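{- Let $(X,d)$ be a Robinson space and $\mathcal T_{PQ}$ be its PQ-tree. Then the call $\mathsf{mmodTree}(\mathcal T_{PQ})$ of the recursive procedure $\mathsf{mmodTree}$ (described in the context) correctly computes the mmodule tree $\mathcal T_M$ of $(X,d)$ in time $O(|X|)$.
   Context: A dissimilarity on a finite set $X$ is a symmetric function $d:X^2\to\mathbb R_{\ge 0}$ with $d(x,y)=0$ if $x=y$; $(X,d)$ is a dissimilarity space. A total order $<$ on $X$ is compatible if $x<y<z$ implies $d(x,z)\ge\max\{d(x,y),d(y,z)\}$. $(X,d)$ is Robinson if it admits a compatible order. An $X$-tree is an ordered rooted tree whose leaves are identified with the elements of $X$ and whose inner nodes have at least 2 children. For a node $\alpha$, $X(\alpha)\subseteq X$ is the set of leaves having $\alpha$ as ancestor (a leaf $x$ has $X(x)=\{x\}$). A node is identified with the subtree rooted at it. A PQ-tree over $X$ is an $X$-tree whose inner nodes are each labelled P-node or Q-node; nodes with exactly 2 children are considered P-nodes. Two PQ-trees are equivalent if one is obtained from the other by a sequence of operations: arbitrarily permuting the children of a P-node; reversing the order of the children of a Q-node. The PQ-tree represents the set of left-to-right leaf orders of all equivalent PQ-trees. The PQ-tree of a Robinson space is the PQ-tree (unique up to equivalence) representing exactly the set of its compatible orders. $P(\beta_1,\dots,\beta_k)$, $Q(\beta_1,\dots,\beta_k)$ denote PQ-trees whose root is a P-node, resp. Q-node, with children $\beta_1,\dots,\beta_k$ in that order; $\cup(\dots)$, $\cap(\dots)$ similarly denote trees whose root is labelled $\cup$, resp. $\cap$.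 For disjoint nodes $\alpha,\beta$ of the PQ-tree, $d(\alpha,\beta)$ is the common value of $d(x,y)$, $x\in X(\alpha)$, $y\in X(\beta)$. An mmodule is a set $M\subseteq X$ such that $d(z,x)=d(z,y)$ for all $z\in X\setminus M$, $x,y\in M$. The mmodule tree $\mathcal T_M$ of a dissimilarity space is the unique (up to reordering children) $X$-tree with inner nodes labelled $\cup$ or $\cap$ such that: (i) each $\cup$-node has at least three children and $X(\beta)$ is an mmodule for each child $\beta$ of it; (ii) each $\cap$-node has at least two children and for any (nonempty) proper subset $\{\beta_1,\dots,\beta_i\}$ of its children, $X(\beta_1)\cup\dots\cup X(\beta_i)$ is an mmodule; (iii) every proper mmodule (nonempty and different from $X$) appears exactly once as in (i) and (ii). A Q-node $\alpha=Q(\beta_1,\dots,\beta_k)$ is $\delta$-conical if it has a child $\beta_i$ (then unique, called the apex child) such that $d(\beta_i,\beta_j)=\delta$ for all $j\ne i$; it is conical if it is $\delta$-conical for some $\delta>0$. For the PQ-tree $T$ of a subspace $(S,d)$, $\rho(T)$ is the unique value $\delta>0$ for which the graph on $S$ with edges $\{xy:x\neq y,\ d(x,y)\ne\delta\}$ is not connected, if it exists, and is undefined otherwise. It is computed as follows: if the root of $T$ is a P-node, $\rho(T)$ is the distance between two distinct children of the root; if the root is a Q-node with children $\beta_1,\dots,\beta_k$, one searches $i\in\{2,\dots,k-1\}$ such that $d(\beta_1,\beta_i)$, $d(\beta_{i-1},\beta_i)$, $d(\beta_i,\beta_{i+1})$ and $d(\beta_i,\beta_k)$ are all equal; then their common value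 is $\rho(T)$ and the root is conical with apex child $\beta_i$; if no such $i$ exists, the root is not conical and $\rho(T)$ is undefined. Procedure $\mathsf{mmodTree}(T)$, where $T$ is the PQ-tree of a subspace of $(X,d)$: - If $T$ is a leaf $x$, return the leaf $x$. - If $T=P(\beta_1,\dots,\beta_k)$, return $\cap(\mathsf{mmodTree}(\beta_1),\dots,\mathsf{mmodTree}(\beta_k))$. - If $T=Q(\beta_1,\dots,\beta_k)$ and the root is not conical, return $\cup(\mathsf{mmodTree}(\beta_1),\dots,\mathsf{mmodTree}(\beta_k))$. - If $T=Q(\beta_1,\dots,\beta_k)$ and the root is conical, let $\rho:=\rho(T)$, let $\beta_i$ be the apex child, and let $T_0:=\cup(\mathsf{mmodTree}(\beta_1),\dots,\mathsf{mmodTree}(\beta_{i-1}),\mathsf{mmodTree}(\beta_{i+1}),\dots,\mathsf{mmodTree}(\beta_k))$, its root being labelled $\cap$ instead of $\cup$ when it has only two children. If $\rho(\beta_i)$ is undefined or $\rho(\beta_i)<\rho$, return $\cap(T_0,\mathsf{mmodTree}(\beta_i))$. Otherwise, let $\gamma_1,\dots,\gamma_\ell$ be the children of $\beta_i$ and return $\cap(T_0,\mathsf{mmodTree}(\gamma_1),\dots,\mathsf{mmodTree}(\gamma_\ell))$. Accessing and comparing values $d(x,y)$ takes constant time. -}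

module Defs where

open import Level using (Level; 0ℓ; _⊔_) renaming (suc to lsuc)
open import Data.Bool.Base using (Bool; true; false; _∧_; if_then_else_)
open import Data.Fin.Base using (Fin; zero; suc)
open import Data.Fin.Permutation using (Permutation′; _⟨$⟩ʳ_)
open import Data.Fin.Subset using (Subset; Nonempty; _∈_; _∉_; _∪_; ⁅_⁆; ⋃; inside; outside)
  renaming (⊥ to ∅; ⊤ to full)
open import Data.List.Base as List using (List)
open import Data.List.Relation.Binary.Permutation.Propositional using (_↭_)
open import Data.List.Relation.Binary.Sublist.Propositional using (_⊆_)
open import Data.Maybe.Base using (Maybe; just; nothing)
import Data.Maybe.Base as Maybe
open import Data.Nat.Base using (ℕ; zero; suc; _+_; _≤_)
open import Data.Product.Base using (∃; _×_; _,_; proj₁; map₂)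
open import Data.Product using (∃!)
open import Data.Unit.Base using (⊤)
open import Data.Vec.Base using (Vec; []; _∷_; head; lookup; reverse; tabulate; _[_]≔_)
open import Function.Bundles using (_⇔_)
open import Relation.Binary.Bundles using (DecTotalOrder)
open import Relation.Binary.Construct.Closure.ReflexiveTransitive using (Star)
open import Relation.Binary.Core using (Rel)
open import Relation.Binary.Structures using (IsStrictTotalOrder)
open import Relation.Binary.PropositionalEquality.Core using (_≡_; _≢_)
open import Relation.Nullary.Decidable.Core using (⌊_⌋)
import Algebra.Construct.NaturalChoice.Max as Max

------------------------------------------------------------------------
-- Dissimilarity spaces on X = Fin n

-- Distances live in an arbitrary decidable total order V with a
-- distinguished element 0#; the intended instance is (ℝ, ≤, 0).  Nothing
-- about dissimilarities uses more of ℝ than its order and 0.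

module _ {c ℓ₁ ℓ₂} (V : DecTotalOrder c ℓ₁ ℓ₂) {n : ℕ} where

  open DecTotalOrder V using (Carrier; _≈_; totalOrder) renaming (_≤_ to _≤ᵛ_)
  open Max totalOrder using () renaming (_⊔_ to max)

  record IsDissimilarity (0# : Carrier) (d : Fin n → Fin n → Carrier) : Set (c ⊔ ℓ₁ ⊔ ℓ₂) where
    field
      nonneg    : ∀ x y → 0# ≤ᵛ d x y
      symmetric : ∀ x y → d x y ≈ d y x
      diagonal  : ∀ x → d x x ≈ 0#

  record IsCompatible (d : Fin n → Fin n → Carrier) (_<_ : Rel (Fin n) 0ℓ) : Set (c ⊔ ℓ₁ ⊔ ℓ₂) where
    field
      isStrictTotalOrder : IsStrictTotalOrder _≡_ _<_
      compatible : ∀ {x y z} → x < y → y < z → max (d x y) (d y z) ≤ᵛ d x z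

  Robinson : (d : Fin n → Fin n → Carrier) → Set (lsuc 0ℓ ⊔ c ⊔ ℓ₁ ⊔ ℓ₂)
  Robinson d = ∃ λ (_<_ : Rel (Fin n) 0ℓ) → IsCompatible d _<_

  Mmodule : (d : Fin n → Fin n → Carrier) → Subset n → Set ℓ₁
  Mmodule d M = ∀ {x y z} → x ∈ M → y ∈ M → z ∉ M → d z x ≈ d z y

------------------------------------------------------------------------
-- Trees

data Tree (L A : Set) : Set where
  leaf : A → Tree L A
  node : L → ∀ {k} → Vec (Tree L A) (2 + k) → Tree L A

module _ {L A : Set} where

  mutual
    leaves : Tree L A → List A
    leaves (leaf x)    = List.[ x ]
    leaves (node _ βs) = leavesAll βs

    leavesAll : ∀ {k} → Vec (Tree L A) k → List A
    leavesAll []       = List.[]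
    leavesAll (β ∷ βs) = leaves β List.++ leavesAll βs

  -- A value of InnerNode T l βs is the position of an inner node of T whose
  -- label is l and whose list of children is βs.
  data InnerNode : Tree L A → L → ∀ {k} → Vec (Tree L A) (2 + k) → Set where
    root  : ∀ {l k} {βs : Vec (Tree L A) (2 + k)} → InnerNode (node l βs) l βs
    below : ∀ {m j} {αs : Vec (Tree L A) (2 + j)} {l k} {βs : Vec (Tree L A) (2 + k)} →
            (i : Fin (2 + j)) → InnerNode (lookup αs i) l βs → InnerNode (node m αs) l βs

module _ {L : Set} {n : ℕ} where

  IsXTree : Tree L (Fin n) → Set
  IsXTree T = leaves T ↭ List.allFin n

  -- X α is the set written X(α); ⋃X βs S is the union of the X(βⱼ) for j ∈ S.
  X : Tree L (Fin n) → Subset n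
  X α = ⋃ (List.map ⁅_⁆ (leaves α))

  ⋃X : ∀ {k} → Vec (Tree L (Fin n)) k → Subset k → Subset n
  ⋃X []       []            = ∅
  ⋃X (β ∷ βs) (inside  ∷ S) = X β ∪ ⋃X βs S
  ⋃X (β ∷ βs) (outside ∷ S) = ⋃X βs S

------------------------------------------------------------------------
-- PQ-trees

data PQ : Set where
  P Q : PQ

-- A Q-labelled node with two children is allowed; since reversing two
-- children is the same as permuting them, it behaves as a P-node below, and
-- the algorithm treats it as one.
PQTree : ℕ → Set
PQTree n = Tree PQ (Fin n)

data _⟶_ {n} : Rel (PQTree n) 0ℓ where
  permuteP : ∀ {k} {βs : Vec (PQTree n) (2 + k)} (π : Permutation′ (2 + k)) →
             node P βs ⟶ node P (tabulate λ i → lookup βs (π ⟨$⟩ʳ i))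
  reverseQ : ∀ {k} {βs : Vec (PQTree n) (2 + k)} →
             node Q βs ⟶ node Q (reverse βs)
  inChild  : ∀ {l k} {βs : Vec (PQTree n) (2 + k)} (i : Fin (2 + k)) {β′} →
             lookup βs i ⟶ β′ → node l βs ⟶ node l (βs [ i ]≔ β′)

_≅_ : ∀ {n} → Rel (PQTree n) 0ℓ
_≅_ = Star _⟶_

-- x comes before y in the left-to-right order of the leaves.
LeafOrder : ∀ {n} → PQTree n → Rel (Fin n) 0ℓ
LeafOrder T x y = (x List.∷ y List.∷ List.[]) ⊆ leaves T

record IsPQTreeOf {c ℓ₁ ℓ₂} (V : DecTotalOrder c ℓ₁ ℓ₂) {n}
                  (d : Fin n → Fin n → DecTotalOrder.Carrier V)
                  (T : PQTree n) : Set (lsuc 0ℓ ⊔ c ⊔ ℓ₁ ⊔ ℓ₂) where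
  field
    isXTree    : IsXTree T
    represents : (_<_ : Rel (Fin n) 0ℓ) →
                 IsCompatible V d _<_ ⇔
                 (∃ λ T′ → T ≅ T′ × (∀ x y → x < y ⇔ LeafOrder T′ x y))

------------------------------------------------------------------------
-- Mmodule trees

data ∪∩ : Set where
  ∪ₙ ∩ₙ : ∪∩

MTree : ℕ → Set
MTree n = Tree ∪∩ (Fin n)

ProperNonempty : ∀ {k} → Subset k → Set
ProperNonempty S = Nonempty S × S ≢ full

-- The places of T at which a set can appear: a child of a ∪-node, or a
-- nonempty proper set of children of a ∩-node (nonemptiness and properness
-- are kept apart, in Admissible, so that _≡_ on places compares data only).
data Place {n} (T : MTree n) : Set where
  child∪    : ∀ {k} {βs : Vec (MTree n) (2 + k)} →
              InnerNode T ∪ₙ βs → Fin (2 + k) → Place T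
  children∩ : ∀ {k} {βs : Vec (MTree n) (2 + k)} →
              InnerNode T ∩ₙ βs → Subset (2 + k) → Place T

module _ {n} {T : MTree n} where

  Admissible : Place T → Set
  Admissible (child∪ _ _)    = ⊤
  Admissible (children∩ _ S) = ProperNonempty S

  setAt : Place T → Subset n
  setAt (child∪    {βs = βs} _ j) = X (lookup βs j)
  setAt (children∩ {βs = βs} _ S) = ⋃X βs S

record IsMmoduleTree {c ℓ₁ ℓ₂} (V : DecTotalOrder c ℓ₁ ℓ₂) {n}
                     (d : Fin n → Fin n → DecTotalOrder.Carrier V)
                     (T : MTree n) : Set (c ⊔ ℓ₁ ⊔ ℓ₂) where
  field
    isXTree  : IsXTree T
    ∪-nodes  : ∀ {k} {βs : Vec (MTree n) (2 + k)} → InnerNode T ∪ₙ βs →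
               3 ≤ 2 + k × (∀ j → Mmodule V d (X (lookup βs j)))
    ∩-nodes  : ∀ {k} {βs : Vec (MTree n) (2 + k)} → InnerNode T ∩ₙ βs →
               ∀ S → ProperNonempty S → Mmodule V d (⋃X βs S)
    complete : ∀ M → Mmodule V d M → ProperNonempty M →
               ∃! _≡_ λ (p : Place T) → Admissible p × setAt p ≡ M

------------------------------------------------------------------------
-- Computations with a running time

record Timed {a} (A : Set a) : Set a where
  constructor _costing_
  field
    value : A
    cost  : ℕ

open Timed public

infixl 1 _>>=_
_>>=_ : ∀ {a b} {A : Set a} {B : Set b} → Timed A → (A → Timed B) → Timed B
m >>= f = value (f (value m)) costing (cost m + cost (f (value m)))

return : ∀ {a} {A : Set a} → A → Timed A
return x = x costing 0

step : ∀ {a} {A : Set a} → Timed A → Timed A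
step m = value m costing suc (cost m)

-- Cost model: one unit for every access to d, one for every comparison of
-- two distances, and one for every call of a function below with result in
-- Timed (the `step' heading each of its clauses).  Apart from such calls, a
-- clause performs a bounded number of constant-time operations: matching on
-- or building a constructor, and reading the label or stored leaf of a node.

------------------------------------------------------------------------
-- The procedure mmodTree

-- For nodes α and β, d(α,β) is read off at one leaf of each.  To have such a
-- leaf at hand in constant time, each inner node is first annotated with one
-- of its leaves.  The annotation pass is part of the running time.
ATree : ℕ → Set
ATree n = Tree (PQ × Fin n) (Fin n)

someLeaf : ∀ {n} → ATree n → Fin n
someLeaf (leaf x)         = x
someLeaf (node (_ , x) _) = x

mutual
  annotate : ∀ {n} → PQTree n → Timed (ATree n)
  annotate (leaf x)    = step (return (leaf x))
  annotate (node l βs) = step do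
    αs ← annotateAll βs
    return (node (l , someLeaf (head αs)) αs)

  annotateAll : ∀ {n k} → Vec (PQTree n) k → Timed (Vec (ATree n) k)
  annotateAll []       = step (return [])
  annotateAll (β ∷ βs) = step do
    α  ← annotate β
    αs ← annotateAll βs
    return (α ∷ αs)

lastChild : ∀ {n k} → Vec (ATree n) (suc k) → Timed (ATree n)
lastChild (β ∷ [])           = step (return β)
lastChild (_ ∷ βs@(_ ∷ _))   = step (lastChild βs)

module _ {c ℓ₁ ℓ₂} (V : DecTotalOrder c ℓ₁ ℓ₂) {n}
         (d : Fin n → Fin n → DecTotalOrder.Carrier V) where

  open DecTotalOrder V using (Carrier; _≟_; _≤?_)

  dist : ATree n → ATree n → Timed Carrier
  dist α β = step (return (d (someLeaf α) (someLeaf β)))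

  equal? : Carrier → Carrier → Timed Bool
  equal? u v = step (return ⌊ u ≟ v ⌋)

  atMost? : Carrier → Carrier → Timed Bool
  atMost? u v = step (return ⌊ u ≤? v ⌋)

  -- scan β₁ βₖ βᵢ₋₁ (βᵢ ∷ … ∷ βₖ ∷ []) looks for the first i′ with i ≤ i′ < k
  -- for which d(β₁,βᵢ′), d(βᵢ′₋₁,βᵢ′), d(βᵢ′,βᵢ′₊₁) and d(βᵢ′,βₖ) are all equal,
  -- and returns their common value and the position of βᵢ′ in its last argument.
  scan : ∀ {k} (β₁ βₖ prev : ATree n) → Vec (ATree n) (suc k) →
         Timed (Maybe (Carrier × Fin (suc k)))
  scan β₁ βₖ prev (_ ∷ [])                = step (return nothing)
  scan β₁ βₖ prev (β ∷ βs@(next ∷ _)) = step do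
    δ₁ ← dist β₁ β
    δ₂ ← dist prev β
    δ₃ ← dist β next
    δ₄ ← dist β βₖ
    e₁ ← equal? δ₁ δ₂
    e₂ ← equal? δ₂ δ₃
    e₃ ← equal? δ₃ δ₄
    if e₁ ∧ e₂ ∧ e₃
      then return (just (δ₁ , zero))
      else (do
        r ← scan β₁ βₖ β βs
        return (Maybe.map (map₂ suc) r))

  -- For the children of a Q-node: if the node is conical, its apex child and
  -- the distance δ from it to the other children.  The search does not test
  -- δ > 0.  This matters only if distinct points may be at distance 0: for
  -- d(1,2) = d(2,3) = 0 < d(1,3), the set {1,3} is an mmodule, which would be
  -- missed if the root Q(1,2,3) were treated as not conical.
  findApex : ∀ {k} → Vec (ATree n) (3 + k) → Timed (Maybe (Carrier × Fin (3 + k)))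
  findApex (β₁ ∷ βs) = step do
    βₖ ← lastChild βs
    r  ← scan β₁ βₖ β₁ βs
    return (Maybe.map (map₂ suc) r)

  -- nothing stands for an undefined ρ.
  ρ : ATree n → Timed (Maybe Carrier)
  ρ (leaf _)                               = step (return nothing)
  ρ (node (P , _) (β₁ ∷ β₂ ∷ _))           = step do
    δ ← dist β₁ β₂
    return (just δ)
  ρ (node (Q , _) {zero} (β₁ ∷ β₂ ∷ []))   = step do
    δ ← dist β₁ β₂
    return (just δ)
  ρ (node (Q , _) {suc _} βs)              = step do
    r ← findApex βs
    return (Maybe.map proj₁ r)

  -- false when the second argument is undefined or less than the first.
  reaches? : Carrier → Maybe Carrier → Timed Bool
  reaches? δ nothing   = step (return false)
  reaches? δ (just δ′) = step (atMost? δ δ′)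

  withoutApex : ∀ {k} → Vec (MTree n) (2 + k) → MTree n
  withoutApex {zero}  Ts = node ∩ₙ Ts
  withoutApex {suc _} Ts = node ∪ₙ Ts

  mutual
    mmod : ATree n → Timed (MTree n)
    mmod (leaf x)                    = step (return (leaf x))
    mmod (node (P , _) βs)           = step do
      Ts ← mmodAll βs
      return (node ∩ₙ Ts)
    mmod (node (Q , _) {zero} βs)    = step do
      Ts ← mmodAll βs
      return (node ∩ₙ Ts)
    mmod (node (Q , _) {suc _} βs)   = step do
      apex ← findApex βs
      mmodQ apex βs

    mmodQ : ∀ {k} → Maybe (Carrier × Fin (3 + k)) → Vec (ATree n) (3 + k) → Timed (MTree n)
    mmodQ nothing        βs = step do
      Ts ← mmodAll βs
      return (node ∪ₙ Ts)
    mmodQ (just (δ , i)) βs = step do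
      Ts ← mmodAllBut i βs
      mmodApex δ (withoutApex Ts) i βs

    mmodAll : ∀ {k} → Vec (ATree n) k → Timed (Vec (MTree n) k)
    mmodAll []       = step (return [])
    mmodAll (β ∷ βs) = step do
      T  ← mmod β
      Ts ← mmodAll βs
      return (T ∷ Ts)

    mmodAllBut : ∀ {k} → Fin (suc k) → Vec (ATree n) (suc k) → Timed (Vec (MTree n) k)
    mmodAllBut         zero    (_ ∷ βs) = step (mmodAll βs)
    mmodAllBut {suc _} (suc i) (β ∷ βs) = step do
      T  ← mmod β
      Ts ← mmodAllBut i βs
      return (T ∷ Ts)

    -- mmodApex δ T₀ i βs is the result for a conical node with children βs,
    -- apex child βᵢ and ρ = δ; the index i only serves to reach βᵢ by
    -- structural recursion.
    mmodApex : ∀ {k} → Carrier → MTree n → Fin k → Vec (ATree n) k → Timed (MTree n)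
    mmodApex δ T₀ (suc i) (_ ∷ βs) = step (mmodApex δ T₀ i βs)
    mmodApex δ T₀ zero    (β ∷ _)  = step do
      δ′    ← ρ β
      merge ← reaches? δ δ′
      attach merge T₀ β

    attach : Bool → MTree n → ATree n → Timed (MTree n)
    attach false T₀ β           = step do
      T ← mmod β
      return (node ∩ₙ (T₀ ∷ T ∷ []))
    attach true  T₀ (node _ γs) = step do
      Ts ← mmodAll γs
      return (node ∩ₙ (T₀ ∷ Ts))
    -- never reached: ρ is undefined on leaves
    attach true  T₀ (leaf x)    = step (return (node ∩ₙ (T₀ ∷ leaf x ∷ [])))

  mmodTree : PQTree n → Timed (MTree n)
  mmodTree T = step do
    α ← annotate T
    mmod α

{-# OPTIONS --safe #-}

-- By soundness of the PQ-tree, distances between two children of a node are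
-- constant, and the children of a P-node are pairwise at one distance δ.  By
-- completeness, every compatible rearrangement of the leaves below a node keeps
-- its children together and, at a Q-node, keeps their order up to reversal; so
-- exhibiting a compatible rearrangement that violates this is a contradiction.
-- Under a P-node, a module meeting two children must be a union of children, as
-- a child it splits could be torn apart.  Under a Q-node, the interval spanned by
-- a module can be reversed, so a proper module M meeting two children contains
-- the first and the last leaf; by monotonicity all leaves outside M are at the
-- same distance δ from M, so they form a module, which misses the ends and hence
-- lies in a single child: the apex.  A δ-apex of a node of diameter at most δ
-- could be moved to an end, which makes the apex interior and excludes that an
-- apex child with ρ = δ is again a conical Q-node.  The running time is amortised
-- against the number of leaves.

module Submission where

open import Defs
open import Level using (Level; 0ℓ; _⊔_)
open import Data.Bool.Base using (Bool; true; false; _∧_; if_then_else_)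
open import Data.Empty using (⊥; ⊥-elim)
open import Data.Fin.Base as Fin using (Fin; zero; suc; opposite; punchIn; punchOut; fromℕ; inject₁; toℕ)
import Data.Fin.Properties as Fin
open import Data.Fin.Permutation using (Permutation′; _⟨$⟩ʳ_; _⟨$⟩ˡ_; transpose)
import Data.Fin.Permutation as Perm
open import Data.Fin.Subset using (Subset; Nonempty; _∈_; _∉_; ∁; ⁅_⁆; ⋃; inside; outside) renaming (⊤ to full)
import Data.Fin.Subset.Properties as Sub
open import Data.Fin.Subset.Properties using (_∈?_)
open import Data.List.Base as List using (List; []; _∷_; _++_; filter; length)
open import Data.List.Membership.Propositional using (find) renaming (_∈_ to _∈ˡ_)
open import Data.List.Membership.Propositional.Properties using (∈-++⁺ˡ; ∈-++⁺ʳ; ∈-++⁻; ∈-filter⁺; ∈-filter⁻; ∈-allFin)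
import Data.List.Properties as List
open import Data.List.Relation.Binary.Permutation.Propositional using (_↭_; ↭-refl; ↭-sym; ↭-trans; ↭-reflexive; prep; ↭⇒↭ₛ)
import Data.List.Relation.Binary.Permutation.Propositional.Properties as Perm↭
open Perm↭ using (∈-resp-↭)
import Data.List.Relation.Binary.Permutation.Setoid.Properties as Permₛ
open import Data.List.Relation.Binary.Sublist.Propositional using (_⊆_; []; _∷_; _∷ʳ_; ⊆-refl; ⊆-trans; to∈; from∈)
import Data.List.Relation.Binary.Sublist.Propositional as Sublist
import Data.List.Relation.Binary.Sublist.Propositional.Properties as Sublist
open import Data.List.Relation.Unary.All as All using (All; []; _∷_)
open import Data.List.Relation.Unary.All.Properties using (¬All⇒Any¬)
open import Data.List.Relation.Unary.AllPairs using ([]; _∷_)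
open import Data.List.Relation.Unary.Any using (Any; here; there; any?)
import Data.List.Relation.Unary.Any.Properties as Any
open import Data.List.Relation.Unary.Unique.Propositional using (Unique)
import Data.List.Relation.Unary.Unique.Propositional.Properties as Unique
open import Data.Maybe.Base as Maybe using (Maybe; just; nothing)
open import Data.Nat.Base as ℕ using (ℕ; zero; suc; _+_; _*_; _≤_; z≤n; s≤s)
import Data.Nat.Properties as ℕ
open import Data.Nat.Tactic.RingSolver using (solve-∀)
open import Data.Product.Base using (∃; ∃₂; _×_; _,_; proj₁; proj₂; map₂)
open import Data.Sum.Base as Sum using (_⊎_; inj₁; inj₂; [_,_]′)
open import Data.Unit.Base using (tt)
open import Data.Vec.Base as Vec using (Vec; []; _∷_; lookup; reverse; tabulate; _[_]≔_; removeAt)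
import Data.Vec.Properties as Vec
open import Function.Base using (_∘_; id; case_of_)
open import Function.Bundles using (mk⇔; Equivalence)
open import Relation.Binary.Bundles using (DecTotalOrder)
open import Relation.Binary.Construct.Closure.ReflexiveTransitive using (ε; _◅_; gmap)
open import Relation.Binary.Core using (Rel)
open import Relation.Binary.Definitions using (Tri; tri<; tri≈; tri>)
open import Relation.Binary.PropositionalEquality.Core using (_≡_; _≢_; refl; sym; trans; cong; cong₂; subst; subst₂)
open import Relation.Binary.PropositionalEquality.Properties using (setoid; isEquivalence; module ≡-Reasoning)
open import Relation.Nullary.Decidable using (Dec; yes; no; ¬?; _×-dec_; _⊎-dec_; dec-true; dec-false; decidable-stable)
open import Relation.Nullary.Negation.Core using (¬_; contradiction)
open import Relation.Unary using (Pred; Decidable)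
import Algebra.Construct.NaturalChoice.Max as Max

-- Being the PQ-tree of a space is a statement on total orders of all of X, so it does not pass to
-- subtrees. The induction runs on `Good` instead, which speaks of lists of the leaves below one
-- node: `comp` makes every equivalent arrangement compatible, and `fits` says that a compatible
-- rearrangement respects the tree. Its conclusion `Fits` records only what is forbidden, namely to
-- interleave a child with its siblings or to change which of three children of a Q-node is the
-- middle one, so that a single triple of leaves refutes it.
--
-- Merging the children of an apex child skips a level of the tree, so correctness is proved for a
-- node together with its children. Existence of a place for each module is inductive; uniqueness is
-- a separate statement on trees with distinct leaves.
--
-- As to time, inner nodes have at least two children, so a fixed reserve left over by each subtree
-- can pay for the work at its parent. A Q-node is searched for an apex at most twice: once by
-- `mmod` and once by `ρ`, called from its parent.

Before : ∀ {A : Set} → List A → Rel A 0ℓ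
Before xs x y = (x ∷ y ∷ []) ⊆ xs

-- Relative order of entries in lists without repetition

module _ {A : Set} where

  Unique-resp-⊇ : ∀ {xs ys : List A} → xs ⊆ ys → Unique ys → Unique xs
  Unique-resp-⊇ []         u       = []
  Unique-resp-⊇ (_ ∷ʳ p)   (_ ∷ u) = Unique-resp-⊇ p u
  Unique-resp-⊇ (refl ∷ p) (a ∷ u) = Sublist.All-resp-⊆ p a ∷ Unique-resp-⊇ p u

  Unique-resp-↭ : ∀ {xs ys : List A} → xs ↭ ys → Unique xs → Unique ys
  Unique-resp-↭ p = Permₛ.Unique-resp-↭ (setoid A) (↭⇒↭ₛ p)

  Before-irrefl : ∀ {xs : List A} {x} → Unique xs → ¬ Before xs x x
  Before-irrefl (_ ∷ u) (_ ∷ʳ p)   = Before-irrefl u p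
  Before-irrefl (a ∷ _) (refl ∷ p) = All.lookup a (to∈ p) refl

  irrefl⇒Unique : ∀ {xs : List A} → (∀ {x} → ¬ Before xs x x) → Unique xs
  irrefl⇒Unique {[]}     irr = []
  irrefl⇒Unique {x ∷ xs} irr =
    All.tabulate (λ { {y} y∈xs refl → irr (refl ∷ from∈ y∈xs) }) ∷
    irrefl⇒Unique (λ p → irr (x ∷ʳ p))

  Before-∈ˡ : ∀ {xs : List A} {x y} → Before xs x y → x ∈ˡ xs
  Before-∈ˡ p = Sublist.lookup p (here refl)

  Before-∈ʳ : ∀ {xs : List A} {x y} → Before xs x y → y ∈ˡ xs
  Before-∈ʳ p = Sublist.lookup p (there (here refl))

  Before-chain : ∀ {xs : List A} {x y z} → Unique xs → Before xs x y → Before xs y z → (x ∷ y ∷ z ∷ []) ⊆ xs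
  Before-chain (_ ∷ u) (w ∷ʳ p)   (.w ∷ʳ q)  = w ∷ʳ Before-chain u p q
  Before-chain (a ∷ _) (w ∷ʳ p)   (refl ∷ q) = contradiction refl (All.lookup a (Before-∈ʳ p))
  Before-chain (a ∷ _) (refl ∷ p) (_ ∷ʳ q)   = refl ∷ q
  Before-chain (a ∷ _) (refl ∷ p) (refl ∷ q) = contradiction refl (All.lookup a (to∈ p))

  Before-trans : ∀ {xs : List A} {x y z} → Unique xs → Before xs x y → Before xs y z → Before xs x z
  Before-trans u p q = ⊆-trans (refl ∷ _ ∷ʳ ⊆-refl) (Before-chain u p q)

  Before-asym : ∀ {xs : List A} {x y} → Unique xs → Before xs x y → ¬ Before xs y x
  Before-asym u p q = Before-irrefl u (Before-trans u p q)

  Before-cmp : ∀ {xs : List A} {x y} → x ∈ˡ xs → y ∈ˡ xs → x ≡ y ⊎ Before xs x y ⊎ Before xs y x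
  Before-cmp (here refl) (here refl) = inj₁ refl
  Before-cmp (here refl) (there q)   = inj₂ (inj₁ (refl ∷ from∈ q))
  Before-cmp (there p)   (here refl) = inj₂ (inj₂ (refl ∷ from∈ p))
  Before-cmp (there p)   (there q)   = Sum.map₂ (Sum.map (_ ∷ʳ_) (_ ∷ʳ_)) (Before-cmp p q)

  Before-++ : ∀ {xs ys : List A} {x y} → x ∈ˡ xs → y ∈ˡ ys → Before (xs ++ ys) x y
  Before-++ p q = Sublist.++⁺ (from∈ p) (from∈ q)

  Before-reverse : ∀ {xs : List A} {x y} → Before xs x y → Before (List.reverse xs) y x
  Before-reverse p = Sublist.reverse⁺ p

  ⊆-++⁻ : ∀ {zs} (xs : List A) {ys} → zs ⊆ xs ++ ys →
          ∃₂ λ us vs → zs ≡ us ++ vs × us ⊆ xs × vs ⊆ ys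
  ⊆-++⁻ []       p          = [] , _ , refl , [] , p
  ⊆-++⁻ (x ∷ xs) (.x ∷ʳ p)  = let us , vs , e , q , r = ⊆-++⁻ xs p in us , vs , e , x ∷ʳ q , r
  ⊆-++⁻ (x ∷ xs) (refl ∷ p) = let us , vs , e , q , r = ⊆-++⁻ xs p in x ∷ us , vs , cong (x ∷_) e , refl ∷ q , r

  -- Compatibility is a condition on triples; on a concatenation it is checked by cases on where the
  -- triple is cut.
  data Split₃ (xs ys : List A) (x y z : A) : Set where
    s₃₀ : (x ∷ y ∷ z ∷ []) ⊆ xs → Split₃ xs ys x y z
    s₂₁ : Before xs x y → z ∈ˡ ys → Split₃ xs ys x y z
    s₁₂ : x ∈ˡ xs → Before ys y z → Split₃ xs ys x y z
    s₀₃ : (x ∷ y ∷ z ∷ []) ⊆ ys → Split₃ xs ys x y z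

  split₃ : ∀ xs {ys} {x y z} → (x ∷ y ∷ z ∷ []) ⊆ xs ++ ys → Split₃ xs ys x y z
  split₃ xs p with ⊆-++⁻ xs p
  ... | []                , _ , refl , q , r = s₀₃ r
  ... | _ ∷ []            , _ , refl , q , r = s₁₂ (to∈ q) r
  ... | _ ∷ _ ∷ []        , _ , refl , q , r = s₂₁ q (to∈ r)
  ... | _ ∷ _ ∷ _ ∷ []    , _ , refl , q , r = s₃₀ q
  ... | _ ∷ _ ∷ _ ∷ _ ∷ _ , _ , ()   , q , r

  data Split₂ (xs ys : List A) (x y : A) : Set where
    s₂₀ : Before xs x y → Split₂ xs ys x y
    s₁₁ : x ∈ˡ xs → y ∈ˡ ys → Split₂ xs ys x y
    s₀₂ : Before ys x y → Split₂ xs ys x y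

  split₂ : ∀ xs {ys} {x y} → Before (xs ++ ys) x y → Split₂ xs ys x y
  split₂ xs p with ⊆-++⁻ xs p
  ... | []            , _ , refl , q , r = s₀₂ r
  ... | _ ∷ []        , _ , refl , q , r = s₁₁ (to∈ q) (to∈ r)
  ... | _ ∷ _ ∷ []    , _ , refl , q , r = s₂₀ q
  ... | _ ∷ _ ∷ _ ∷ _ , _ , ()   , q , r

  module _ {P : Pred A 0ℓ} (P? : Decidable P) where

    first : ∀ {xs x} → x ∈ˡ xs → P x →
            ∃₂ λ pre h → ∃ λ post → xs ≡ pre ++ h ∷ post × P h × (∀ {z} → z ∈ˡ pre → ¬ P z)
    first {w ∷ xs} x∈ px with P? w
    first {w ∷ xs} x∈ px | yes pw = [] , w , xs , refl , pw , λ ()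
    first {w ∷ xs} (here refl) px | no ¬pw = contradiction px ¬pw
    first {w ∷ xs} (there x∈) px | no ¬pw with first x∈ px
    ... | pre , h , post , refl , ph , out =
      w ∷ pre , h , post , refl , ph , λ { (here refl) → ¬pw ; (there z∈) → out z∈ }

    last : ∀ {xs x} → x ∈ˡ xs → P x →
           ∃₂ λ pre l → ∃ λ post → xs ≡ pre ++ l ∷ post × P l × (∀ {z} → z ∈ˡ post → ¬ P z)
    last {xs} x∈ px with first (Any.reverse⁺ x∈) px
    ... | pre , l , post , eq , pl , out =
      List.reverse post , l , List.reverse pre , eq′ , pl , λ z∈ → out (Any.reverse⁻ z∈)
      where
      open ≡-Reasoning
      eq′ : xs ≡ List.reverse post ++ l ∷ List.reverse pre
      eq′ = begin
        xs                                                   ≡⟨ List.reverse-involutive xs ⟨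
        List.reverse (List.reverse xs)                       ≡⟨ cong List.reverse eq ⟩
        List.reverse (pre ++ l ∷ post)                       ≡⟨ List.reverse-++ pre (l ∷ post) ⟩
        List.reverse (l ∷ post) ++ List.reverse pre          ≡⟨ cong (_++ List.reverse pre) (List.unfold-reverse l post) ⟩
        (List.reverse post List.∷ʳ l) ++ List.reverse pre    ≡⟨ List.∷ʳ-++ (List.reverse post) l (List.reverse pre) ⟩
        List.reverse post ++ l ∷ List.reverse pre            ∎

    -- `H` is the smallest interval around the entries satisfying `P`, so its two ends `h` and `e`
    -- satisfy `P`, while entries strictly between them need not.
    span : ∀ {xs x} → x ∈ˡ xs → P x → ∃₂ λ pre H → ∃ λ post → xs ≡ pre ++ H ++ post ×
           (∀ {z} → z ∈ˡ pre ⊎ z ∈ˡ post → ¬ P z) ×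
           (∃ λ h → h ∈ˡ H × P h × (∀ {z} → z ∈ˡ H → z ≡ h ⊎ Before H h z)) ×
           (∃ λ e → e ∈ˡ H × P e × (∀ {z} → z ∈ˡ H → z ≡ e ⊎ Before H z e))
    span x∈ px with first x∈ px
    ... | pre , h , r , refl , ph , outˡ with last (here refl) ph
    ...   | init , e , post , eq , pe , outʳ =
      pre , init ++ e ∷ [] , post ,
      cong (pre ++_) (trans eq (sym (List.++-assoc init (e ∷ []) post))) ,
      [ outˡ , outʳ ]′ ,
      (h , h∈ init eq , ph , fromFirst init eq) ,
      (e , ∈-++⁺ʳ init (here refl) , pe , toLast)
      where
      h∈ : ∀ init → h ∷ r ≡ init ++ e ∷ post → h ∈ˡ init ++ e ∷ []
      h∈ []      refl = here refl
      h∈ (_ ∷ _) refl = here refl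
      fromFirst : ∀ init → h ∷ r ≡ init ++ e ∷ post → ∀ {z} → z ∈ˡ init ++ e ∷ [] → z ≡ h ⊎ Before (init ++ e ∷ []) h z
      fromFirst []      refl (here refl) = inj₁ refl
      fromFirst (_ ∷ _) refl (here refl) = inj₁ refl
      fromFirst (_ ∷ _) refl (there z∈)  = inj₂ (refl ∷ from∈ z∈)
      toLast : ∀ {z} → z ∈ˡ init ++ e ∷ [] → z ≡ e ⊎ Before (init ++ e ∷ []) z e
      toLast z∈ with ∈-++⁻ init z∈
      ... | inj₁ q           = inj₂ (Before-++ q (here refl))
      ... | inj₂ (here refl) = inj₁ refl

    filter-↭ : ∀ xs → filter P? xs ++ filter (¬? ∘ P?) xs ↭ xs
    filter-↭ []       = ↭-refl
    filter-↭ (x ∷ xs) with P? x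
    ... | yes _ = prep x (filter-↭ xs)
    ... | no  _ = ↭-trans (Perm↭.shift x (filter P? xs) _) (prep x (filter-↭ xs))

-- Leaves of trees

infix 4 _∈ᵀ_

_∈ᵀ_ : ∀ {L A : Set} → A → Tree L A → Set
x ∈ᵀ T = x ∈ˡ leaves T

module _ {L A : Set} where

  module _ {p} {P : Tree L A → Set p} (pl : ∀ x → P (leaf x))
           (pn : ∀ l {k} (βs : Vec (Tree L A) (2 + k)) → (∀ i → P (lookup βs i)) → P (node l βs)) where

    -- Children are stored in a vector, and a recursive call on `lookup βs i` is not structural; the
    -- companion over vectors supplies the induction hypothesis at every position.
    Tree-ind  : ∀ T → P T
    Tree-ind′ : ∀ {k} (βs : Vec (Tree L A) k) → ∀ i → P (lookup βs i)
    Tree-ind (leaf x)    = pl x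
    Tree-ind (node l βs) = pn l βs (Tree-ind′ βs)
    Tree-ind′ (β ∷ βs) zero    = Tree-ind β
    Tree-ind′ (β ∷ βs) (suc i) = Tree-ind′ βs i

  leavesAll⁺ : ∀ {k} (βs : Vec (Tree L A) k) i {x} → x ∈ᵀ lookup βs i → x ∈ˡ leavesAll βs
  leavesAll⁺ (β ∷ βs) zero    p = ∈-++⁺ˡ p
  leavesAll⁺ (β ∷ βs) (suc i) p = ∈-++⁺ʳ (leaves β) (leavesAll⁺ βs i p)

  leavesAll⁻ : ∀ {k} (βs : Vec (Tree L A) k) {x} → x ∈ˡ leavesAll βs → ∃ λ i → x ∈ᵀ lookup βs i
  leavesAll⁻ (β ∷ βs) p with ∈-++⁻ (leaves β) p
  ... | inj₁ q = zero , q
  ... | inj₂ q = let i , r = leavesAll⁻ βs q in suc i , r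

  leaves-⊆ : ∀ {k} (βs : Vec (Tree L A) k) i → leaves (lookup βs i) ⊆ leavesAll βs
  leaves-⊆ (β ∷ βs) zero    = Sublist.++⁺ʳ (leavesAll βs) ⊆-refl
  leaves-⊆ (β ∷ βs) (suc i) = Sublist.++⁺ˡ (leaves β) (leaves-⊆ βs i)

  leaves-⊆₂ : ∀ {k} (βs : Vec (Tree L A) k) {i j} → i Fin.< j →
              leaves (lookup βs i) ++ leaves (lookup βs j) ⊆ leavesAll βs
  leaves-⊆₂ (β ∷ βs) {zero}  {suc j} _       = Sublist.++⁺ ⊆-refl (leaves-⊆ βs j)
  leaves-⊆₂ (β ∷ βs) {suc i} {suc j} (s≤s p) = Sublist.++⁺ˡ (leaves β) (leaves-⊆₂ βs p)

  leaves-⊆₃ : ∀ {k} (βs : Vec (Tree L A) k) {i j m} → i Fin.< j → j Fin.< m →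
              leaves (lookup βs i) ++ leaves (lookup βs j) ++ leaves (lookup βs m) ⊆ leavesAll βs
  leaves-⊆₃ (β ∷ βs) {zero}  {suc j} {suc m} _       (s≤s q) = Sublist.++⁺ ⊆-refl (leaves-⊆₂ βs q)
  leaves-⊆₃ (β ∷ βs) {suc i} {suc j} {suc m} (s≤s p) (s≤s q) = Sublist.++⁺ˡ (leaves β) (leaves-⊆₃ βs p q)

  leavesAll-before : ∀ {k} (βs : Vec (Tree L A) k) {i j x y} → i Fin.< j →
                     x ∈ᵀ lookup βs i → y ∈ᵀ lookup βs j → Before (leavesAll βs) x y
  leavesAll-before βs i<j x∈ y∈ = ⊆-trans (Before-++ x∈ y∈) (leaves-⊆₂ βs i<j)

  sameChild : ∀ {k} (βs : Vec (Tree L A) k) → Unique (leavesAll βs) →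
              ∀ {i j x} → x ∈ᵀ lookup βs i → x ∈ᵀ lookup βs j → i ≡ j
  sameChild βs u {i} {j} p q with Fin.<-cmp i j
  ... | tri≈ _ e _ = e
  ... | tri< l _ _ = contradiction (leavesAll-before βs l p q) (Before-irrefl u)
  ... | tri> _ _ l = contradiction (leavesAll-before βs l q p) (Before-irrefl u)

  Before-≤ : ∀ {k} (βs : Vec (Tree L A) k) → Unique (leavesAll βs) →
             ∀ {i j x y} → x ∈ᵀ lookup βs i → y ∈ᵀ lookup βs j → Before (leavesAll βs) x y → i Fin.≤ j
  Before-≤ βs u {i} {j} p q b with Fin.<-cmp j i
  ... | tri< l _ _ = contradiction (leavesAll-before βs l q p) (Before-asym u b)
  ... | tri≈ _ refl _ = ℕ.≤-refl
  ... | tri> _ _ l = ℕ.<⇒≤ l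

  leavesAll-split : ∀ {k} (βs : Vec (Tree L A) k) i → ∃₂ λ pre post →
    leavesAll βs ≡ pre ++ leaves (lookup βs i) ++ post ×
    (∀ {x} → x ∈ˡ pre ⊎ x ∈ˡ post → ∃ λ j → j ≢ i × x ∈ᵀ lookup βs j)
  leavesAll-split (β ∷ βs) zero    = [] , leavesAll βs , refl ,
    λ { (inj₂ p) → let j , q = leavesAll⁻ βs p in suc j , (λ ()) , q }
  leavesAll-split (β ∷ βs) (suc i) with leavesAll-split βs i
  ... | pre , post , eq , out =
    leaves β ++ pre , post ,
    trans (cong (leaves β ++_) eq) (sym (List.++-assoc (leaves β) pre _)) , out′
    where
    lift : ∀ {x} → (∃ λ j → j ≢ i × x ∈ᵀ lookup βs j) → ∃ λ j → j ≢ suc i × x ∈ᵀ lookup (β ∷ βs) j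
    lift (j , j≢i , q) = suc j , j≢i ∘ Fin.suc-injective , q
    out′ : ∀ {x} → x ∈ˡ leaves β ++ pre ⊎ x ∈ˡ post → ∃ λ j → j ≢ suc i × x ∈ᵀ lookup (β ∷ βs) j
    out′ (inj₂ p) = lift (out (inj₂ p))
    out′ (inj₁ p) with ∈-++⁻ (leaves β) p
    ... | inj₁ q = zero , (λ ()) , q
    ... | inj₂ q = lift (out (inj₁ q))

  someLeaf∈ : (T : Tree L A) → ∃ λ x → x ∈ᵀ T
  someLeaf∈ (leaf x)           = x , here refl
  someLeaf∈ (node l (β ∷ βs)) = let x , p = someLeaf∈ β in x , ∈-++⁺ˡ p

-- Orders fitting a PQ-tree

lookup-∷ʳ-fromℕ : ∀ {A : Set} {k} (xs : Vec A k) x → lookup (xs Vec.∷ʳ x) (fromℕ k) ≡ x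
lookup-∷ʳ-fromℕ []       x = refl
lookup-∷ʳ-fromℕ (_ ∷ xs) x = lookup-∷ʳ-fromℕ xs x

lookup-∷ʳ-inject₁ : ∀ {A : Set} {k} (xs : Vec A k) x i → lookup (xs Vec.∷ʳ x) (inject₁ i) ≡ lookup xs i
lookup-∷ʳ-inject₁ (_ ∷ xs) x zero    = refl
lookup-∷ʳ-inject₁ (_ ∷ xs) x (suc i) = lookup-∷ʳ-inject₁ xs x i

lookup-reverse-opposite : ∀ {A : Set} {k} (xs : Vec A k) i → lookup (reverse xs) (opposite i) ≡ lookup xs i
lookup-reverse-opposite (x ∷ xs) zero    rewrite Vec.reverse-∷ x xs = lookup-∷ʳ-fromℕ (reverse xs) x
lookup-reverse-opposite (x ∷ xs) (suc i) rewrite Vec.reverse-∷ x xs =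
  trans (lookup-∷ʳ-inject₁ (reverse xs) x (opposite i)) (lookup-reverse-opposite xs i)

lookup-reverse : ∀ {A : Set} {k} (xs : Vec A k) i → lookup (reverse xs) i ≡ lookup xs (opposite i)
lookup-reverse xs i = trans (cong (lookup (reverse xs)) (sym (Fin.opposite-involutive i))) (lookup-reverse-opposite xs (opposite i))

opposite-< : ∀ {k} {i j : Fin k} → i Fin.< j → opposite j Fin.< opposite i
opposite-< {i = i} {j} p rewrite Fin.opposite-prop i | Fin.opposite-prop j =
  ℕ.∸-monoʳ-< (s≤s p) (Fin.toℕ<n j)

module _ {n : ℕ} where

  Convex : Rel (Fin n) 0ℓ → ∀ {k} → Vec (PQTree n) k → Set
  Convex R βs = ∀ {i x y z} → x ∈ᵀ lookup βs i → y ∈ˡ leavesAll βs → z ∈ᵀ lookup βs i →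
                R x y → R y z → y ∈ᵀ lookup βs i

  -- Order up to reversal, expressed without choosing a direction. With fewer than three children
  -- the condition is vacuous, so a Q-node with two children behaves as a P-node.
  Betweenness : Rel (Fin n) 0ℓ → ∀ {k} → Vec (PQTree n) k → Set
  Betweenness R βs = ∀ {i j m x y z} → i Fin.< j → j Fin.< m →
                     x ∈ᵀ lookup βs i → y ∈ᵀ lookup βs j → z ∈ᵀ lookup βs m →
                     (R x y × R y z) ⊎ (R z y × R y x)

  -- A necessary condition for `R` to be the leaf order of some tree equivalent to the given one. It
  -- mentions the given tree only, so the equivalent tree need not be known to refute it.
  data Fits (R : Rel (Fin n) 0ℓ) : PQTree n → Set where
    leaf : ∀ {x} → Fits R (leaf x)
    node : ∀ {l k} {βs : Vec (PQTree n) (2 + k)} → Convex R βs → (l ≡ Q → Betweenness R βs) →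
           (∀ i → Fits R (lookup βs i)) → Fits R (node l βs)

  -- Both implications are needed because `R` is a premise in `Convex` and a conclusion in
  -- `Betweenness`. They are asked for leaves of `T` only, which allows restriction to a sublist.
  Fits-mono : ∀ {R R′ T} → (∀ {x y} → x ∈ᵀ T → y ∈ᵀ T → R x y → R′ x y) →
              (∀ {x y} → x ∈ᵀ T → y ∈ᵀ T → R′ x y → R x y) → Fits R T → Fits R′ T
  Fits-mono f g leaf = leaf
  Fits-mono f g (node {βs = βs} cv bt fs) = node
    (λ {i} x∈ y∈ z∈ xy yz → cv x∈ y∈ z∈ (g (up i x∈) y∈ xy) (g y∈ (up i z∈) yz))
    (λ lq {i} {j} {m} ij jm x∈ y∈ z∈ →
      Sum.map (λ (p , q) → f (up i x∈) (up j y∈) p , f (up j y∈) (up m z∈) q)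
              (λ (p , q) → f (up m z∈) (up j y∈) p , f (up j y∈) (up i x∈) q)
              (bt lq ij jm x∈ y∈ z∈))
    (λ i → Fits-mono (λ x∈ y∈ → f (up i x∈) (up i y∈)) (λ x∈ y∈ → g (up i x∈) (up i y∈)) (fs i))
    where up = leavesAll⁺ βs

  Before-restrict : ∀ {xs ys : List (Fin n)} {x y} → Unique ys → xs ⊆ ys → x ∈ˡ xs → y ∈ˡ xs → Before ys x y → Before xs x y
  Before-restrict u s x∈ y∈ p with Before-cmp x∈ y∈
  ... | inj₁ refl     = contradiction p (Before-irrefl u)
  ... | inj₂ (inj₁ q) = q
  ... | inj₂ (inj₂ q) = contradiction (⊆-trans q s) (Before-asym u p)

  Fits-Before : ∀ T → Unique (leaves T) → Fits (Before (leaves T)) T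
  Fits-Before = Tree-ind (λ _ _ → leaf) λ l βs ih u → node
    (λ {i} x∈ y∈ z∈ xy yz →
      let j , y∈j = leavesAll⁻ βs y∈
          e = Fin.≤-antisym (Before-≤ βs u x∈ y∈j xy) (Before-≤ βs u y∈j z∈ yz)
      in subst (λ j → _ ∈ᵀ lookup βs j) (sym e) y∈j)
    (λ _ ij jm x∈ y∈ z∈ → inj₁ (leavesAll-before βs ij x∈ y∈ , leavesAll-before βs jm y∈ z∈))
    (λ i → let s = leaves-⊆ βs i in
      Fits-mono (λ _ _ p → ⊆-trans p s) (λ x∈ y∈ p → Before-restrict u s x∈ y∈ p) (ih i (Unique-resp-⊇ s u)))

  leavesAll-mono : ∀ {j k} (βs : Vec (PQTree n) j) (γs : Vec (PQTree n) k) (σ : Fin j → Fin k) →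
                   (∀ i {x} → x ∈ᵀ lookup βs i → x ∈ᵀ lookup γs (σ i)) →
                   ∀ {x} → x ∈ˡ leavesAll βs → x ∈ˡ leavesAll γs
  leavesAll-mono βs γs σ f p = let i , q = leavesAll⁻ βs p in leavesAll⁺ γs (σ i) (f i q)

  permuted : ∀ {k} → Vec (PQTree n) k → Permutation′ k → Vec (PQTree n) k
  permuted βs π = tabulate λ i → lookup βs (π ⟨$⟩ʳ i)

  lookup-permuted : ∀ {k} (βs : Vec (PQTree n) k) (π : Permutation′ k) i →
                    lookup (permuted βs π) (π ⟨$⟩ˡ i) ≡ lookup βs i
  lookup-permuted βs π i = trans (Vec.lookup∘tabulate _ (π ⟨$⟩ˡ i)) (cong (lookup βs) (Perm.inverseʳ π))

  update-⊆ : ∀ {k} (βs : Vec (PQTree n) k) i {β′} → (∀ {x} → x ∈ᵀ lookup βs i → x ∈ᵀ β′) →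
             ∀ j {x} → x ∈ᵀ lookup βs j → x ∈ᵀ lookup (βs [ i ]≔ β′) j
  update-⊆ βs i {β′} f j p with j Fin.≟ i
  ... | yes refl = subst (_ ∈ᵀ_) (sym (Vec.lookup∘update i βs β′)) (f p)
  ... | no  j≢i  = subst (_ ∈ᵀ_) (sym (Vec.lookup∘update′ j≢i βs β′)) p

  update-⊇ : ∀ {k} (βs : Vec (PQTree n) k) i {β′} → (∀ {x} → x ∈ᵀ β′ → x ∈ᵀ lookup βs i) →
             ∀ j {x} → x ∈ᵀ lookup (βs [ i ]≔ β′) j → x ∈ᵀ lookup βs j
  update-⊇ βs i {β′} f j p with j Fin.≟ i
  ... | yes refl = f (subst (_ ∈ᵀ_) (Vec.lookup∘update i βs β′) p)
  ... | no  j≢i  = subst (_ ∈ᵀ_) (Vec.lookup∘update′ j≢i βs β′) p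

  ⟶-∈ : ∀ {T T′ : PQTree n} → T ⟶ T′ → ∀ {x} → x ∈ᵀ T → x ∈ᵀ T′
  ⟶-∈ (permuteP {βs = βs} π) =
    leavesAll-mono βs (permuted βs π) (π ⟨$⟩ˡ_) λ i → subst (_ ∈ᵀ_) (sym (lookup-permuted βs π i))
  ⟶-∈ (reverseQ {βs = βs}) =
    leavesAll-mono βs (reverse βs) opposite λ i → subst (_ ∈ᵀ_) (sym (lookup-reverse-opposite βs i))
  ⟶-∈ (inChild {βs = βs} i {β′} s) = leavesAll-mono βs (βs [ i ]≔ β′) id (update-⊆ βs i {β′} (⟶-∈ s))

  ⟶-∋ : ∀ {T T′ : PQTree n} → T ⟶ T′ → ∀ {x} → x ∈ᵀ T′ → x ∈ᵀ T
  ⟶-∋ (permuteP {βs = βs} π) =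
    leavesAll-mono (permuted βs π) βs (π ⟨$⟩ʳ_) λ i → subst (_ ∈ᵀ_) (Vec.lookup∘tabulate (λ j → lookup βs (π ⟨$⟩ʳ j)) i)
  ⟶-∋ (reverseQ {βs = βs}) =
    leavesAll-mono (reverse βs) βs opposite λ i → subst (_ ∈ᵀ_) (lookup-reverse βs i)
  ⟶-∋ (inChild {βs = βs} i {β′} s) = leavesAll-mono (βs [ i ]≔ β′) βs id (update-⊇ βs i {β′} (⟶-∋ s))

  Convex-mono : ∀ {R k} (βs γs : Vec (PQTree n) k) (σ : Fin k → Fin k) →
                (∀ i {x} → x ∈ᵀ lookup βs i → x ∈ᵀ lookup γs (σ i)) →
                (∀ i {x} → x ∈ᵀ lookup γs (σ i) → x ∈ᵀ lookup βs i) →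
                Convex R γs → Convex R βs
  Convex-mono βs γs σ f g cv {i} x∈ y∈ z∈ xy yz =
    g i (cv (f i x∈) (leavesAll-mono βs γs σ f y∈) (f i z∈) xy yz)

  -- The order is known to fit the last tree of a chain of operations, and this is pulled back along
  -- the chain. Convexity does not see the positions of the children, reversal swaps the two
  -- alternatives of `Betweenness`, and a P-node has no such condition.
  Fits-⟶ : ∀ {R} {T T′ : PQTree n} → T ⟶ T′ → Fits R T′ → Fits R T
  Fits-⟶ {R} (permuteP {βs = βs} π) (node cv bt fs) = node
    (Convex-mono βs (permuted βs π) (π ⟨$⟩ˡ_) (λ i → subst (_ ∈ᵀ_) (sym (lookup-permuted βs π i)))
                           (λ i → subst (_ ∈ᵀ_) (lookup-permuted βs π i)) (λ {i} → cv {i}))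
    (λ ())
    (λ i → subst (Fits R) (lookup-permuted βs π i) (fs (π ⟨$⟩ˡ i)))
  Fits-⟶ {R} (reverseQ {βs = βs}) (node cv bt fs) = node
    (Convex-mono βs (reverse βs) opposite (λ i → subst (_ ∈ᵀ_) (sym (lookup-reverse-opposite βs i)))
                          (λ i → subst (_ ∈ᵀ_) (lookup-reverse-opposite βs i)) cv)
    (λ lq {i} {j} {m} ij jm x∈ y∈ z∈ → Sum.swap
      (bt lq (opposite-< jm) (opposite-< ij) (to m z∈) (to j y∈) (to i x∈)))
    (λ i → subst (Fits R) (lookup-reverse-opposite βs i) (fs _))
    where
    to : ∀ i {x} → x ∈ᵀ lookup βs i → x ∈ᵀ lookup (reverse βs) (opposite i)
    to i = subst (_ ∈ᵀ_) (sym (lookup-reverse-opposite βs i))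
  Fits-⟶ {R} (inChild {βs = βs} i {β′} s) (node cv bt fs) = node
    (Convex-mono βs (βs [ i ]≔ β′) id to (update-⊇ βs i {β′} (⟶-∋ s)) cv)
    (λ lq {a} {b} {c} ab bc x∈ y∈ z∈ → bt lq ab bc (to a x∈) (to b y∈) (to c z∈))
    fs′
    where
    to = update-⊆ βs i {β′} (⟶-∈ s)
    fs′ : ∀ j → Fits R (lookup βs j)
    fs′ j with j Fin.≟ i
    ... | yes refl = Fits-⟶ s (subst (Fits R) (Vec.lookup∘update i βs β′) (fs i))
    ... | no  j≢i  = subst (Fits R) (Vec.lookup∘update′ j≢i βs β′) (fs j)

  Fits-≅ : ∀ {R} {T T′ : PQTree n} → T ≅ T′ → Fits R T′ → Fits R T
  Fits-≅ ε       f = f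
  Fits-≅ (s ◅ r) f = Fits-⟶ s (Fits-≅ r f)

  ≅-child : ∀ {l k} (βs : Vec (PQTree n) (2 + k)) i {β′} → lookup βs i ≅ β′ → node l βs ≅ node l (βs [ i ]≔ β′)
  ≅-child {l} βs i {β′} r =
    subst (λ γs → node l γs ≅ node l (βs [ i ]≔ β′)) (Vec.[]≔-lookup βs i)
          (gmap (λ β → node l (βs [ i ]≔ β)) lift r)
    where
    lift : ∀ {β β″} → β ⟶ β″ → node l (βs [ i ]≔ β) ⟶ node l (βs [ i ]≔ β″)
    lift {β} {β″} s =
      subst (λ γs → node l (βs [ i ]≔ β) ⟶ node l γs) (Vec.[]≔-idempotent βs i)
            (inChild i (subst (_⟶ β″) (sym (Vec.lookup∘update i βs β)) s))

-- Compatible orders and PQ-trees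

transpose-first : ∀ {k} (i j : Fin k) → transpose i j ⟨$⟩ʳ i ≡ j
transpose-first i j rewrite dec-true (i Fin.≟ i) refl = refl

transpose-second : ∀ {k} (i j : Fin k) → transpose i j ⟨$⟩ʳ j ≡ i
transpose-second i j with j Fin.≟ i
... | yes e = e
... | no  _ rewrite dec-true (j Fin.≟ j) refl = refl

transpose-other : ∀ {k} {i j m : Fin k} → m ≢ i → m ≢ j → transpose i j ⟨$⟩ʳ m ≡ m
transpose-other {i = i} {j} {m} m≢i m≢j
  rewrite dec-false (m Fin.≟ i) m≢i | dec-false (m Fin.≟ j) m≢j = refl

otherIndex : ∀ {k} (i : Fin (2 + k)) → ∃ λ j → j ≢ i
otherIndex zero    = suc zero , λ ()
otherIndex (suc i) = zero , λ ()

_∈ᵀ?_ : ∀ {L : Set} {n} (x : Fin n) (T : Tree L (Fin n)) → Dec (x ∈ᵀ T)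
x ∈ᵀ? T = any? (x Fin.≟_) (leaves T)

-- Sets of leaves

ProperNonempty-⁅⁆ : ∀ {k} (i : Fin (2 + k)) → ProperNonempty ⁅ i ⁆
ProperNonempty-⁅⁆ i = (i , Sub.x∈⁅x⁆ i) , λ e → let j , j≢i = otherIndex i in
  j≢i (Sub.x∈⁅y⁆⇒x≡y i (subst (j ∈_) (sym e) Sub.∈⊤))

≢full⇒∉ : ∀ {k} {S : Subset k} → S ≢ full → ∃ λ j → j ∉ S
≢full⇒∉ {S = S} S≢ with Fin.any? (λ j → ¬? (j ∈? S))
... | yes p = p
... | no ¬p = contradiction (Sub.⊆-antisym (λ _ → Sub.∈⊤) (λ {j} _ → decidable-stable (j ∈? S) λ j∉ → ¬p (j , j∉))) S≢

⁅⁆-injective : ∀ {k} {i j : Fin k} → ⁅ i ⁆ ≡ ⁅ j ⁆ → i ≡ j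
⁅⁆-injective {i = i} {j} eq = Sub.x∈⁅y⁆⇒x≡y j (subst (i ∈_) eq (Sub.x∈⁅x⁆ i))

module _ {n : ℕ} where

  ∈⋃-singletons⁺ : ∀ {x} (xs : List (Fin n)) → x ∈ˡ xs → x ∈ ⋃ (List.map ⁅_⁆ xs)
  ∈⋃-singletons⁺ (x ∷ xs) (here refl) = Sub.x∈p∪q⁺ (inj₁ (Sub.x∈⁅x⁆ x))
  ∈⋃-singletons⁺ (x ∷ xs) (there p)   = Sub.x∈p∪q⁺ (inj₂ (∈⋃-singletons⁺ xs p))

  ∈⋃-singletons⁻ : ∀ {x} (xs : List (Fin n)) → x ∈ ⋃ (List.map ⁅_⁆ xs) → x ∈ˡ xs
  ∈⋃-singletons⁻ []       p = contradiction p Sub.∉⊥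
  ∈⋃-singletons⁻ (y ∷ xs) p with Sub.x∈p∪q⁻ ⁅ y ⁆ _ p
  ... | inj₁ q = here (Sub.x∈⁅y⁆⇒x≡y y q)
  ... | inj₂ q = there (∈⋃-singletons⁻ xs q)

  module _ {L : Set} where

    ∈X⁺ : ∀ {x} (T : Tree L (Fin n)) → x ∈ᵀ T → x ∈ X T
    ∈X⁺ T = ∈⋃-singletons⁺ (leaves T)

    ∈X⁻ : ∀ {x} (T : Tree L (Fin n)) → x ∈ X T → x ∈ᵀ T
    ∈X⁻ T = ∈⋃-singletons⁻ (leaves T)

    ∈⋃X⁺ : ∀ {k} (βs : Vec (Tree L (Fin n)) k) {S j x} → j ∈ S → x ∈ᵀ lookup βs j → x ∈ ⋃X βs S
    ∈⋃X⁺ (β ∷ βs) {inside  ∷ S} {zero}  _           p = Sub.x∈p∪q⁺ (inj₁ (∈X⁺ β p))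
    ∈⋃X⁺ (β ∷ βs) {inside  ∷ S} {suc j} (Vec.there q) p = Sub.x∈p∪q⁺ (inj₂ (∈⋃X⁺ βs q p))
    ∈⋃X⁺ (β ∷ βs) {outside ∷ S} {suc j} (Vec.there q) p = ∈⋃X⁺ βs q p

    ∈⋃X⁻ : ∀ {k} (βs : Vec (Tree L (Fin n)) k) S {x} → x ∈ ⋃X βs S → ∃ λ j → j ∈ S × x ∈ᵀ lookup βs j
    ∈⋃X⁻ []       []            p = contradiction p Sub.∉⊥
    ∈⋃X⁻ (β ∷ βs) (inside  ∷ S) p with Sub.x∈p∪q⁻ (X β) _ p
    ... | inj₁ q = zero , Vec.here , ∈X⁻ β q
    ... | inj₂ q = let j , r , s = ∈⋃X⁻ βs S q in suc j , Vec.there r , s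
    ∈⋃X⁻ (β ∷ βs) (outside ∷ S) p = let j , r , s = ∈⋃X⁻ βs S p in suc j , Vec.there r , s

    inner-∈ : ∀ {T : Tree L (Fin n)} {l k} {βs : Vec (Tree L (Fin n)) (2 + k)} →
              InnerNode T l βs → ∀ j {x} → x ∈ᵀ lookup βs j → x ∈ᵀ T
    inner-∈ {βs = βs} root j p = leavesAll⁺ βs j p
    inner-∈ (below {αs = αs} i q) j p = leavesAll⁺ αs i (inner-∈ q j p)

    covered? : (T : Tree L (Fin n)) (M : Subset n) → (∀ {x} → x ∈ᵀ T → x ∈ M) ⊎ (∃ λ z → z ∈ᵀ T × z ∉ M)
    covered? T M with All.all? (_∈? M) (leaves T)
    ... | yes a = inj₁ (All.lookup a)
    ... | no ¬a = let z , z∈ , z∉ = find (¬All⇒Any¬ (_∈? M) (leaves T) ¬a) in inj₂ (z , z∈ , z∉)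

    within? : (T : Tree L (Fin n)) (M : Subset n) → (∀ {x} → x ∈ M → x ∈ᵀ T) ⊎ (∃ λ z → z ∈ M × ¬ z ∈ᵀ T)
    within? T M with Fin.any? (λ z → (z ∈? M) ×-dec ¬? (z ∈ᵀ? T))
    ... | yes p = inj₂ p
    ... | no ¬p = inj₁ λ {x} x∈ → decidable-stable (x ∈ᵀ? T) λ x∉ → ¬p (x , x∈ , x∉)

    ≡X : ∀ {M} (T : Tree L (Fin n)) → (∀ {x} → x ∈ M → x ∈ᵀ T) → (∀ {x} → x ∈ᵀ T → x ∈ M) → X T ≡ M
    ≡X T f g = Sub.⊆-antisym (λ p → g (∈X⁻ T p)) (λ p → ∈X⁺ T (f p))

  ⋃X-⁅⁆ : ∀ {L : Set} {k} (βs : Vec (Tree L (Fin n)) k) i → ⋃X βs ⁅ i ⁆ ≡ X (lookup βs i)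
  ⋃X-⁅⁆ βs i = Sub.⊆-antisym
    (λ p → let j , j∈ , q = ∈⋃X⁻ βs ⁅ i ⁆ p in
           ∈X⁺ (lookup βs i) (subst (λ j → _ ∈ᵀ lookup βs j) (Sub.x∈⁅y⁆⇒x≡y i j∈) q))
    (λ p → ∈⋃X⁺ βs (Sub.x∈⁅x⁆ i) (∈X⁻ (lookup βs i) p))

  -- Places in a tree and the sets found there

  liftPlace : ∀ {l k} {Us : Vec (MTree n) (2 + k)} i → Place (lookup Us i) → Place (node l Us)
  liftPlace i (child∪ q j)    = child∪ (below i q) j
  liftPlace i (children∩ q S) = children∩ (below i q) S

  liftPlace-setAt : ∀ {l k} {Us : Vec (MTree n) (2 + k)} i (p : Place (lookup Us i)) →
                    setAt (liftPlace {l} {Us = Us} i p) ≡ setAt p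
  liftPlace-setAt i (child∪ q j)    = refl
  liftPlace-setAt i (children∩ q S) = refl

  liftPlace-Admissible : ∀ {l k} {Us : Vec (MTree n) (2 + k)} i (p : Place (lookup Us i)) →
                         Admissible p → Admissible (liftPlace {l} {Us = Us} i p)
  liftPlace-Admissible i (child∪ q j)    a = a
  liftPlace-Admissible i (children∩ q S) a = a

  setAt-∈ : ∀ {T : MTree n} (p : Place T) {x} → x ∈ setAt p → x ∈ᵀ T
  setAt-∈ (child∪ {βs = βs} q j)    x∈ = inner-∈ q j (∈X⁻ (lookup βs j) x∈)
  setAt-∈ (children∩ {βs = βs} q S) x∈ = let j , _ , r = ∈⋃X⁻ βs S x∈ in inner-∈ q j r

  setAt-nonempty : ∀ {T : MTree n} (p : Place T) → Admissible p → Nonempty (setAt p)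
  setAt-nonempty (child∪ {βs = βs} q j) _ =
    let x , x∈ = someLeaf∈ (lookup βs j) in x , ∈X⁺ (lookup βs j) x∈
  setAt-nonempty (children∩ {βs = βs} q S) ((j , j∈) , _) =
    let x , x∈ = someLeaf∈ (lookup βs j) in x , ∈⋃X⁺ βs j∈ x∈

  inner-Unique : ∀ {T : MTree n} {l k} {βs : Vec (MTree n) (2 + k)} →
                 InnerNode T l βs → Unique (leaves T) → Unique (leavesAll βs)
  inner-Unique root              u = u
  inner-Unique (below {αs = αs} i q) u = inner-Unique q (Unique-resp-⊇ (leaves-⊆ αs i) u)

  setAt-proper : ∀ {T : MTree n} → Unique (leaves T) → (p : Place T) → Admissible p →
                 ∃ λ x → x ∈ᵀ T × x ∉ setAt p
  setAt-proper u (child∪ {βs = βs} q j) _ =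
    let i , i≢j = otherIndex j ; x , x∈ = someLeaf∈ (lookup βs i) in
    x , inner-∈ q i x∈ , λ p → i≢j (sameChild βs (inner-Unique q u) x∈ (∈X⁻ (lookup βs j) p))
  setAt-proper u (children∩ {βs = βs} q S) (_ , S≢) =
    let i , i∉ = ≢full⇒∉ S≢ ; x , x∈ = someLeaf∈ (lookup βs i) in
    x , inner-∈ q i x∈ , λ p → let j , j∈ , x∈j = ∈⋃X⁻ βs S p in
      i∉ (subst (_∈ S) (sameChild βs (inner-Unique q u) x∈j x∈) j∈)

  -- The set at a place of a subtree is a nonempty proper part of one child of
  -- the root.
  root≢lift : ∀ {k} (Us : Vec (MTree n) (2 + k)) → Unique (leavesAll Us) → ∀ S i (p : Place (lookup Us i)) →
              Admissible p → ⋃X Us S ≢ setAt p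
  root≢lift Us u S i p a eq =
    let x , x∈ = setAt-nonempty p a
        j , j∈ , x∈j = ∈⋃X⁻ Us S (subst (x ∈_) (sym eq) x∈)
        z , z∈ , z∉ = setAt-proper (Unique-resp-⊇ (leaves-⊆ Us i) u) p a
        j≡i = sameChild Us u x∈j (setAt-∈ p x∈)
    in z∉ (subst (z ∈_) eq (∈⋃X⁺ Us (subst (_∈ S) j≡i j∈) z∈))

  ⋃X-injective : ∀ {k} (Us : Vec (MTree n) k) → Unique (leavesAll Us) → ∀ {S S′} → ⋃X Us S ≡ ⋃X Us S′ → S ≡ S′
  ⋃X-injective Us u {S} {S′} eq = Sub.⊆-antisym (half eq) (half (sym eq))
    where
    half : ∀ {S S′} → ⋃X Us S ≡ ⋃X Us S′ → ∀ {j} → j ∈ S → j ∈ S′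
    half {S} {S′} eq {j} j∈ =
      let x , x∈ = someLeaf∈ (lookup Us j)
          i , i∈ , x∈i = ∈⋃X⁻ Us S′ (subst (x ∈_) eq (∈⋃X⁺ Us j∈ x∈))
      in subst (_∈ S′) (sameChild Us u x∈i x∈) i∈

  -- Puts both kinds of place at the root on one footing: a child of a ∪-node counts as a singleton
  -- set of children, so `⋃X-injective` serves for either label.
  data AtRoot : ∀ {l k} {Us : Vec (MTree n) (2 + k)} → Place (node l Us) → Subset (2 + k) → Set where
    ∪-root : ∀ {k} {Us : Vec (MTree n) (2 + k)} j → AtRoot {Us = Us} (child∪ root j) ⁅ j ⁆
    ∩-root : ∀ {k} {Us : Vec (MTree n) (2 + k)} S → AtRoot {Us = Us} (children∩ root S) S

  AtRoot-setAt : ∀ {l k} {Us : Vec (MTree n) (2 + k)} {p : Place (node l Us)} {S} → AtRoot p S → ⋃X Us S ≡ setAt p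
  AtRoot-setAt {Us = Us} (∪-root j) = ⋃X-⁅⁆ Us j
  AtRoot-setAt           (∩-root S) = refl

  AtRoot-injective : ∀ {l k} {Us : Vec (MTree n) (2 + k)} {p q : Place (node l Us)} {S S′} →
                     AtRoot p S → AtRoot q S′ → S ≡ S′ → p ≡ q
  AtRoot-injective (∪-root i) (∪-root j) e = cong (child∪ root) (⁅⁆-injective e)
  AtRoot-injective (∩-root S) (∩-root T) e = cong (children∩ root) e

  data PlaceView {l k} {Us : Vec (MTree n) (2 + k)} : Place (node l Us) → Set where
    at-root : ∀ {p S} → AtRoot p S → PlaceView p
    under   : ∀ i p → Admissible p → PlaceView (liftPlace i p)

  placeView : ∀ {l k} {Us : Vec (MTree n) (2 + k)} (p : Place (node l Us)) → Admissible p → PlaceView p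
  placeView (child∪ root j)           _ = at-root (∪-root j)
  placeView (child∪ (below i q) j)    a = under i (child∪ q j) a
  placeView (children∩ root S)        _ = at-root (∩-root S)
  placeView (children∩ (below i q) S) a = under i (children∩ q S) a

  -- The uniqueness half of completeness. Every child has a leaf, so distinct sets of children at
  -- the root have distinct unions; `root≢lift` separates the root from deeper places; and two
  -- deeper places sharing a leaf lie in the same child, where induction applies.
  setAt-injective : ∀ (T : MTree n) → Unique (leaves T) → ∀ (p q : Place T) → Admissible p → Admissible q →
                    setAt p ≡ setAt q → p ≡ q
  setAt-injective = Tree-ind (λ x u → λ { (child∪ () _) ; (children∩ () _) }) at-node
    where
    at-node : ∀ l {k} (Us : Vec (MTree n) (2 + k)) →
      (∀ i → Unique (leaves (lookup Us i)) → ∀ (p q : Place (lookup Us i)) → Admissible p → Admissible q → setAt p ≡ setAt q → p ≡ q) →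
      Unique (leavesAll Us) → ∀ (p q : Place (node l Us)) → Admissible p → Admissible q → setAt p ≡ setAt q → p ≡ q
    at-node l Us ih u p q a b eq with placeView p a | placeView q b
    ... | at-root r | at-root s =
      AtRoot-injective r s (⋃X-injective Us u (trans (AtRoot-setAt r) (trans eq (sym (AtRoot-setAt s)))))
    ... | at-root {S = S} r | under i q′ b′ = ⊥-elim (root≢lift Us u S i q′ b′
      (trans (AtRoot-setAt r) (trans eq (liftPlace-setAt {l} {Us = Us} i q′))))
    ... | under i p′ a′ | at-root {S = S} s = ⊥-elim (root≢lift Us u S i p′ a′
      (trans (AtRoot-setAt s) (trans (sym eq) (liftPlace-setAt {l} {Us = Us} i p′))))
    ... | under i p′ a′ | under j q′ b′ = both (sameChild Us u (setAt-∈ p′ x∈) (setAt-∈ q′ (subst (x ∈_) eq′ x∈)))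
      where
      x  = proj₁ (setAt-nonempty p′ a′)
      x∈ = proj₂ (setAt-nonempty p′ a′)
      eq′ : setAt p′ ≡ setAt q′
      eq′ = trans (sym (liftPlace-setAt {l} {Us = Us} i p′)) (trans eq (liftPlace-setAt {l} {Us = Us} j q′))
      both : i ≡ j → liftPlace i p′ ≡ liftPlace j q′
      both refl = cong (liftPlace i) (ih i (Unique-resp-⊇ (leaves-⊆ Us i) u) p′ q′ a′ b′ eq′)

-- Compatible arrangements of lists of points

module Space {c ℓ₁ ℓ₂} (V : DecTotalOrder c ℓ₁ ℓ₂) (0# : DecTotalOrder.Carrier V) {n : ℕ}
             (d : Fin n → Fin n → DecTotalOrder.Carrier V) (isD : IsDissimilarity V 0# d) where

  open DecTotalOrder V public using (Carrier; _≈_; antisym; totalOrder; module Eq)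
    renaming (_≤_ to _≤ᵛ_; trans to ≤ᵛ-trans; reflexive to ≤ᵛ-reflexive; refl to ≤ᵛ-refl)
  open Eq public using () renaming (refl to ≈-refl; sym to ≈-sym; trans to ≈-trans)
  open IsDissimilarity isD public
  open Max totalOrder using (x≤x⊔y; x≤y⊔x; ⊔-lub)

  ≤≈ : ∀ {a b c} → a ≤ᵛ b → b ≈ c → a ≤ᵛ c
  ≤≈ p q = ≤ᵛ-trans p (≤ᵛ-reflexive q)

  ≈≤ : ∀ {a b c} → a ≈ b → b ≤ᵛ c → a ≤ᵛ c
  ≈≤ p q = ≤ᵛ-trans (≤ᵛ-reflexive p) q

  d-sym : ∀ {x y δ} → d x y ≈ δ → d y x ≈ δ
  d-sym p = ≈-trans (symmetric _ _) p

  d-diag≤ : ∀ x y z → d x x ≤ᵛ d y z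
  d-diag≤ x y z = ≈≤ (diagonal x) (nonneg y z)

  Rob : Fin n → Fin n → Fin n → Set ℓ₂
  Rob x y z = d x y ≤ᵛ d x z × d y z ≤ᵛ d x z

  Rob-sym : ∀ {x y z} → Rob x y z → Rob z y x
  Rob-sym (p , q) =
    ≈≤ (symmetric _ _) (≤≈ q (symmetric _ _)) , ≈≤ (symmetric _ _) (≤≈ p (symmetric _ _))

  -- Compatibility of a list, not of a relation on all of X: it passes to sublists, hence to the
  -- leaves below a node.
  CompatL : List (Fin n) → Set ℓ₂
  CompatL xs = ∀ {x y z} → (x ∷ y ∷ z ∷ []) ⊆ xs → Rob x y z

  CompatL-⊆ : ∀ {xs ys} → xs ⊆ ys → CompatL ys → CompatL xs
  CompatL-⊆ s cl p = cl (⊆-trans p s)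

  CompatL-reverse : ∀ xs → CompatL xs → CompatL (List.reverse xs)
  CompatL-reverse xs cl p = Rob-sym (cl (subst (_ ⊆_) (List.reverse-involutive xs) (Sublist.reverse⁺ p)))

  -- A triple meeting both lists has two distances equal to `δ`, one of them that of its outer
  -- entries, so only the distance within one list has to be bounded.
  CompatL-join : ∀ {as bs δ} → CompatL as → CompatL bs →
                 (∀ {x y} → x ∈ˡ as → y ∈ˡ bs → d x y ≈ δ) →
                 (∀ {x y} → x ∈ˡ as → y ∈ˡ as → d x y ≤ᵛ δ) →
                 (∀ {x y} → x ∈ˡ bs → y ∈ˡ bs → d x y ≤ᵛ δ) →
                 CompatL (as ++ bs)
  CompatL-join {as} ca cb eq da db p with split₃ as p
  ... | s₃₀ q    = ca q
  ... | s₀₃ q    = cb q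
  ... | s₂₁ xy z = let xz≈ = eq (Before-∈ˡ xy) z in
    ≤≈ (da (Before-∈ˡ xy) (Before-∈ʳ xy)) (≈-sym xz≈) ,
    ≤ᵛ-reflexive (≈-trans (eq (Before-∈ʳ xy) z) (≈-sym xz≈))
  ... | s₁₂ x yz = let xz≈ = eq x (Before-∈ʳ yz) in
    ≤ᵛ-reflexive (≈-trans (eq x (Before-∈ˡ yz)) (≈-sym xz≈)) ,
    ≤≈ (db (Before-∈ˡ yz) (Before-∈ʳ yz)) (≈-sym xz≈)

  -- Triples with at most one entry in the block occur in the old list as well. If two entries are
  -- in the block, the third point is equidistant from them, and their mutual distance is bounded by
  -- the old list in whichever order it has them.
  CompatL-replace : ∀ pre {H H′} post → CompatL (pre ++ H ++ post) → H′ ↭ H → CompatL H′ →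
                    (∀ {x y z} → z ∈ˡ pre ⊎ z ∈ˡ post → x ∈ˡ H → y ∈ˡ H → d z x ≈ d z y) →
                    CompatL (pre ++ H′ ++ post)
  CompatL-replace pre {H} {H′} post cl perm cl′ mod p = go (split₃ pre p)
    where
    to : ∀ {x} → x ∈ˡ H′ → x ∈ˡ H
    to = ∈-resp-↭ perm
    pre-pair : ∀ {x y z} → x ∈ˡ pre → Before H y z → Rob x y z
    pre-pair x yz = cl (Sublist.++⁺ (from∈ x) (Sublist.++⁺ʳ post yz))
    post-pair : ∀ {x y z} → Before H x y → z ∈ˡ post → Rob x y z
    post-pair xy z = cl (Sublist.++⁺ˡ pre (Sublist.++⁺ xy (from∈ z)))
    pre₂ : ∀ {x y z} → x ∈ˡ pre → y ∈ˡ H → z ∈ˡ H → Rob x y z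
    pre₂ {x} {y} {z} x∈ y∈ z∈ = ≤ᵛ-reflexive xy≈xz , yz≤ (Before-cmp y∈ z∈)
      where
      xy≈xz = mod (inj₁ x∈) y∈ z∈
      yz≤ : y ≡ z ⊎ Before H y z ⊎ Before H z y → d y z ≤ᵛ d x z
      yz≤ (inj₁ refl)     = d-diag≤ _ _ _
      yz≤ (inj₂ (inj₁ q)) = proj₂ (pre-pair x∈ q)
      yz≤ (inj₂ (inj₂ q)) = ≈≤ (symmetric _ _) (≤≈ (proj₂ (pre-pair x∈ q)) xy≈xz)
    post₂ : ∀ {x y z} → x ∈ˡ H → y ∈ˡ H → z ∈ˡ post → Rob x y z
    post₂ {x} {y} {z} x∈ y∈ z∈ = xy≤ (Before-cmp x∈ y∈) , ≤ᵛ-reflexive yz≈xz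
      where
      yz≈xz = ≈-trans (symmetric _ _) (≈-trans (mod (inj₂ z∈) y∈ x∈) (symmetric _ _))
      xy≤ : x ≡ y ⊎ Before H x y ⊎ Before H y x → d x y ≤ᵛ d x z
      xy≤ (inj₁ refl)     = d-diag≤ _ _ _
      xy≤ (inj₂ (inj₁ q)) = proj₁ (post-pair q z∈)
      xy≤ (inj₂ (inj₂ q)) = ≈≤ (symmetric _ _) (≤≈ (proj₁ (post-pair q z∈)) yz≈xz)
    go : ∀ {x y z} → Split₃ pre (H′ ++ post) x y z → Rob x y z
    go (s₃₀ q) = cl (Sublist.++⁺ʳ (H ++ post) q)
    go (s₂₁ xy z) with ∈-++⁻ H′ z
    ... | inj₁ z∈ = cl (Sublist.++⁺ xy (from∈ (∈-++⁺ˡ (to z∈))))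
    ... | inj₂ z∈ = cl (Sublist.++⁺ xy (from∈ (∈-++⁺ʳ H z∈)))
    go (s₁₂ x yz) with split₂ H′ yz
    ... | s₂₀ q   = pre₂ x (to (Before-∈ˡ q)) (to (Before-∈ʳ q))
    ... | s₁₁ y z = cl (Sublist.++⁺ (from∈ x) (Before-++ (to y) z))
    ... | s₀₂ q   = cl (Sublist.++⁺ (from∈ x) (Sublist.++⁺ˡ H q))
    go (s₀₃ q) with split₃ H′ q
    ... | s₃₀ r    = cl′ r
    ... | s₂₁ xy z = post₂ (to (Before-∈ˡ xy)) (to (Before-∈ʳ xy)) z
    ... | s₁₂ x yz = cl (Sublist.++⁺ˡ pre (Sublist.++⁺ (from∈ (to x)) yz))
    ... | s₀₃ r    = cl (Sublist.++⁺ˡ pre (Sublist.++⁺ˡ H r))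

  -- What is left of "T is the PQ-tree of a Robinson space" when T is a node
  -- of such a tree and only its own leaves are considered.
  record Good (T : PQTree n) : Set ℓ₂ where
    field
      unique : Unique (leaves T)
      comp   : ∀ {T′} → T ≅ T′ → CompatL (leaves T′)
      fits   : ∀ {ys} → ys ↭ leaves T → CompatL ys → Fits (Before ys) T

  PQTree⇒Good : ∀ {T} → IsPQTreeOf V d T → Good T
  PQTree⇒Good {T} isPQ = record { unique = uniqueT ; comp = compT ; fits = fitsT }
    where
    open IsPQTreeOf isPQ
    uniqueT : Unique (leaves T)
    uniqueT = Unique-resp-↭ (↭-sym isXTree) (Unique.allFin⁺ n)
    compT : ∀ {T′} → T ≅ T′ → CompatL (leaves T′)
    compT {T′} r {x} {y} {z} p =
      ≤ᵛ-trans (x≤x⊔y _ _) m , ≤ᵛ-trans (x≤y⊔x _ _) m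
      where
      m = IsCompatible.compatible
            (Equivalence.from (represents (LeafOrder T′)) (T′ , r , λ _ _ → mk⇔ id id))
            {x} {y} {z} (⊆-trans (refl ∷ refl ∷ _ ∷ʳ []) p) (⊆-trans (_ ∷ʳ ⊆-refl) p)
    fitsT : ∀ {ys} → ys ↭ leaves T → CompatL ys → Fits (Before ys) T
    fitsT {ys} perm cl =
      let T′ , r , same = Equivalence.to (represents (Before ys)) compatible
          -- Distinctness of the leaves of `T′` is read off the irreflexivity of the order that it
          -- represents.
          u′ = irrefl⇒Unique (λ p → Before-irrefl u (Equivalence.from (same _ _) p))
      in Fits-≅ r (Fits-mono (λ _ _ → Equivalence.from (same _ _)) (λ _ _ → Equivalence.to (same _ _)) (Fits-Before T′ u′))
      where
      u : Unique ys
      u = Unique-resp-↭ (↭-sym perm) uniqueT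
      all : ∀ x → x ∈ˡ ys
      all x = ∈-resp-↭ (↭-sym (↭-trans perm isXTree)) (∈-allFin x)
      compare : ∀ x y → Tri (Before ys x y) (x ≡ y) (Before ys y x)
      compare x y with Before-cmp (all x) (all y)
      ... | inj₁ refl     = tri≈ (Before-irrefl u) refl (Before-irrefl u)
      ... | inj₂ (inj₁ p) = tri< p (λ { refl → Before-irrefl u p }) (Before-asym u p)
      ... | inj₂ (inj₂ p) = tri> (Before-asym u p) (λ { refl → Before-irrefl u p }) p
      compatible : IsCompatible V d (Before ys)
      compatible = record
        { isStrictTotalOrder = record
          { isStrictPartialOrder = record
            { isEquivalence = isEquivalence
            ; irrefl        = λ { refl → Before-irrefl u }
            ; trans         = Before-trans u
            ; <-resp-≈      = (λ { refl p → p }) , (λ { refl p → p })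
            }
          ; compare = compare
          }
        ; compatible = λ p q → let r , s = cl (Before-chain u p q) in ⊔-lub r s
        }

  -- Rearranging the children of a node

  Reachable : ∀ (l : PQ) {k} → Vec (PQTree n) (2 + k) → Set ℓ₂
  Reachable l βs = ∀ {T′} → node l βs ≅ T′ → CompatL (leaves T′)

  -- A transposition at a P-node and the reversal at a Q-node both exchange the two children.
  -- Together with the given arrangement this makes either order of two children compatible,
  -- whatever the label.
  swapped : ∀ l {k} (βs : Vec (PQTree n) (2 + k)) → Reachable l βs → ∀ {i j} → i Fin.< j →
            CompatL (leaves (lookup βs j) ++ leaves (lookup βs i))
  swapped P βs comp {i} {j} i<j = CompatL-⊆ sub (comp (permuteP π ◅ ε))
    where
    π = transpose i j
    at : ∀ {a b} → π ⟨$⟩ʳ a ≡ b → lookup (permuted βs π) a ≡ lookup βs b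
    at {a} e = trans (Vec.lookup∘tabulate (λ a → lookup βs (π ⟨$⟩ʳ a)) a) (cong (lookup βs) e)
    sub : leaves (lookup βs j) ++ leaves (lookup βs i) ⊆ leavesAll (permuted βs π)
    sub = subst₂ (λ a b → leaves a ++ leaves b ⊆ leavesAll (permuted βs π))
            (at {i} (transpose-first i j)) (at {j} (transpose-second i j)) (leaves-⊆₂ (permuted βs π) i<j)
  swapped Q βs comp {i} {j} i<j = CompatL-⊆ sub (comp (reverseQ ◅ ε))
    where
    sub : leaves (lookup βs j) ++ leaves (lookup βs i) ⊆ leavesAll (reverse βs)
    sub = subst₂ (λ a b → leaves a ++ leaves b ⊆ leavesAll (reverse βs))
            (lookup-reverse-opposite βs j) (lookup-reverse-opposite βs i)
            (leaves-⊆₂ (reverse βs) (opposite-< i<j))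

  permuted-triple : ∀ {k} (βs : Vec (PQTree n) (2 + k)) → Reachable P βs →
    ∀ (π : Permutation′ (2 + k)) {p q r a b c} →
    p Fin.< q → q Fin.< r → π ⟨$⟩ʳ p ≡ a → π ⟨$⟩ʳ q ≡ b → π ⟨$⟩ʳ r ≡ c →
    ∀ {x y z} → x ∈ᵀ lookup βs a → y ∈ᵀ lookup βs b → z ∈ᵀ lookup βs c → Rob x y z
  permuted-triple βs comp π {p} {q} {r} p<q q<r refl refl refl x∈ y∈ z∈ =
    comp (permuteP π ◅ ε)
      (⊆-trans (Sublist.++⁺ (from∈ (at p x∈)) (Sublist.++⁺ (from∈ (at q y∈)) (from∈ (at r z∈))))
               (leaves-⊆₃ (permuted βs π) p<q q<r))
    where
    at : ∀ a {x} → x ∈ᵀ lookup βs (π ⟨$⟩ʳ a) → x ∈ᵀ lookup (permuted βs π) a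
    at a = subst (_ ∈ᵀ_) (sym (Vec.lookup∘tabulate (λ a → lookup βs (π ⟨$⟩ʳ a)) a))

  Hom : ∀ {L : Set} {k} → Vec (Tree L (Fin n)) k → Carrier → Set ℓ₁
  Hom βs δ = ∀ {i j x y} → i ≢ j → x ∈ᵀ lookup βs i → y ∈ᵀ lookup βs j → d x y ≈ δ

  Apex : ∀ {L : Set} {k} → Vec (Tree L (Fin n)) k → Fin k → Carrier → Set ℓ₁
  Apex βs i δ = ∀ {j x y} → j ≢ i → x ∈ᵀ lookup βs i → y ∈ᵀ lookup βs j → d x y ≈ δ

  -- Distances between the children of one node

  module Node {l k} (βs : Vec (PQTree n) (2 + k)) (good : Good (node l βs)) where

    open Good good public

    xs : List (Fin n)
    xs = leavesAll βs

    compat : CompatL xs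
    compat = comp ε

    up : ∀ i {x} → x ∈ᵀ lookup βs i → x ∈ˡ xs
    up = leavesAll⁺ βs

    pair : ∀ {i j} → i ≢ j → CompatL (leaves (lookup βs i) ++ leaves (lookup βs j))
    pair {i} {j} i≢j with Fin.<-cmp i j
    ... | tri< p _ _ = CompatL-⊆ (leaves-⊆₂ βs p) compat
    ... | tri≈ _ p _ = contradiction p i≢j
    ... | tri> _ _ p = swapped l βs comp p

    -- Both orders of the two children are compatible: `y x x′` bounds `d y x` by `d y x′`, and
    -- `x x′ y` gives the converse.
    const-ordered : ∀ {i j x x′ y} → i ≢ j → Before (leaves (lookup βs i)) x x′ → y ∈ᵀ lookup βs j →
                    d x y ≈ d x′ y
    const-ordered i≢j p y∈ = antisym
      (≈≤ (symmetric _ _) (≤≈ (proj₁ (pair (i≢j ∘ sym) (Sublist.++⁺ (from∈ y∈) p))) (symmetric _ _)))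
      (proj₂ (pair i≢j (Sublist.++⁺ p (from∈ y∈))))

    const : ∀ {i j x x′ y} → i ≢ j → x ∈ᵀ lookup βs i → x′ ∈ᵀ lookup βs i → y ∈ᵀ lookup βs j →
            d x y ≈ d x′ y
    const i≢j x∈ x′∈ y∈ with Before-cmp x∈ x′∈
    ... | inj₁ refl     = ≈-refl
    ... | inj₂ (inj₁ p) = const-ordered i≢j p y∈
    ... | inj₂ (inj₂ p) = ≈-sym (const-ordered i≢j p y∈)

    const₂ : ∀ {i j x x′ y y′} → i ≢ j → x ∈ᵀ lookup βs i → x′ ∈ᵀ lookup βs i →
             y ∈ᵀ lookup βs j → y′ ∈ᵀ lookup βs j → d x y ≈ d x′ y′
    const₂ i≢j x∈ x′∈ y∈ y′∈ =
      ≈-trans (const i≢j x∈ x′∈ y∈) (d-sym (≈-trans (const (i≢j ∘ sym) y∈ y′∈ x′∈) (symmetric _ _)))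

    diam : ∀ {i j x x′ y} → i ≢ j → x ∈ᵀ lookup βs i → x′ ∈ᵀ lookup βs i → y ∈ᵀ lookup βs j →
           d x x′ ≤ᵛ d x y
    diam i≢j x∈ x′∈ y∈ with Before-cmp x∈ x′∈
    ... | inj₁ refl     = d-diag≤ _ _ _
    ... | inj₂ (inj₁ p) = proj₁ (pair i≢j (Sublist.++⁺ p (from∈ y∈)))
    ... | inj₂ (inj₂ p) = ≈≤ (symmetric _ _)
      (≤≈ (proj₁ (pair i≢j (Sublist.++⁺ p (from∈ y∈)))) (const i≢j x′∈ x∈ y∈))

    -- The inheritance that makes induction possible. From outside, the leaves of a child look
    -- alike, so a compatible rearrangement `ys` of them can be spliced into the leaf list of the
    -- node; `fits` of the node constrains the result, and the constraint is restricted to `ys`.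
    good-child : ∀ i → Good (lookup βs i)
    good-child i = record
      { unique = Unique-resp-⊇ (leaves-⊆ βs i) unique
      ; comp   = λ {T′} r → CompatL-⊆
          (subst (λ β → leaves β ⊆ leavesAll (βs [ i ]≔ T′)) (Vec.lookup∘update i βs T′)
                 (leaves-⊆ (βs [ i ]≔ T′) i))
          (comp (≅-child βs i r))
      ; fits   = fits-child
      }
      where
      fits-child : ∀ {ys} → ys ↭ leaves (lookup βs i) → CompatL ys → Fits (Before ys) (lookup βs i)
      fits-child {ys} perm cl with leavesAll-split βs i
      ... | pre , post , eq , out =
        restrict (fits (↭-trans perm′ (↭-reflexive (sym eq)))
          (CompatL-replace pre post (subst CompatL eq compat) perm cl mod))
        where
        zs = pre ++ ys ++ post
        perm′ : zs ↭ pre ++ leaves (lookup βs i) ++ post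
        perm′ = Perm↭.++⁺ˡ pre (Perm↭.++⁺ʳ post perm)
        mod : ∀ {x y z} → z ∈ˡ pre ⊎ z ∈ˡ post → x ∈ᵀ lookup βs i → y ∈ᵀ lookup βs i → d z x ≈ d z y
        mod z∈ x∈ y∈ = let j , j≢i , z∈j = out z∈ in
          const₂ j≢i z∈j z∈j x∈ y∈
        u : Unique zs
        u = Unique-resp-↭ (↭-trans (↭-reflexive eq) (↭-sym perm′)) unique
        s : ys ⊆ zs
        s = Sublist.++⁺ˡ pre (Sublist.++⁺ʳ post ⊆-refl)
        restrict : Fits (Before zs) (node l βs) → Fits (Before ys) (lookup βs i)
        restrict (node _ _ fs) = Fits-mono
          (λ x∈ y∈ → Before-restrict u s (∈-resp-↭ (↭-sym perm) x∈) (∈-resp-↭ (↭-sym perm) y∈))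
          (λ _ _ p → ⊆-trans p s) (fs i)

  -- Swapping the first two or the last two of the three children keeps compatibility, and each swap
  -- reverses one of the inequalities of the original triple.
  P-triple : ∀ {k} (βs : Vec (PQTree n) (2 + k)) → Reachable P βs → ∀ {p q r x y z} →
             p Fin.< q → q Fin.< r →
             x ∈ᵀ lookup βs p → y ∈ᵀ lookup βs q → z ∈ᵀ lookup βs r →
             d x y ≈ d x z × d x z ≈ d y z
  P-triple βs comp {p} {q} {r} {x} {y} {z} p<q q<r x∈ y∈ z∈ =
    antisym (proj₁ xyz) (proj₁ xzy) , antisym (proj₂ yxz) (proj₂ xyz)
    where
    p≢q = Fin.<⇒≢ p<q
    q≢r = Fin.<⇒≢ q<r
    p≢r = Fin.<⇒≢ (Fin.<-trans p<q q<r)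
    xyz : Rob x y z
    xyz = permuted-triple βs comp Perm.id p<q q<r refl refl refl x∈ y∈ z∈
    yxz : Rob y x z
    yxz = permuted-triple βs comp (transpose p q) p<q q<r (transpose-first p q) (transpose-second p q)
            (transpose-other (p≢r ∘ sym) (q≢r ∘ sym)) y∈ x∈ z∈
    xzy : Rob x z y
    xzy = permuted-triple βs comp (transpose q r) p<q q<r (transpose-other p≢q p≢r)
            (transpose-first q r) (transpose-second q r) x∈ z∈ y∈

  P-row : ∀ {k} (βs : Vec (PQTree n) (2 + k)) → Reachable P βs → ∀ {i j m x y z} →
          i ≢ j → j ≢ m → i ≢ m →
          x ∈ᵀ lookup βs i → y ∈ᵀ lookup βs j → z ∈ᵀ lookup βs m → d x y ≈ d x z
  P-row βs comp {i} {j} {m} i≢j j≢m i≢m x∈ y∈ z∈ with Fin.<-cmp i j | Fin.<-cmp j m | Fin.<-cmp i m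
  ... | tri≈ _ e _  | _           | _           = contradiction e i≢j
  ... | _           | tri≈ _ e _  | _           = contradiction e j≢m
  ... | _           | _           | tri≈ _ e _  = contradiction e i≢m
  ... | tri< ij _ _ | tri< jm _ _ | _           = proj₁ (P-triple βs comp ij jm x∈ y∈ z∈)
  ... | _           | tri> _ _ mj | tri< im _ _ = ≈-sym (proj₁ (P-triple βs comp im mj x∈ z∈ y∈))
  ... | tri> _ _ ji | _           | tri< im _ _ = d-sym (let p , q = P-triple βs comp ji im y∈ x∈ z∈ in ≈-trans p q)
  ... | tri> _ _ ji | tri> _ _ mj | _           = let p , q = P-triple βs comp mj ji z∈ y∈ x∈ in d-sym (≈-trans (≈-sym q) (symmetric _ _))
  ... | tri< ij _ _ | _           | tri> _ _ mi = let p , q = P-triple βs comp mi ij z∈ x∈ y∈ in ≈-trans (≈-sym (≈-trans p q)) (symmetric _ _)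
  ... | _           | tri< jm _ _ | tri> _ _ mi = let p , q = P-triple βs comp jm mi y∈ z∈ x∈ in d-sym (≈-trans q (symmetric _ _))

  P-row′ : ∀ {k} {βs : Vec (PQTree n) (2 + k)} → Good (node P βs) → ∀ {i j m x y z} →
           i ≢ j → i ≢ m → x ∈ᵀ lookup βs i → y ∈ᵀ lookup βs j → z ∈ᵀ lookup βs m → d x y ≈ d x z
  P-row′ {βs = βs} good {i} {j} {m} i≢j i≢m x∈ y∈ z∈ with j Fin.≟ m
  ... | yes refl = Node.const₂ βs good i≢j x∈ x∈ y∈ z∈
  ... | no  j≢m  = P-row βs (Good.comp good) i≢j j≢m i≢m x∈ y∈ z∈

  -- The common distance is expressed at leaves of the first two children because `ρ` reads it
  -- there.
  Hom-P : ∀ {k} {βs : Vec (PQTree n) (2 + k)} → Good (node P βs) → ∀ {x₀ x₁} →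
          x₀ ∈ᵀ lookup βs zero → x₁ ∈ᵀ lookup βs (suc zero) → Hom βs (d x₀ x₁)
  Hom-P {βs = βs} good {x₀} {x₁} x₀∈ x₁∈ {i} i≢j x∈ y∈ with i Fin.≟ zero
  ... | yes refl = ≈-trans (P-row′ good i≢j (λ ()) x∈ y∈ x₁∈) (Node.const βs good (λ ()) x∈ x₀∈ x₁∈)
  ... | no  i≢0  = ≈-trans (P-row′ good i≢j i≢0 x∈ y∈ x₀∈) (d-sym (P-row′ good (i≢0 ∘ sym) (λ ()) x₀∈ x∈ x₁∈))

  Hom-2 : ∀ {L : Set} (βs : Vec (Tree L (Fin n)) 2) →
          (∀ {x x′ y y′} → x ∈ᵀ lookup βs zero → x′ ∈ᵀ lookup βs zero →
             y ∈ᵀ lookup βs (suc zero) → y′ ∈ᵀ lookup βs (suc zero) → d x y ≈ d x′ y′) →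
          ∀ {x₀ x₁} → x₀ ∈ᵀ lookup βs zero → x₁ ∈ᵀ lookup βs (suc zero) → Hom βs (d x₀ x₁)
  Hom-2 βs c x₀∈ x₁∈ {zero}     {zero}     i≢j x∈ y∈ = contradiction refl i≢j
  Hom-2 βs c x₀∈ x₁∈ {zero}     {suc zero} i≢j x∈ y∈ = c x∈ x₀∈ y∈ x₁∈
  Hom-2 βs c x₀∈ x₁∈ {suc zero} {zero}     i≢j x∈ y∈ = d-sym (c y∈ x₀∈ x∈ x₁∈)
  Hom-2 βs c x₀∈ x₁∈ {suc zero} {suc zero} i≢j x∈ y∈ = contradiction refl i≢j

  -- Rearrangements excluded by the tree

  module _ {l k} (βs : Vec (PQTree n) (2 + k)) (good : Good (node l βs)) where

    open Node βs good

    -- The leaves of one child and those of its siblings, each kept in the order of the node, so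
    -- that both lists are compatible as sublists.
    module Cut (i : Fin (2 + k)) where
      inside? : Decidable (_∈ᵀ lookup βs i)
      inside? x = x ∈ᵀ? lookup βs i
      B R : List (Fin n)
      B = filter inside? xs
      R = filter (¬? ∘ inside?) xs
      B⊆ : B ⊆ xs
      B⊆ = Sublist.filter-⊆ inside? xs
      R⊆ : R ⊆ xs
      R⊆ = Sublist.filter-⊆ (¬? ∘ inside?) xs
      B∈ : ∀ {x} → x ∈ˡ B → x ∈ᵀ lookup βs i
      B∈ p = proj₂ (∈-filter⁻ inside? {xs = xs} p)
      R∈ : ∀ {x} → x ∈ˡ R → ∃ λ j → j ≢ i × x ∈ᵀ lookup βs j
      R∈ p = let q , x∉ = ∈-filter⁻ (¬? ∘ inside?) {xs = xs} p
                 j , r = leavesAll⁻ βs q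
             in j , (λ e → x∉ (subst (λ j → _ ∈ᵀ lookup βs j) e r)) , r
      ∈B : ∀ {x} → x ∈ᵀ lookup βs i → x ∈ˡ B
      ∈B p = ∈-filter⁺ inside? (up i p) p
      ∈R : ∀ {j x} → j ≢ i → x ∈ᵀ lookup βs j → x ∈ˡ R
      ∈R j≢i p = ∈-filter⁺ (¬? ∘ inside?) (up _ p) (λ q → j≢i (sameChild βs unique p q))
      BR↭ : B ++ R ↭ xs
      BR↭ = filter-↭ inside? xs

    diam-Hom : ∀ {δ} → Hom βs δ → ∀ {x y} → x ∈ˡ xs → y ∈ˡ xs → d x y ≤ᵛ δ
    diam-Hom hom x∈ y∈ with leavesAll⁻ βs x∈ | leavesAll⁻ βs y∈
    ... | i , p | j , q with i Fin.≟ j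
    ...   | no  i≢j  = ≤ᵛ-reflexive (hom i≢j p q)
    ...   | yes refl = let m , m≢i = otherIndex i ; w , w∈ = someLeaf∈ (lookup βs m) in
      ≤≈ (diam (m≢i ∘ sym) p q w∈) (hom (m≢i ∘ sym) p w∈)

    -- Otherwise the other children could be inserted between the part of βᵢ
    -- inside M and the part outside M.
    no-split : ∀ {δ} → Hom βs δ → (M : Subset n) → ∀ {i m z} →
               m ∈ᵀ lookup βs i → m ∈ M → z ∈ᵀ lookup βs i → z ∉ M →
               (∀ {x y} → x ∈ᵀ lookup βs i → x ∈ M → y ∈ᵀ lookup βs i → y ∉ M → d x y ≈ δ) → ⊥
    no-split {δ} hom M {i} {m} {z} m∈ m∈M z∈ z∉M split = conflict (fits perm cl)
      where
      open Cut i
      inM? : Decidable (_∈ M)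
      inM? = _∈? M
      B₁ = filter inM? B
      B₂ = filter (¬? ∘ inM?) B
      -- All distances between two of these three blocks equal `δ`, which also bounds the diameter,
      -- so `CompatL-join` applies twice.
      ys = B₁ ++ R ++ B₂
      perm : ys ↭ xs
      perm = ↭-trans (Perm↭.++⁺ˡ B₁ (Perm↭.++-comm R B₂))
             (↭-trans (↭-reflexive (sym (List.++-assoc B₁ B₂ R)))
             (↭-trans (Perm↭.++⁺ʳ R (filter-↭ inM? B)) BR↭))
      B₁∈ : ∀ {x} → x ∈ˡ B₁ → x ∈ᵀ lookup βs i × x ∈ M
      B₁∈ p = let q , r = ∈-filter⁻ inM? {xs = B} p in B∈ q , r
      B₂∈ : ∀ {x} → x ∈ˡ B₂ → x ∈ᵀ lookup βs i × x ∉ M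
      B₂∈ p = let q , r = ∈-filter⁻ (¬? ∘ inM?) {xs = B} p in B∈ q , r
      diam≤ : ∀ {as x y} → (∀ {x} → x ∈ˡ as → x ∈ˡ xs) → x ∈ˡ as → y ∈ˡ as → d x y ≤ᵛ δ
      diam≤ sub p q = diam-Hom hom (sub p) (sub q)
      sub₁ : ∀ {x} → x ∈ˡ B₁ → x ∈ˡ xs
      sub₁ p = up i (proj₁ (B₁∈ p))
      sub₂ : ∀ {x} → x ∈ˡ B₂ → x ∈ˡ xs
      sub₂ p = up i (proj₁ (B₂∈ p))
      subR : ∀ {x} → x ∈ˡ R → x ∈ˡ xs
      subR = Sublist.lookup R⊆
      subRB₂ : ∀ {x} → x ∈ˡ R ++ B₂ → x ∈ˡ xs
      subRB₂ p = [ subR , sub₂ ]′ (∈-++⁻ R p)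
      cross : ∀ {x y} → x ∈ˡ B₁ → y ∈ˡ R ++ B₂ → d x y ≈ δ
      cross p q with ∈-++⁻ R q
      ... | inj₁ r = let j , j≢i , y∈ = R∈ r in hom (j≢i ∘ sym) (proj₁ (B₁∈ p)) y∈
      ... | inj₂ r = split (proj₁ (B₁∈ p)) (proj₂ (B₁∈ p)) (proj₁ (B₂∈ r)) (proj₂ (B₂∈ r))
      cl : CompatL ys
      cl = CompatL-join
        (CompatL-⊆ (⊆-trans (Sublist.filter-⊆ inM? B) B⊆) compat)
        (CompatL-join (CompatL-⊆ R⊆ compat)
          (CompatL-⊆ (⊆-trans (Sublist.filter-⊆ (¬? ∘ inM?) B) B⊆) compat)
          (λ p q → let j , j≢i , x∈ = R∈ p in hom j≢i x∈ (proj₁ (B₂∈ q)))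
          (diam≤ subR) (diam≤ sub₂))
        cross (diam≤ sub₁) (diam≤ subRB₂)
      conflict : ¬ Fits (Before ys) (node l βs)
      conflict (node convex _ _) =
        let j , j≢i = otherIndex i
            w , w∈ = someLeaf∈ (lookup βs j)
            w∈R = ∈R j≢i w∈
            m∈B₁ = ∈-filter⁺ inM? (∈B m∈) m∈M
            z∈B₂ = ∈-filter⁺ (¬? ∘ inM?) (∈B z∈) z∉M
        in j≢i (sameChild βs unique w∈ (convex m∈ (up j w∈) z∈
             (Before-++ m∈B₁ (∈-++⁺ˡ w∈R)) (Sublist.++⁺ˡ B₁ (Before-++ w∈R z∈B₂))))

    -- The set is a decidable predicate because it is instantiated with a module, with the
    -- complement of one, and with the union of two children.
    module _ (l≡Q : l ≡ Q) {P : Pred (Fin n) 0ℓ} (P? : Decidable P)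
             (mod : ∀ {x y z} → P x → P y → x ∈ˡ xs → y ∈ˡ xs → z ∈ˡ xs → ¬ P z → d z x ≈ d z y) where

      -- Reversing the smallest interval containing a module gives another
      -- compatible order; under a Q-node this forces it to be everything.
      hull : ∀ {a b u v} → a ≢ b → u ∈ᵀ lookup βs a → P u → v ∈ᵀ lookup βs b → P v →
             (∃ λ h → h ∈ˡ xs × P h × (∀ {z} → z ∈ˡ xs → z ≡ h ⊎ Before xs h z)) ×
             (∃ λ e → e ∈ˡ xs × P e × (∀ {z} → z ∈ˡ xs → z ≡ e ⊎ Before xs z e))
      hull {a} {b} a≢b u∈ pu v∈ pv with span P? (up a u∈) pu
      ... | pre , H , post , eq , out , (h , h∈ , ph , from-h) , (e , e∈ , pe , to-e) =
        (h , up′ h∈ , ph , λ z∈ → Sum.map₂ lift (from-h (inH z∈))) ,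
        (e , up′ e∈ , pe , λ z∈ → Sum.map₂ lift (to-e (inH z∈)))
        where
        H⊆ : H ⊆ xs
        H⊆ = subst (H ⊆_) (sym eq) (Sublist.++⁺ˡ pre (Sublist.++⁺ʳ post ⊆-refl))
        up′ : ∀ {x} → x ∈ˡ H → x ∈ˡ xs
        up′ = Sublist.lookup H⊆
        lift : ∀ {x y} → Before H x y → Before xs x y
        lift p = ⊆-trans p H⊆
        sub : ∀ {zs} → zs ⊆ pre ++ H ++ post → zs ⊆ xs
        sub = subst (_ ⊆_) (sym eq)
        locate : ∀ {x} → x ∈ˡ xs → x ∈ˡ H ⊎ (x ∈ˡ pre ⊎ x ∈ˡ post)
        locate p with ∈-++⁻ pre (subst (_ ∈ˡ_) eq p)
        ... | inj₁ q = inj₂ (inj₁ q)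
        ... | inj₂ q with ∈-++⁻ H q
        ...   | inj₁ r = inj₁ r
        ...   | inj₂ r = inj₂ (inj₂ r)
        P∈H : ∀ {x} → x ∈ˡ xs → P x → x ∈ˡ H
        P∈H p px = [ id , (λ q → contradiction px (out q)) ]′ (locate p)
        outer∈ : ∀ {z} → z ∈ˡ pre ⊎ z ∈ˡ post → z ∈ˡ xs
        outer∈ (inj₁ q) = subst (_ ∈ˡ_) (sym eq) (∈-++⁺ˡ q)
        outer∈ (inj₂ q) = subst (_ ∈ˡ_) (sym eq) (∈-++⁺ʳ pre (∈-++⁺ʳ H q))
        ends : ∀ {z} → z ∈ˡ pre ⊎ z ∈ˡ post → d z h ≈ d z e
        ends z∈ = mod ph pe (up′ h∈) (up′ e∈) (outer∈ z∈) (out z∈)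
        -- The interval may contain points outside `P`. Seen from beyond the interval, the distance
        -- to such a point is squeezed between the distances to the two ends, which agree as both
        -- ends satisfy `P`.
        hull-mod : ∀ {w z} → z ∈ˡ pre ⊎ z ∈ˡ post → w ∈ˡ H → d z w ≈ d z h
        hull-mod {w} {z} z∈ w∈ with from-h w∈ | to-e w∈
        ... | inj₁ refl | _         = ≈-refl
        ... | inj₂ _    | inj₁ refl = ≈-sym (ends z∈)
        ... | inj₂ hw   | inj₂ we   = squeeze z∈
          where
          squeeze : z ∈ˡ pre ⊎ z ∈ˡ post → d z w ≈ d z h
          squeeze (inj₁ q) = antisym
            (≤≈ (proj₁ (compat (sub (Sublist.++⁺ (from∈ q) (Sublist.++⁺ʳ post we))))) (≈-sym (ends z∈)))
            (proj₁ (compat (sub (Sublist.++⁺ (from∈ q) (Sublist.++⁺ʳ post hw)))))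
          squeeze (inj₂ q) = antisym
            (≈≤ (symmetric _ _) (≤≈ (proj₂ (compat (sub (Sublist.++⁺ˡ pre (Sublist.++⁺ hw (from∈ q)))))) (symmetric _ _)))
            (≈≤ (ends z∈) (≈≤ (symmetric _ _) (≤≈ (proj₂ (compat (sub (Sublist.++⁺ˡ pre (Sublist.++⁺ we (from∈ q)))))) (symmetric _ _))))
        ys : List (Fin n)
        ys = pre ++ List.reverse H ++ post
        perm : ys ↭ pre ++ H ++ post
        perm = Perm↭.++⁺ˡ pre (Perm↭.++⁺ʳ post (Perm↭.↭-reverse H))
        perm-xs : ys ↭ xs
        perm-xs = ↭-trans perm (↭-reflexive (sym eq))
        uys : Unique ys
        uys = Unique-resp-↭ (↭-sym perm-xs) unique
        cl : CompatL ys
        cl = CompatL-replace pre post (subst CompatL eq compat) (Perm↭.↭-reverse H)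
               (CompatL-reverse H (CompatL-⊆ H⊆ compat))
               (λ z∈ x∈ y∈ → ≈-trans (hull-mod z∈ x∈) (≈-sym (hull-mod z∈ y∈)))
        none : ∀ {a b u v} → a Fin.< b → u ∈ᵀ lookup βs a → P u → v ∈ᵀ lookup βs b → P v →
               ∀ {z} → ¬ (z ∈ˡ pre ⊎ z ∈ˡ post)
        none {a} {b} {u} {v} a<b u∈ pu v∈ pv {z} z∈ = go (fits perm-xs cl) z∈ (leavesAll⁻ βs (outer∈ z∈))
          where
          u∈H = P∈H (up a u∈) pu
          v∈H = P∈H (up b v∈) pv
          Hrev : ∀ {x} → x ∈ˡ H → x ∈ˡ List.reverse H
          Hrev = Any.reverse⁺
          vu : Before ys v u
          vu = Sublist.++⁺ˡ pre (Sublist.++⁺ʳ post (Before-reverse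
                 (Before-restrict unique H⊆ u∈H v∈H (leavesAll-before βs a<b u∈ v∈))))
          -- After the reversal `v` precedes `u`, and a point `z` left of the interval is still left
          -- of both. If the child of `z` comes before βₐ, the middle one of three children has
          -- changed; if it is βₐ, then `v` separates `z` from `u`; if it comes later, the old order
          -- is contradicted. The right side is symmetric.
          go : Fits (Before ys) (node l βs) → z ∈ˡ pre ⊎ z ∈ˡ post → (∃ λ c → z ∈ᵀ lookup βs c) → ⊥
          go (node convex betw _) (inj₁ q) (c , z∈c) with Fin.<-cmp c a
          ... | tri< c<a _ _ = case betw l≡Q c<a a<b z∈c u∈ v∈ of λ where
                 (inj₁ (_ , uv)) → Before-asym uys uv vu
                 (inj₂ (_ , uz)) → Before-asym uys uz (Before-++ q (∈-++⁺ˡ (Hrev u∈H)))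
          ... | tri≈ _ refl _ = Fin.<⇒≢ a<b (sameChild βs unique
                 (convex z∈c (up b v∈) u∈ (Before-++ q (∈-++⁺ˡ (Hrev v∈H))) vu) v∈)
          ... | tri> _ _ a<c = ℕ.<⇒≱ a<c (Before-≤ βs unique z∈c u∈
                 (sub (Before-++ q (∈-++⁺ˡ u∈H))))
          go (node convex betw _) (inj₂ q) (c , z∈c) with Fin.<-cmp b c
          ... | tri< b<c _ _ = case betw l≡Q a<b b<c u∈ v∈ z∈c of λ where
                 (inj₁ (uv , _)) → Before-asym uys uv vu
                 (inj₂ (zv , _)) → Before-asym uys zv (Sublist.++⁺ˡ pre (Before-++ (Hrev v∈H) q))
          ... | tri≈ _ refl _ = Fin.<⇒≢ a<b (sameChild βs unique u∈
                 (convex v∈ (up a u∈) z∈c vu (Sublist.++⁺ˡ pre (Before-++ (Hrev u∈H) q))))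
          ... | tri> _ _ c<b = ℕ.<⇒≱ c<b (Before-≤ βs unique v∈ z∈c
                 (sub (Sublist.++⁺ˡ pre (Before-++ v∈H q))))
        inH : ∀ {x} → x ∈ˡ xs → x ∈ˡ H
        inH p with locate p
        ... | inj₁ q = q
        ... | inj₂ q with Fin.<-cmp a b
        ...   | tri< a<b _ _ = ⊥-elim (none a<b u∈ pu v∈ pv q)
        ...   | tri≈ _ e _   = contradiction e a≢b
        ...   | tri> _ _ b<a = ⊥-elim (none b<a v∈ pv u∈ pu q)

  -- Apex children of a Q-node

  module QNode {k} (βs : Vec (PQTree n) (3 + k)) (good : Good (node Q βs)) where

    open Node βs good

    -- Otherwise the child βᵢ could be moved to one of the two ends.
    apex-far : ∀ {i δ} → Apex βs i δ → ¬ (∀ {x y} → x ∈ˡ xs → y ∈ˡ xs → d x y ≤ᵛ δ)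
    apex-far {i} {δ} apex small = go i refl
      where
      open Cut βs good i
      ∈xs : ∀ {as x y} → as ⊆ xs → x ∈ˡ as → y ∈ˡ as → d x y ≤ᵛ δ
      ∈xs s p q = small (Sublist.lookup s p) (Sublist.lookup s q)
      far : ∀ {x y} → x ∈ˡ B → y ∈ˡ R → d x y ≈ δ
      far p q = let j , j≢i , y∈ = R∈ q in apex j≢i (B∈ p) y∈
      front : Fits (Before (B ++ R)) (node Q βs)
      front = fits BR↭ (CompatL-join (CompatL-⊆ B⊆ compat) (CompatL-⊆ R⊆ compat) far (∈xs B⊆) (∈xs R⊆))
      end : Fits (Before (R ++ B)) (node Q βs)
      end = fits (↭-trans (Perm↭.++-comm R B) BR↭)
        (CompatL-join (CompatL-⊆ R⊆ compat) (CompatL-⊆ B⊆ compat) (λ p q → d-sym (far q p)) (∈xs R⊆) (∈xs B⊆))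
      u₁ : Unique (B ++ R)
      u₁ = Unique-resp-↭ (↭-sym BR↭) unique
      u₂ : Unique (R ++ B)
      u₂ = Unique-resp-↭ (Perm↭.++-comm B R) u₁
      leafOf : ∀ j → ∃ λ x → x ∈ᵀ lookup βs j
      leafOf j = someLeaf∈ (lookup βs j)
      inR : ∀ {a b x y} → a ≢ i → b ≢ i → a Fin.< b → x ∈ᵀ lookup βs a → y ∈ᵀ lookup βs b → Before R x y
      inR a≢i b≢i a<b x∈ y∈ = Before-restrict unique R⊆ (∈R a≢i x∈) (∈R b≢i y∈) (leavesAll-before βs a<b x∈ y∈)
      -- The apex is moved to the end if it is the first child and to the front otherwise; taken
      -- with two of its siblings, the move changes the middle one of the three.
      go : ∀ j → j ≡ i → ⊥
      go zero refl with end | leafOf zero | leafOf (suc zero) | leafOf (suc (suc zero))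
      ... | node _ betw _ | x , x∈ | y , y∈ | z , z∈ =
        case betw refl (s≤s z≤n) (s≤s (s≤s z≤n)) x∈ y∈ z∈ of λ where
          (inj₁ (xy , _)) → Before-asym u₂ xy (Before-++ (∈R (λ ()) y∈) (∈B x∈))
          (inj₂ (zy , _)) → Before-asym u₂ zy (Sublist.++⁺ʳ B (inR (λ ()) (λ ()) (s≤s (s≤s z≤n)) y∈ z∈))
      go (suc zero) refl with front | leafOf zero | leafOf (suc zero) | leafOf (suc (suc zero))
      ... | node _ betw _ | x , x∈ | y , y∈ | z , z∈ =
        case betw refl (s≤s z≤n) (s≤s (s≤s z≤n)) x∈ y∈ z∈ of λ where
          (inj₁ (xy , _)) → Before-asym u₁ xy (Before-++ (∈B y∈) (∈R (λ ()) x∈))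
          (inj₂ (zy , _)) → Before-asym u₁ zy (Before-++ (∈B y∈) (∈R (λ ()) z∈))
      go (suc (suc j)) refl with front | leafOf zero | leafOf (suc zero) | leafOf (suc (suc j))
      ... | node _ betw _ | x , x∈ | y , y∈ | z , z∈ =
        case betw refl (s≤s z≤n) (s≤s (s≤s z≤n)) x∈ y∈ z∈ of λ where
          (inj₁ (_ , yz)) → Before-asym u₁ yz (Before-++ (∈B z∈) (∈R (λ ()) y∈))
          (inj₂ (_ , yx)) → Before-asym u₁ yx (Sublist.++⁺ˡ B (inR (λ ()) (λ ()) (s≤s z≤n) x∈ y∈))

    -- A pair touching βᵢ once is at distance `δ`, and a pair inside βᵢ is bounded through `diam`.
    -- Only pairs among the siblings remain, and by symmetry only in list order.
    apex-diam : ∀ {i δ} → Apex βs i δ →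
                (∀ {a b x y w} → a ≢ i → b ≢ i → x ∈ᵀ lookup βs a → y ∈ᵀ lookup βs b → w ∈ᵀ lookup βs i →
                   Before xs x y → d x y ≤ᵛ δ) →
                ∀ {x y} → x ∈ˡ xs → y ∈ˡ xs → d x y ≤ᵛ δ
    apex-diam {i} apex outer {x} {y} x∈ y∈ with leavesAll⁻ βs x∈ | leavesAll⁻ βs y∈
    ... | a , p | b , q with a Fin.≟ i | b Fin.≟ i
    ...   | yes refl | no b≢i   = ≤ᵛ-reflexive (apex b≢i p q)
    ...   | no a≢i   | yes refl = ≤ᵛ-reflexive (d-sym (apex a≢i q p))
    ...   | yes refl | yes refl = let m , m≢i = otherIndex i ; w , w∈ = someLeaf∈ (lookup βs m) in
      ≤≈ (diam (m≢i ∘ sym) p q w∈) (apex m≢i p w∈)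
    ...   | no a≢i   | no b≢i   with someLeaf∈ (lookup βs i) | Before-cmp x∈ y∈
    ...     | w , w∈ | inj₁ refl       = ≤≈ (d-diag≤ _ _ _) (apex a≢i w∈ p)
    ...     | w , w∈ | inj₂ (inj₁ xy) = outer a≢i b≢i p q w∈ xy
    ...     | w , w∈ | inj₂ (inj₂ yx) = ≈≤ (symmetric _ _) (outer b≢i a≢i q p w∈ yx)

    -- If the apex came first, with a leaf `w`, then `d x y ≤ d w y ≈ δ` for leaves `x` before `y`
    -- of the siblings; so `δ` would bound the diameter, against `apex-far`. The last position is
    -- symmetric. This is why searching the interior positions is enough.
    apex-interior : ∀ {i δ} → Apex βs i δ → (∃ λ (a : Fin (3 + k)) → a Fin.< i) × (∃ λ (b : Fin (3 + k)) → i Fin.< b)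
    apex-interior {i} {δ} apex = left (i Fin.≟ zero) , right (i Fin.≟ fromℕ (2 + k))
      where
      left : Dec (i ≡ zero) → ∃ λ (a : Fin (3 + k)) → a Fin.< i
      left (no i≢0)   = zero , Fin.≤∧≢⇒< z≤n (i≢0 ∘ sym)
      left (yes refl) = ⊥-elim (apex-far apex (apex-diam apex λ a≢i b≢i x∈ y∈ w∈ xy →
        ≤≈ (proj₂ (compat (Before-chain unique (leavesAll-before βs (Fin.≤∧≢⇒< z≤n (a≢i ∘ sym)) w∈ x∈) xy)))
           (apex b≢i w∈ y∈)))
      right : Dec (i ≡ fromℕ (2 + k)) → ∃ λ (b : Fin (3 + k)) → i Fin.< b
      right (no i≢l)   = fromℕ (2 + k) , Fin.≤∧≢⇒< (Fin.≤fromℕ i) i≢l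
      right (yes refl) = ⊥-elim (apex-far apex (apex-diam apex λ a≢i b≢i x∈ y∈ w∈ xy →
        ≤≈ (proj₁ (compat (Before-chain unique xy (leavesAll-before βs (Fin.≤∧≢⇒< (Fin.≤fromℕ _) b≢i) y∈ w∈))))
           (d-sym (apex a≢i w∈ x∈))))

    -- Two apex children together would form a module with the whole node as
    -- its hull.
    apex-unique : ∀ {i i′ δ δ′} → Apex βs i δ → Apex βs i′ δ′ → i ≡ i′
    apex-unique {i} {i′} {δ} {δ′} apex apex′ with i Fin.≟ i′
    ... | yes e   = e
    ... | no i≢i′ = ⊥-elim (ends (apex-interior apex))
      where
      P? : Decidable (λ x → x ∈ᵀ lookup βs i ⊎ x ∈ᵀ lookup βs i′)
      P? x = (x ∈ᵀ? lookup βs i) ⊎-dec (x ∈ᵀ? lookup βs i′)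
      u = someLeaf∈ (lookup βs i)
      v = someLeaf∈ (lookup βs i′)
      δ≈δ′ : δ ≈ δ′
      δ≈δ′ = ≈-trans (≈-sym (apex (i≢i′ ∘ sym) (proj₂ u) (proj₂ v))) (d-sym (apex′ i≢i′ (proj₂ v) (proj₂ u)))
      toδ : ∀ {x z} → x ∈ᵀ lookup βs i ⊎ x ∈ᵀ lookup βs i′ → z ∈ˡ xs → ¬ (z ∈ᵀ lookup βs i ⊎ z ∈ᵀ lookup βs i′) →
            d z x ≈ δ
      toδ px z∈ ¬pz with leavesAll⁻ βs z∈
      ... | j , q with px
      ...   | inj₁ x∈ = d-sym (apex (λ { refl → ¬pz (inj₁ q) }) x∈ q)
      ...   | inj₂ x∈ = d-sym (≈-trans (apex′ (λ { refl → ¬pz (inj₂ q) }) x∈ q) (≈-sym δ≈δ′))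
      H = hull βs good refl P? (λ px py _ _ z∈ ¬pz → ≈-trans (toδ px z∈ ¬pz) (≈-sym (toδ py z∈ ¬pz)))
               i≢i′ (proj₂ u) (inj₁ (proj₂ u)) (proj₂ v) (inj₂ (proj₂ v))
      ends : ¬ ((∃ λ (a : Fin (3 + k)) → a Fin.< i) × (∃ λ (b : Fin (3 + k)) → i Fin.< b))
      -- The hull reaches the first leaf `h` and the last leaf `e`. As βᵢ has siblings on both
      -- sides, both leaves lie in the other apex child, which would then surround βᵢ.
      ends ((a , a<i) , (b , i<b)) with H
      ... | (h , h∈ , ph , from-h) , (e , e∈ , pe , to-e) = finish (h∈i′ ph) (e∈i′ pe)
        where
        x = someLeaf∈ (lookup βs a)
        y = someLeaf∈ (lookup βs b)
        h∈i′ : h ∈ᵀ lookup βs i ⊎ h ∈ᵀ lookup βs i′ → h ∈ᵀ lookup βs i′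
        h∈i′ (inj₂ p) = p
        h∈i′ (inj₁ p) with from-h (up a (proj₂ x))
        ... | inj₁ e = contradiction (sameChild βs unique (proj₂ x) (subst (_∈ᵀ lookup βs i) (sym e) p)) (Fin.<⇒≢ a<i)
        ... | inj₂ q = contradiction (Before-≤ βs unique p (proj₂ x) q) (ℕ.<⇒≱ a<i)
        e∈i′ : e ∈ᵀ lookup βs i ⊎ e ∈ᵀ lookup βs i′ → e ∈ᵀ lookup βs i′
        e∈i′ (inj₂ p) = p
        e∈i′ (inj₁ p) with to-e (up b (proj₂ y))
        ... | inj₁ e = contradiction (sameChild βs unique (proj₂ y) (subst (_∈ᵀ lookup βs i) (sym e) p)) (Fin.<⇒≢ i<b ∘ sym)
        ... | inj₂ q = contradiction (Before-≤ βs unique (proj₂ y) p q) (ℕ.<⇒≱ i<b)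
        finish : h ∈ᵀ lookup βs i′ → e ∈ᵀ lookup βs i′ → ⊥
        finish h∈′ e∈′ with from-h (up i (proj₂ u)) | to-e (up i (proj₂ u))
        ... | inj₁ refl | _         = i≢i′ (sameChild βs unique (proj₂ u) h∈′)
        ... | inj₂ _    | inj₁ refl = i≢i′ (sameChild βs unique (proj₂ u) e∈′)
        ... | inj₂ hu   | inj₂ ue   = i≢i′ (Fin.≤-antisym (Before-≤ βs unique (proj₂ u) e∈′ ue)
                                                          (Before-≤ βs unique h∈′ (proj₂ u) hu))

    -- Let `h` and `e` be the first and last leaf, both in `M`. For `z` before `z′` outside `M`, the
    -- triple `h z z′` gives `d h z ≤ d h z′`, and `z z′ e` gives the converse since outside points
    -- do not tell `h` from `e`. Hence `d h z₀` is the distance across `M`, and `hull` applies to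
    -- the outside too.
    split⇒apex : (M : Subset n) →
      (∀ {x y z} → x ∈ M → y ∈ M → x ∈ˡ xs → y ∈ˡ xs → z ∈ˡ xs → z ∉ M → d z x ≈ d z y) →
      ∀ {a b u v z₀} → a ≢ b → u ∈ᵀ lookup βs a → u ∈ M → v ∈ᵀ lookup βs b → v ∈ M → z₀ ∈ˡ xs → z₀ ∉ M →
      ∃₂ λ i δ → Apex βs i δ × (∀ {z} → z ∈ˡ xs → z ∉ M → z ∈ᵀ lookup βs i) ×
                 (∀ {m z} → m ∈ˡ xs → m ∈ M → z ∈ˡ xs → z ∉ M → d m z ≈ δ)
    split⇒apex M mod {z₀ = z₀} a≢b u∈ u∈M v∈ v∈M z₀∈ z₀∉ with hull βs good refl (_∈? M) mod a≢b u∈ u∈M v∈ v∈M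
    ... | (h , h∈ , h∈M , from-h) , (e , e∈ , e∈M , to-e) = i , d h z₀ , apex , rest∈ , split
      where
      i = proj₁ (leavesAll⁻ βs z₀∈)
      z₀∈i = proj₂ (leavesAll⁻ βs z₀∈)
      h< : ∀ {z} → z ∈ˡ xs → z ∉ M → Before xs h z
      h< z∈ z∉ = [ (λ { refl → contradiction h∈M z∉ }) , id ]′ (from-h z∈)
      <e : ∀ {z} → z ∈ˡ xs → z ∉ M → Before xs z e
      <e z∈ z∉ = [ (λ { refl → contradiction e∈M z∉ }) , id ]′ (to-e z∈)
      ordered : ∀ {z z′} → z ∈ˡ xs → z ∉ M → z′ ∈ˡ xs → z′ ∉ M → Before xs z z′ → d h z ≈ d h z′
      ordered z∈ z∉ z′∈ z′∉ zz′ = antisym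
        (proj₁ (compat (Before-chain unique (h< z∈ z∉) zz′)))
        (≈≤ (≈-trans (symmetric _ _) (mod h∈M e∈M h∈ e∈ z′∈ z′∉))
        (≤≈ (proj₂ (compat (Before-chain unique zz′ (<e z′∈ z′∉))))
            (≈-trans (mod e∈M h∈M e∈ h∈ z∈ z∉) (symmetric _ _))))
      same : ∀ {z} → z ∈ˡ xs → z ∉ M → d h z ≈ d h z₀
      same z∈ z∉ with Before-cmp z∈ z₀∈
      ... | inj₁ refl     = ≈-refl
      ... | inj₂ (inj₁ p) = ordered z∈ z∉ z₀∈ z₀∉ p
      ... | inj₂ (inj₂ p) = ≈-sym (ordered z₀∈ z₀∉ z∈ z∉ p)
      split : ∀ {m z} → m ∈ˡ xs → m ∈ M → z ∈ˡ xs → z ∉ M → d m z ≈ d h z₀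
      split m∈ m∈M z∈ z∉ = d-sym (≈-trans (mod m∈M h∈M m∈ h∈ z∈ z∉) (d-sym (same z∈ z∉)))
      rest∈ : ∀ {z} → z ∈ˡ xs → z ∉ M → z ∈ᵀ lookup βs i
      rest∈ {z} z∈ z∉ with leavesAll⁻ βs z∈
      ... | j , q with j Fin.≟ i
      ...   | yes refl = q
      -- If the complement of `M` met two children, its hull would start at the first leaf of the
      -- node as well, but that leaf is in `M`.
      ...   | no j≢i with hull βs good refl (λ x → ¬? (x ∈? M))
                            (λ {_} {_} {w} x∉ y∉ x∈ y∈ w∈ ¬w∉ → let w∈M = decidable-stable (w ∈? M) ¬w∉ in
                              ≈-trans (split w∈ w∈M x∈ x∉) (≈-sym (split w∈ w∈M y∈ y∉)))
                            j≢i q z∉ z₀∈i z₀∉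
      ...     | (h′ , h′∈ , h′∉ , from-h′) , _ with from-h′ h∈
      ...       | inj₁ refl = contradiction h∈M h′∉
      ...       | inj₂ h′h  = contradiction h′h (Before-asym unique (h< h′∈ h′∉))
      apex : Apex βs i (d h z₀)
      apex {j} {x} {y} j≢i x∈ y∈ with y ∈? M
      -- The leaf `x` of the apex child may itself belong to `M`; `const` replaces it by `z₀`, which
      -- does not.
      ... | yes y∈M = ≈-trans (const (j≢i ∘ sym) x∈ z₀∈i y∈) (d-sym (split (up j y∈) y∈M z₀∈ z₀∉))
      ... | no y∉M  = contradiction (sameChild βs unique y∈ (rest∈ (up j y∈) y∉M)) j≢i

  -- Mmodule trees relative to the leaves of a tree

  ModuleIn : ∀ {L : Set} → Tree L (Fin n) → Subset n → Set ℓ₁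
  ModuleIn T M = ∀ {x y z} → x ∈ M → y ∈ M → z ∈ᵀ T → z ∉ M → d z x ≈ d z y

  -- The mmodule tree of the subspace on the leaves of U.
  record MmoduleTree (U : MTree n) : Set ℓ₁ where
    field
      arity    : ∀ {k} {βs : Vec (MTree n) (2 + k)} → InnerNode U ∪ₙ βs → 3 ≤ 2 + k
      sound    : ∀ (p : Place U) → Admissible p → ModuleIn U (setAt p)
      complete : ∀ M → (∀ {x} → x ∈ M → x ∈ᵀ U) → Nonempty M → (∃ λ z → z ∈ᵀ U × z ∉ M) →
                 ModuleIn U M → ∃ λ (p : Place U) → Admissible p × setAt p ≡ M

  MmoduleTree-leaf : ∀ x → MmoduleTree (leaf x)
  MmoduleTree-leaf x = record
    { arity    = λ ()
    ; sound    = λ { (child∪ () _) ; (children∩ () _) }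
    ; complete = λ { M M⊆ (y , y∈) (z , here refl , z∉) _ → case M⊆ y∈ of λ { (here refl) → contradiction y∈ z∉ } }
    }

  module _ (l : ∪∩) {k} (Us : Vec (MTree n) (2 + k)) (sub : ∀ i → MmoduleTree (lookup Us i))
           (child-const : ∀ {i j x y z} → j ≢ i → x ∈ᵀ lookup Us i → y ∈ᵀ lookup Us i → z ∈ᵀ lookup Us j → d z x ≈ d z y)
           where

    sound-under : ∀ i (p : Place (lookup Us i)) → Admissible p → ModuleIn (node l Us) (setAt p)
    sound-under i p a x∈ y∈ z∈ z∉ with leavesAll⁻ Us z∈
    ... | j , z∈j with j Fin.≟ i
    ...   | yes refl = MmoduleTree.sound (sub i) p a x∈ y∈ z∈j z∉
    ...   | no j≢i   = child-const j≢i (setAt-∈ p x∈) (setAt-∈ p y∈) z∈j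

    -- A set inside one child is either the whole child, to be placed at the root by the caller, or
    -- a proper part of it, for which the child already has a place.
    complete-under : ∀ M i → (∀ {x} → x ∈ M → x ∈ᵀ lookup Us i) → Nonempty M → ModuleIn (node l Us) M →
                     X (lookup Us i) ≡ M ⊎ ∃ λ (p : Place (node l Us)) → Admissible p × setAt p ≡ M
    complete-under M i M⊆ ne mod with covered? (lookup Us i) M
    ... | inj₁ full = inj₁ (≡X (lookup Us i) M⊆ full)
    ... | inj₂ out  = inj₂ (let p , a , eq = MmoduleTree.complete (sub i) M M⊆ ne out
                                               (λ x∈ y∈ z∈ → mod x∈ y∈ (leavesAll⁺ Us i z∈))
                            in liftPlace i p , liftPlace-Admissible {l = l} {Us = Us} i p a , trans (liftPlace-setAt {l = l} {Us = Us} i p) eq)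

  MmoduleTree-∪ : ∀ {k} (Us : Vec (MTree n) (2 + k)) → 3 ≤ 2 + k → (∀ i → MmoduleTree (lookup Us i)) →
    (∀ {i j x y z} → j ≢ i → x ∈ᵀ lookup Us i → y ∈ᵀ lookup Us i → z ∈ᵀ lookup Us j → d z x ≈ d z y) →
    (∀ M → (∀ {x} → x ∈ M → x ∈ˡ leavesAll Us) → Nonempty M → (∃ λ z → z ∈ˡ leavesAll Us × z ∉ M) →
       ModuleIn (node ∪ₙ Us) M → ∃ λ i → ∀ {x} → x ∈ M → x ∈ᵀ lookup Us i) →
    MmoduleTree (node ∪ₙ Us)
  MmoduleTree-∪ {k} Us 3≤ sub child-const classify = record
    { arity    = arity-∪
    ; sound    = sound-∪
    ; complete = λ M M⊆ ne out mod → let i , M⊆i = classify M M⊆ ne out mod in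
        case complete-under ∪ₙ Us sub child-const M i M⊆i ne mod of λ where
          (inj₁ eq) → child∪ root i , tt , eq
          (inj₂ r)  → r
    }
    where
    arity-∪ : ∀ {j} {βs : Vec (MTree n) (2 + j)} → InnerNode (node ∪ₙ Us) ∪ₙ βs → 3 ≤ 2 + j
    arity-∪ root        = 3≤
    arity-∪ (below i q) = MmoduleTree.arity (sub i) q
    sound-∪ : ∀ (p : Place (node ∪ₙ Us)) → Admissible p → ModuleIn (node ∪ₙ Us) (setAt p)
    sound-∪ (child∪ (below i q) j)    a = sound-under ∪ₙ Us sub child-const i (child∪ q j) a
    sound-∪ (children∩ (below i q) S) a = sound-under ∪ₙ Us sub child-const i (children∩ q S) a
    sound-∪ (child∪ root i) a x∈ y∈ z∈ z∉ with leavesAll⁻ Us z∈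
    ... | j , z∈j with j Fin.≟ i
    ...   | yes refl = contradiction (∈X⁺ (lookup Us i) z∈j) z∉
    ...   | no j≢i   = child-const j≢i (∈X⁻ (lookup Us i) x∈) (∈X⁻ (lookup Us i) y∈) z∈j

  -- The alternatives of `classify` may overlap, as for a single whole child; this does no harm
  -- because only the existence of a place is claimed.
  MmoduleTree-∩ : ∀ {k} (Us : Vec (MTree n) (2 + k)) → (∀ i → MmoduleTree (lookup Us i)) → ∀ {δ} → Hom Us δ →
    (∀ M → (∀ {x} → x ∈ M → x ∈ˡ leavesAll Us) → Nonempty M → (∃ λ z → z ∈ˡ leavesAll Us × z ∉ M) →
       ModuleIn (node ∩ₙ Us) M →
       (∃ λ i → ∀ {x} → x ∈ M → x ∈ᵀ lookup Us i) ⊎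
       (∀ i → (∀ {x} → x ∈ᵀ lookup Us i → x ∈ M) ⊎ (∀ {x} → x ∈ᵀ lookup Us i → x ∉ M))) →
    MmoduleTree (node ∩ₙ Us)
  MmoduleTree-∩ {k} Us sub hom classify = record
    { arity    = λ { (below i q) → MmoduleTree.arity (sub i) q }
    ; sound    = sound-∩
    ; complete = λ M M⊆ ne out mod → case classify M M⊆ ne out mod of λ where
        (inj₁ (i , M⊆i)) → case complete-under ∩ₙ Us sub child-const M i M⊆i ne mod of λ where
          (inj₁ eq) → children∩ root ⁅ i ⁆ , ProperNonempty-⁅⁆ i , trans (⋃X-⁅⁆ Us i) eq
          (inj₂ r)  → r
        (inj₂ union) → union-place M M⊆ ne out union
    }
    where
    child-const : ∀ {i j x y z} → j ≢ i → x ∈ᵀ lookup Us i → y ∈ᵀ lookup Us i → z ∈ᵀ lookup Us j → d z x ≈ d z y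
    child-const j≢i x∈ y∈ z∈ = ≈-trans (hom j≢i z∈ x∈) (≈-sym (hom j≢i z∈ y∈))
    sound-∩ : ∀ (p : Place (node ∩ₙ Us)) → Admissible p → ModuleIn (node ∩ₙ Us) (setAt p)
    sound-∩ (child∪ (below i q) j)    a = sound-under ∩ₙ Us sub child-const i (child∪ q j) a
    sound-∩ (children∩ (below i q) S) a = sound-under ∩ₙ Us sub child-const i (children∩ q S) a
    sound-∩ (children∩ root S) a x∈ y∈ z∈ z∉ with leavesAll⁻ Us z∈ | ∈⋃X⁻ Us S x∈ | ∈⋃X⁻ Us S y∈
    ... | j , z∈j | i , i∈S , x∈i | i′ , i′∈S , y∈i′ =
      ≈-trans (hom (λ { refl → z∉ (∈⋃X⁺ Us i∈S z∈j) }) z∈j x∈i)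
              (≈-sym (hom (λ { refl → z∉ (∈⋃X⁺ Us i′∈S z∈j) }) z∈j y∈i′))
    union-place : ∀ M → (∀ {x} → x ∈ M → x ∈ˡ leavesAll Us) → Nonempty M → (∃ λ z → z ∈ˡ leavesAll Us × z ∉ M) →
      (∀ i → (∀ {x} → x ∈ᵀ lookup Us i → x ∈ M) ⊎ (∀ {x} → x ∈ᵀ lookup Us i → x ∉ M)) →
      ∃ λ (p : Place (node ∩ₙ Us)) → Admissible p × setAt p ≡ M
    union-place M M⊆ (m , m∈) (z , z∈ , z∉) union =
      children∩ root S ,
      ((let i , m∈i = leavesAll⁻ Us (M⊆ m∈) in i , meets m∈i m∈) ,
       λ S≡ → let i , z∈i = leavesAll⁻ Us z∈ in z∉ (inside⇒ (subst (i ∈_) (sym S≡) Sub.∈⊤) z∈i)) ,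
      Sub.⊆-antisym
        (λ p → let j , j∈ , q = ∈⋃X⁻ Us S p in inside⇒ j∈ q)
        (λ p → let i , q = leavesAll⁻ Us (M⊆ p) in ∈⋃X⁺ Us (meets q p) q)
      where
      side : ∀ i → Bool
      side i = [ (λ _ → inside) , (λ _ → outside) ]′ (union i)
      S : Subset (2 + k)
      S = tabulate side
      inside⇒ : ∀ {i x} → i ∈ S → x ∈ᵀ lookup Us i → x ∈ M
      inside⇒ {i} i∈ x∈ with union i | trans (sym (Vec.lookup∘tabulate side i)) (Vec.[]=⇒lookup i∈)
      ... | inj₁ all | _ = all x∈
      ... | inj₂ _   | ()
      meets : ∀ {i x} → x ∈ᵀ lookup Us i → x ∈ M → i ∈ S
      meets {i} x∈ x∈M = Vec.lookup⇒[]= i S (trans (Vec.lookup∘tabulate side i) side≡)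
        where
        side≡ : side i ≡ inside
        side≡ with union i
        ... | inj₁ _    = refl
        ... | inj₂ none = contradiction x∈M (none x∈)

  -- The annotated tree and the search for an apex

  open DecTotalOrder V using (_≟_; _≤?_)

  data Annotated : PQTree n → ATree n → Set where
    leaf : ∀ {x} → Annotated (leaf x) (leaf x)
    node : ∀ {l k x} {βs : Vec (PQTree n) (2 + k)} {As} → x ∈ˡ leavesAll βs →
           (∀ i → Annotated (lookup βs i) (lookup As i)) → Annotated (node l βs) (node (l , x) As)

  someLeaf-∈ : ∀ {T A} → Annotated T A → someLeaf A ∈ᵀ T
  someLeaf-∈ leaf       = here refl
  someLeaf-∈ (node p _) = p

  annotate-Annotated : ∀ T → Annotated T (value (annotate T))
  annotateAll-Annotated : ∀ {k} (βs : Vec (PQTree n) k) i → Annotated (lookup βs i) (lookup (value (annotateAll βs)) i)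
  annotate-Annotated (leaf x)            = leaf
  annotate-Annotated (node l βs@(_ ∷ _)) =
    node (leavesAll⁺ βs zero (someLeaf-∈ (annotateAll-Annotated βs zero))) (annotateAll-Annotated βs)
  annotateAll-Annotated (β ∷ βs) zero    = annotate-Annotated β
  annotateAll-Annotated (β ∷ βs) (suc i) = annotateAll-Annotated βs i

  D : ATree n → ATree n → Carrier
  D α β = d (someLeaf α) (someLeaf β)

  -- The equalities tested by `scan`, up to transitivity. The vector `w` starts with the predecessor
  -- of the first candidate, and writing the candidate as `inject₁ (suc i)` guarantees that both
  -- neighbours exist.
  record Pivot {k} (a z : ATree n) (w : Vec (ATree n) (2 + k)) (i : Fin k) (δ : Carrier) : Set ℓ₁ where
    field
      from-first : D a (lookup w (inject₁ (suc i))) ≈ δ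
      from-prev  : D (lookup w (inject₁ (inject₁ i))) (lookup w (inject₁ (suc i))) ≈ δ
      to-next    : D (lookup w (inject₁ (suc i))) (lookup w (suc (suc i))) ≈ δ
      to-last    : D (lookup w (inject₁ (suc i))) z ≈ δ

  map-suc-just : ∀ {k} (r : Maybe (Carrier × Fin k)) {δ i} → Maybe.map (map₂ suc) r ≡ just (δ , i) →
                 ∃ λ j → r ≡ just (δ , j) × i ≡ suc j
  map-suc-just (just (_ , j)) refl = j , refl , refl

  map-suc-nothing : ∀ {k} (r : Maybe (Carrier × Fin k)) → Maybe.map (map₂ Fin.suc) r ≡ nothing → r ≡ nothing
  map-suc-nothing nothing refl = refl

  scan-just : ∀ {k} a z p (v : Vec (ATree n) (suc k)) {δ i} → value (scan V d a z p v) ≡ just (δ , i) →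
              ∃ λ j → i ≡ inject₁ j × Pivot a z (p ∷ v) j δ
  scan-just-later : ∀ {k} a z p β (βs : Vec (ATree n) (suc k)) {δ i} →
                    Maybe.map (map₂ suc) (value (scan V d a z β βs)) ≡ just (δ , i) →
                    ∃ λ j → i ≡ inject₁ j × Pivot a z (p ∷ β ∷ βs) j δ
  scan-just a z p (β ∷ βs@(next ∷ _)) eq with D a β ≟ D p β | D p β ≟ D β next | D β next ≟ D β z
  scan-just a z p (β ∷ βs@(next ∷ _)) refl | yes e₁ | yes e₂ | yes e₃ = zero , refl , record
    { from-first = ≈-refl ; from-prev = ≈-sym e₁ ; to-next = ≈-sym (≈-trans e₁ e₂)
    ; to-last = ≈-sym (≈-trans e₁ (≈-trans e₂ e₃)) }
  ... | no _  | _     | _     = scan-just-later a z p β βs eq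
  ... | yes _ | no _  | _     = scan-just-later a z p β βs eq
  ... | yes _ | yes _ | no _  = scan-just-later a z p β βs eq
  scan-just-later a z p β βs eq with map-suc-just (value (scan V d a z β βs)) eq
  ... | i₀ , eq₀ , refl with scan-just a z β βs eq₀
  ...   | j , refl , piv = suc j , refl , record
    { from-first = Pivot.from-first piv ; from-prev = Pivot.from-prev piv
    ; to-next = Pivot.to-next piv ; to-last = Pivot.to-last piv }

  scan-nothing : ∀ {k} a z p (v : Vec (ATree n) (suc k)) → value (scan V d a z p v) ≡ nothing →
                 ∀ {j δ} → ¬ Pivot a z (p ∷ v) j δ
  scan-nothing-later : ∀ {k} a z p β (βs : Vec (ATree n) (suc k)) →
                       Maybe.map (map₂ Fin.suc) (value (scan V d a z β βs)) ≡ nothing →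
                       ∀ {j δ} → ¬ Pivot a z (p ∷ β ∷ βs) (suc j) δ
  scan-nothing a z p (β ∷ βs@(next ∷ _)) eq {zero} piv with D a β ≟ D p β | D p β ≟ D β next | D β next ≟ D β z
  scan-nothing a z p (β ∷ βs@(next ∷ _)) () {zero} piv | yes _ | yes _ | yes _
  ... | no ¬e | _     | _     = ¬e (≈-trans (Pivot.from-first piv) (≈-sym (Pivot.from-prev piv)))
  ... | yes _ | no ¬e | _     = ¬e (≈-trans (Pivot.from-prev piv) (≈-sym (Pivot.to-next piv)))
  ... | yes _ | yes _ | no ¬e = ¬e (≈-trans (Pivot.to-next piv) (≈-sym (Pivot.to-last piv)))
  scan-nothing a z p (β ∷ βs@(next ∷ _)) eq {suc j} piv with D a β ≟ D p β | D p β ≟ D β next | D β next ≟ D β z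
  scan-nothing a z p (β ∷ βs@(next ∷ _)) () {suc j} piv | yes _ | yes _ | yes _
  ... | no _  | _     | _     = scan-nothing-later a z p β βs eq piv
  ... | yes _ | no _  | _     = scan-nothing-later a z p β βs eq piv
  ... | yes _ | yes _ | no _  = scan-nothing-later a z p β βs eq piv
  scan-nothing-later a z p β βs eq piv = scan-nothing a z β βs (map-suc-nothing (value (scan V d a z β βs)) eq) (record
    { from-first = Pivot.from-first piv ; from-prev = Pivot.from-prev piv
    ; to-next = Pivot.to-next piv ; to-last = Pivot.to-last piv })

  lastChild-value : ∀ {k} (v : Vec (ATree n) (suc k)) → value (lastChild v) ≡ lookup v (fromℕ k)
  lastChild-value (β ∷ [])         = refl
  lastChild-value (_ ∷ βs@(_ ∷ _)) = lastChild-value βs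

  findApex-just : ∀ {k} (As : Vec (ATree n) (3 + k)) {δ i} → value (findApex V d As) ≡ just (δ , i) →
                  ∃ λ j → i ≡ inject₁ (suc j) × Pivot (lookup As zero) (lookup As (fromℕ (2 + k))) As j δ
  findApex-just (A ∷ As) eq with map-suc-just (value (scan V d A (value (lastChild As)) A As)) eq
  ... | i₀ , eq₀ , refl with scan-just A (value (lastChild As)) A As eq₀
  ...   | j , refl , piv = j , refl , subst (λ z → Pivot A z (A ∷ As) j _) (lastChild-value As) piv

  findApex-nothing : ∀ {k} (As : Vec (ATree n) (3 + k)) → value (findApex V d As) ≡ nothing →
                     ∀ {j δ} → ¬ Pivot (lookup As zero) (lookup As (fromℕ (2 + k))) As j δ
  findApex-nothing (A ∷ As) eq piv =
    scan-nothing A (value (lastChild As)) A As (map-suc-nothing (value (scan V d A (value (lastChild As)) A As)) eq)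
      (subst (λ z → Pivot A z (A ∷ As) _ _) (sym (lastChild-value As)) piv)

  interior-index : ∀ {k} {a b i : Fin (3 + k)} → a Fin.< i → i Fin.< b → ∃ λ (j : Fin (1 + k)) → i ≡ inject₁ (suc j)
  interior-index {k} {b = b} {suc i} _ i<b = Fin.lower₁ i ≢ , cong suc (sym (Fin.inject₁-lower₁ i ≢))
    where
    ≢ : suc k ≢ toℕ i
    ≢ e = ℕ.<-irrefl (cong suc (sym e)) (ℕ.<-≤-trans i<b (ℕ.≤-pred (Fin.toℕ<n b)))

  module _ {k} {βs : Vec (PQTree n) (3 + k)} {As : Vec (ATree n) (3 + k)} (good : Good (node Q βs))
           (ann : ∀ i → Annotated (lookup βs i) (lookup As i)) where

    open Node βs good
    open QNode βs good

    private
      rep : ∀ j → someLeaf (lookup As j) ∈ᵀ lookup βs j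
      rep j = someLeaf-∈ (ann j)

      dist≤ˡ : ∀ {a b c : Fin (3 + k)} → a Fin.≤ b → b Fin.< c → D (lookup As b) (lookup As c) ≤ᵛ D (lookup As a) (lookup As c)
      dist≤ˡ {a} {b} {c} a≤b b<c with a Fin.≟ b
      ... | yes refl = ≤ᵛ-refl
      ... | no a≢b   = proj₂ (compat (Before-chain unique
        (leavesAll-before βs (Fin.≤∧≢⇒< a≤b a≢b) (rep a) (rep b)) (leavesAll-before βs b<c (rep b) (rep c))))

      dist≤ʳ : ∀ {a b c : Fin (3 + k)} → a Fin.< b → b Fin.≤ c → D (lookup As a) (lookup As b) ≤ᵛ D (lookup As a) (lookup As c)
      dist≤ʳ {a} {b} {c} a<b b≤c with b Fin.≟ c
      ... | yes refl = ≤ᵛ-refl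
      ... | no b≢c   = proj₁ (compat (Before-chain unique
        (leavesAll-before βs a<b (rep a) (rep b)) (leavesAll-before βs (Fin.≤∧≢⇒< b≤c b≢c) (rep b) (rep c))))

    -- Four distances suffice by monotonicity: for `m` left of `i`, the distance to βₘ lies between
    -- those to the left neighbour and to the first child, both equal to `δ`. On the right, the next
    -- and the last child take these roles.
    Pivot⇒Apex : ∀ {j δ} → Pivot (lookup As zero) (lookup As (fromℕ (2 + k))) As j δ → Apex βs (inject₁ (suc j)) δ
    Pivot⇒Apex {j} {δ} piv {m} m≢i x∈ y∈ = ≈-trans (const₂ (m≢i ∘ sym) x∈ (rep _) y∈ (rep m)) at-rep
      where
      open Pivot piv
      i = inject₁ (suc j)
      toℕ-i : toℕ i ≡ suc (toℕ j)
      toℕ-i = Fin.toℕ-inject₁ (suc j)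
      toℕ-prev : toℕ (inject₁ (inject₁ j)) ≡ toℕ j
      toℕ-prev = trans (Fin.toℕ-inject₁ (inject₁ j)) (Fin.toℕ-inject₁ j)
      at-rep : D (lookup As i) (lookup As m) ≈ δ
      at-rep with Fin.<-cmp m i
      ... | tri≈ _ e _   = contradiction e m≢i
      ... | tri< m<i _ _ = d-sym (antisym
        (≤≈ (dist≤ˡ {zero} {m} {i} z≤n m<i) from-first)
        (≈≤ (≈-sym from-prev) (dist≤ˡ {m} {inject₁ (inject₁ j)} {i}
          (subst (toℕ m ℕ.≤_) (sym toℕ-prev) (ℕ.≤-pred (subst (suc (toℕ m) ℕ.≤_) toℕ-i m<i)))
          (subst₂ ℕ._<_ (sym toℕ-prev) (sym toℕ-i) ℕ.≤-refl))))
      ... | tri> _ _ i<m = antisym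
        (≤≈ (dist≤ʳ {i} {m} {fromℕ (2 + k)} i<m (Fin.≤fromℕ m)) to-last)
        (≈≤ (≈-sym to-next) (dist≤ʳ {i} {suc (suc j)} {m}
          (subst (ℕ._< suc (suc (toℕ j))) (sym toℕ-i) ℕ.≤-refl)
          (subst (λ t → suc t ℕ.≤ toℕ m) toℕ-i i<m)))

    Apex⇒Pivot : ∀ {j δ} → Apex βs (inject₁ (suc j)) δ → Pivot (lookup As zero) (lookup As (fromℕ (2 + k))) As j δ
    Apex⇒Pivot {j} {δ} apex = record
      { from-first = d-sym (to (λ ())) ; from-prev = d-sym (to prev≢)
      ; to-next = to next≢ ; to-last = to last≢ }
      where
      i = inject₁ (suc j)
      toℕ-i : toℕ i ≡ suc (toℕ j)
      toℕ-i = Fin.toℕ-inject₁ (suc j)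
      to : ∀ {m} → m ≢ i → D (lookup As i) (lookup As m) ≈ δ
      to m≢i = apex m≢i (rep _) (rep _)
      prev≢ : inject₁ (inject₁ j) ≢ i
      prev≢ e = ℕ.1+n≢n (trans (sym toℕ-i) (trans (cong toℕ (sym e)) (trans (Fin.toℕ-inject₁ (inject₁ j)) (Fin.toℕ-inject₁ j))))
      next≢ : suc (suc j) ≢ i
      next≢ e = ℕ.1+n≢n (trans (cong toℕ e) toℕ-i)
      last≢ : fromℕ (2 + k) ≢ i
      last≢ e = Fin.fromℕ≢inject₁ e

    findApex-Apex : ∀ {δ i} → value (findApex V d As) ≡ just (δ , i) → Apex βs i δ
    findApex-Apex eq with findApex-just As eq
    ... | j , refl , piv = Pivot⇒Apex piv

    -- `scan` tests neither the first nor the last child as a candidate; `apex-interior` rules out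
    -- an apex there.
    findApex-¬Apex : value (findApex V d As) ≡ nothing → ∀ {δ i} → ¬ Apex βs i δ
    findApex-¬Apex eq apex with apex-interior apex
    ... | (a , a<i) , (b , i<b) with interior-index a<i i<b
    ...   | j , refl = findApex-nothing As eq (Apex⇒Pivot apex)

  -- The value of `ρ` and sets at constant distance from their complement

  data RhoView : PQTree n → Maybe Carrier → Set (c ⊔ ℓ₁) where
    ρ-leaf : ∀ {x} → RhoView (leaf x) nothing
    ρ-hom  : ∀ {l k δ} {βs : Vec (PQTree n) (2 + k)} → Hom βs δ → RhoView (node l βs) (just δ)
    ρ-apex : ∀ {k i δ} {βs : Vec (PQTree n) (3 + k)} → Apex βs i δ → RhoView (node Q βs) (just δ)
    ρ-none : ∀ {k} {βs : Vec (PQTree n) (3 + k)} → RhoView (node Q βs) nothing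

  ρ-view : ∀ {T A} → Annotated T A → Good T → RhoView T (value (ρ V d A))
  ρ-view leaf good = ρ-leaf
  ρ-view (node {P} {As = _ ∷ _ ∷ _} _ ann) good =
    ρ-hom (Hom-P good (someLeaf-∈ (ann zero)) (someLeaf-∈ (ann (suc zero))))
  ρ-view (node {Q} {zero} {βs = βs} {_ ∷ _ ∷ []} _ ann) good =
    ρ-hom (Hom-2 βs (Node.const₂ βs good (λ ())) (someLeaf-∈ (ann zero)) (someLeaf-∈ (ann (suc zero))))
  ρ-view (node {Q} {suc k} {βs = βs} {As} _ ann) good = go (value (findApex V d As)) refl
    where
    go : ∀ r → value (findApex V d As) ≡ r → RhoView (node Q βs) (Maybe.map proj₁ r)
    go nothing        _  = ρ-none
    go (just (δ , i)) eq = ρ-apex (findApex-Apex {As = As} good ann eq)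

  module _ {k} (βs : Vec (PQTree n) (3 + k)) (good : Good (node Q βs)) where

    -- Take one leaf from each of the first three children: two of them are on the same side of `M`.
    -- That side is a module meeting two children, so `split⇒apex` yields an apex at distance `δ`,
    -- and the bound `small` contradicts `apex-far`.
    Q-no-split : ∀ {δ} → (∀ {x y} → x ∈ˡ leavesAll βs → y ∈ˡ leavesAll βs → d x y ≤ᵛ δ) →
                 (M : Subset n) → ∀ {x z} → x ∈ˡ leavesAll βs → x ∈ M → z ∈ˡ leavesAll βs → z ∉ M →
                 ¬ (∀ {x y} → x ∈ˡ leavesAll βs → x ∈ M → y ∈ˡ leavesAll βs → y ∉ M → d x y ≈ δ)
    Q-no-split {δ} small M {x} {z} x∈ x∈M z∈ z∉ split = pigeonhole
      (proj₁ (w zero) ∈? M) (proj₁ (w (suc zero)) ∈? M) (proj₁ (w (suc (suc zero))) ∈? M)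
      where
      w : ∀ j → ∃ λ x → x ∈ᵀ lookup βs j
      w j = someLeaf∈ (lookup βs j)
      inM : ∀ {i j} → i ≢ j → proj₁ (w i) ∈ M → proj₁ (w j) ∈ M → ⊥
      inM i≢j p q with QNode.split⇒apex βs good M
        (λ u∈M v∈M u∈ v∈ y∈ y∉ → ≈-trans (d-sym (split u∈ u∈M y∈ y∉)) (≈-sym (d-sym (split v∈ v∈M y∈ y∉))))
        i≢j (proj₂ (w _)) p (proj₂ (w _)) q z∈ z∉
      ... | i , δ′ , apex , _ , split′ = QNode.apex-far βs good apex
        (λ p q → ≤≈ (small p q) (≈-trans (≈-sym (split x∈ x∈M z∈ z∉)) (split′ x∈ x∈M z∈ z∉)))
      outM : ∀ {i j} → i ≢ j → proj₁ (w i) ∉ M → proj₁ (w j) ∉ M → ⊥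
      outM i≢j p q with QNode.split⇒apex βs good (∁ M)
        (λ u∈ v∈ u∈xs v∈xs y∈ y∉ → ≈-trans (split y∈ (Sub.x∉∁p⇒x∈p y∉) u∈xs (Sub.x∈∁p⇒x∉p u∈))
                                   (≈-sym (split y∈ (Sub.x∉∁p⇒x∈p y∉) v∈xs (Sub.x∈∁p⇒x∉p v∈))))
        i≢j (proj₂ (w _)) (Sub.x∉p⇒x∈∁p p) (proj₂ (w _)) (Sub.x∉p⇒x∈∁p q) x∈ (Sub.x∈p⇒x∉∁p x∈M)
      ... | i , δ′ , apex , _ , split′ = QNode.apex-far βs good apex
        (λ p q → ≤≈ (small p q) (≈-trans (≈-sym (d-sym (split x∈ x∈M z∈ z∉)))
                                         (split′ z∈ (Sub.x∉p⇒x∈∁p z∉) x∈ (Sub.x∈p⇒x∉∁p x∈M))))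
      pigeonhole : Dec (proj₁ (w zero) ∈ M) → Dec (proj₁ (w (suc zero)) ∈ M) → Dec (proj₁ (w (suc (suc zero))) ∈ M) → ⊥
      pigeonhole (yes p) (yes q) _       = inM {zero} {suc zero} (λ ()) p q
      pigeonhole (yes p) (no _)  (yes r) = inM {zero} {suc (suc zero)} (λ ()) p r
      pigeonhole (no _)  (yes q) (yes r) = inM {suc zero} {suc (suc zero)} (λ ()) q r
      pigeonhole (no p)  (no q)  _       = outM {zero} {suc zero} (λ ()) p q
      pigeonhole (no p)  (yes _) (no r)  = outM {zero} {suc (suc zero)} (λ ()) p r
      pigeonhole (yes _) (no q)  (no r)  = outM {suc zero} {suc (suc zero)} (λ ()) q r

  -- Serves the case where the apex child is kept whole: a set cutting it at distance `δ` would
  -- force `ρ` to be at least `δ`. The views `ρ-apex` and `ρ-none` are excluded by `Q-no-split`.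
  split⇒ρ : ∀ {T r} → RhoView T r → Good T → ∀ {δ} → (∀ {x y} → x ∈ᵀ T → y ∈ᵀ T → d x y ≤ᵛ δ) →
            (M : Subset n) → ∀ {x z} → x ∈ᵀ T → x ∈ M → z ∈ᵀ T → z ∉ M →
            (∀ {x y} → x ∈ᵀ T → x ∈ M → y ∈ᵀ T → y ∉ M → d x y ≈ δ) → ∃ λ δ′ → r ≡ just δ′ × δ ≤ᵛ δ′
  split⇒ρ ρ-leaf good small M (here refl) x∈M (here refl) z∉ split = contradiction x∈M z∉
  split⇒ρ (ρ-apex {βs = βs} _) good small M x∈ x∈M z∈ z∉ split = ⊥-elim (Q-no-split βs good small M x∈ x∈M z∈ z∉ split)
  split⇒ρ (ρ-none {βs = βs})   good small M x∈ x∈M z∈ z∉ split = ⊥-elim (Q-no-split βs good small M x∈ x∈M z∈ z∉ split)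
  split⇒ρ (ρ-hom {δ = δ′} {βs} h) good {δ} small M x∈ x∈M z∈ z∉ split = δ′ , refl , δ≤δ′
    where
    δ≤δ′ : δ ≤ᵛ δ′
    δ≤δ′ with leavesAll⁻ βs x∈ | leavesAll⁻ βs z∈
    ... | a , x∈a | b , z∈b with a Fin.≟ b
    ...   | no a≢b   = ≤ᵛ-reflexive (≈-trans (≈-sym (split x∈ x∈M z∈ z∉)) (h a≢b x∈a z∈b))
    -- Both points are in one child. A leaf `w` of another child is on one side of `M`, so its
    -- distance to the point on the other side is `δ`, and it is `δ′` by homogeneity.
    ...   | yes refl with otherIndex a
    ...     | m , m≢a with someLeaf∈ (lookup βs m)
    ...       | w , w∈ with w ∈? M
    ...         | yes w∈M = ≤ᵛ-reflexive (≈-trans (≈-sym (split (leavesAll⁺ βs m w∈) w∈M z∈ z∉)) (h m≢a w∈ z∈b))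
    ...         | no w∉   = ≤ᵛ-reflexive (≈-trans (≈-sym (split x∈ x∈M (leavesAll⁺ βs m w∈) w∉)) (h (m≢a ∘ sym) x∈a w∈))

  -- The diameter is at most `δ`, so at a homogeneous node the inequality `δ ≤ δ′` can only hold
  -- with equality; this is what makes the test of the procedure one for equality.
  ρ⇒Hom : ∀ {l k δ δ′} {βs : Vec (PQTree n) (2 + k)} → RhoView (node l βs) (just δ′) → Good (node l βs) →
          (∀ {x y} → x ∈ˡ leavesAll βs → y ∈ˡ leavesAll βs → d x y ≤ᵛ δ) → δ ≤ᵛ δ′ → Hom βs δ
  ρ⇒Hom {δ = δ} {βs = βs} (ρ-hom h) good small δ≤δ′ i≢j x∈ y∈ = antisym
    (small (leavesAll⁺ βs _ x∈) (leavesAll⁺ βs _ y∈)) (≤≈ δ≤δ′ (≈-sym (h i≢j x∈ y∈)))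
  ρ⇒Hom {δ = δ} {βs = βs} (ρ-apex a) good small δ≤δ′ =
    ⊥-elim (QNode.apex-far βs good a (λ p q → ≤ᵛ-trans (small p q) δ≤δ′))

  -- Modules below a homogeneous and below a conical node

  Module : List (Fin n) → Subset n → Set ℓ₁
  Module xs M = ∀ {x y z} → x ∈ M → y ∈ M → z ∈ˡ xs → z ∉ M → d z x ≈ d z y

  FullOrDisjoint : ∀ {L : Set} → Subset n → Tree L (Fin n) → Set
  FullOrDisjoint M T = (∀ {x} → x ∈ᵀ T → x ∈ M) ⊎ (∀ {x} → x ∈ᵀ T → x ∉ M)

  hom-fullOrDisjoint : ∀ {l k δ} {βs : Vec (PQTree n) (2 + k)} → Good (node l βs) → Hom βs δ → ∀ M j →
    (∀ {x y} → x ∈ᵀ lookup βs j → x ∈ M → y ∈ᵀ lookup βs j → y ∉ M → d x y ≈ δ) → FullOrDisjoint M (lookup βs j)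
  hom-fullOrDisjoint {βs = βs} good h M j split with covered? (lookup βs j) M
  ... | inj₁ full = inj₁ full
  ... | inj₂ (z , z∈ , z∉) = inj₂ λ x∈ x∈M → no-split βs good h M x∈ x∈M z∈ z∉ split

  -- If no child contains `M`, then for each child βⱼ there is a point `w` of `M` outside βⱼ. A
  -- point of βⱼ not in `M` is at distance `δ` from `w`, hence from all of `M`, and `no-split` keeps
  -- βⱼ whole.
  hom-classify : ∀ {l k δ} {βs : Vec (PQTree n) (2 + k)} → Good (node l βs) → Hom βs δ → ∀ M →
    (∀ {x} → x ∈ M → x ∈ˡ leavesAll βs) → Nonempty M → Module (leavesAll βs) M →
    (∃ λ i → ∀ {x} → x ∈ M → x ∈ᵀ lookup βs i) ⊎ (∀ i → FullOrDisjoint M (lookup βs i))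
  hom-classify {δ = δ} {βs} good h M M⊆ (m , m∈) mod with leavesAll⁻ βs (M⊆ m∈)
  ... | a , m∈a with within? (lookup βs a) M
  ...   | inj₁ M⊆a = inj₁ (a , M⊆a)
  ...   | inj₂ (m′ , m′∈ , m′∉a) = inj₂ λ j → hom-fullOrDisjoint good h M j (split j)
    where
    b = proj₁ (leavesAll⁻ βs (M⊆ m′∈))
    m′∈b = proj₂ (leavesAll⁻ βs (M⊆ m′∈))
    outside-j : ∀ j → ∃ λ w → w ∈ M × ∃ λ i → i ≢ j × w ∈ᵀ lookup βs i
    outside-j j with a Fin.≟ j
    ... | no a≢j   = m , m∈ , a , a≢j , m∈a
    ... | yes refl = m′ , m′∈ , b , (λ e → m′∉a (subst (λ i → m′ ∈ᵀ lookup βs i) e m′∈b)) , m′∈b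
    split : ∀ j {x y} → x ∈ᵀ lookup βs j → x ∈ M → y ∈ᵀ lookup βs j → y ∉ M → d x y ≈ δ
    split j x∈ x∈M y∈ y∉ = let w , w∈M , i , i≢j , w∈ = outside-j j in
      d-sym (≈-trans (mod x∈M w∈M (leavesAll⁺ βs j y∈) y∉) (h (i≢j ∘ sym) y∈ w∈))

  -- If `M` meets two children, `split⇒apex` provides some apex and `apex-unique` identifies it with
  -- the given one. How `M` cuts the apex child is left open, as this depends on the inner structure
  -- of that child.
  conical-classify : ∀ {k i δ} {βs : Vec (PQTree n) (3 + k)} → Good (node Q βs) → Apex βs i δ → ∀ M →
    (∀ {x} → x ∈ M → x ∈ˡ leavesAll βs) → Nonempty M → (∃ λ z → z ∈ˡ leavesAll βs × z ∉ M) → Module (leavesAll βs) M →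
    (∃ λ a → ∀ {x} → x ∈ M → x ∈ᵀ lookup βs a) ⊎
    ((∀ {z} → z ∈ˡ leavesAll βs → z ∉ M → z ∈ᵀ lookup βs i) ×
     (∀ {m z} → m ∈ˡ leavesAll βs → m ∈ M → z ∈ˡ leavesAll βs → z ∉ M → d m z ≈ δ))
  conical-classify {i = i} {δ} {βs} good apex M M⊆ (m , m∈) (z₀ , z₀∈ , z₀∉) mod with leavesAll⁻ βs (M⊆ m∈)
  ... | a , m∈a with within? (lookup βs a) M
  ...   | inj₁ M⊆a = inj₁ (a , M⊆a)
  ...   | inj₂ (m′ , m′∈ , m′∉a) with leavesAll⁻ βs (M⊆ m′∈)
  ...     | b , m′∈b with QNode.split⇒apex βs good M (λ x∈ y∈ _ _ z∈ → mod x∈ y∈ z∈)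
                            {a} {b} (λ { refl → m′∉a m′∈b }) m∈a m∈ m′∈b m′∈ z₀∈ z₀∉
  ...       | i′ , δ′ , apex′ , rest , split with QNode.apex-unique βs good apex apex′
  ...         | refl = inj₂ (rest , λ x∈ x∈M z∈ z∉ → ≈-trans (split x∈ x∈M z∈ z∉) δ′≈δ)
    where
    δ′≈δ : δ′ ≈ δ
    δ′≈δ with otherIndex i
    ... | j , j≢i with someLeaf∈ (lookup βs i) | someLeaf∈ (lookup βs j)
    ...   | u , u∈ | v , v∈ = ≈-trans (≈-sym (apex′ j≢i u∈ v∈)) (apex j≢i u∈ v∈)

  -- The tree built at each kind of node

  leavesAll-↭ : ∀ {L L′ : Set} {k} (αs : Vec (Tree L (Fin n)) k) (βs : Vec (Tree L′ (Fin n)) k) →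
                (∀ i → leaves (lookup αs i) ↭ leaves (lookup βs i)) → leavesAll αs ↭ leavesAll βs
  leavesAll-↭ []       []       f = ↭-refl
  leavesAll-↭ (α ∷ αs) (β ∷ βs) f = Perm↭.++⁺ (f zero) (leavesAll-↭ αs βs (f ∘ suc))

  lookup-removeAt : ∀ {A : Set} {k} (xs : Vec A (suc k)) i j → lookup (removeAt xs i) j ≡ lookup xs (punchIn i j)
  lookup-removeAt (x ∷ xs)     zero    j       = refl
  lookup-removeAt (x ∷ y ∷ xs) (suc i) zero    = refl
  lookup-removeAt (x ∷ y ∷ xs) (suc i) (suc j) = lookup-removeAt (y ∷ xs) i j

  leavesAll-removeAt : ∀ {L : Set} {k} (αs : Vec (Tree L (Fin n)) (suc k)) i →
                       leavesAll (removeAt αs i) ++ leaves (lookup αs i) ↭ leavesAll αs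
  leavesAll-removeAt (α ∷ αs)     zero    = Perm↭.++-comm (leavesAll αs) (leaves α)
  leavesAll-removeAt (α ∷ β ∷ αs) (suc i) =
    ↭-trans (↭-reflexive (List.++-assoc (leaves α) (leavesAll (removeAt (β ∷ αs) i)) _))
            (Perm↭.++⁺ˡ (leaves α) (leavesAll-removeAt (β ∷ αs) i))

  leaves-withoutApex : ∀ {k} (Us : Vec (MTree n) (2 + k)) → leaves (withoutApex V d Us) ≡ leavesAll Us
  leaves-withoutApex {zero}  Us = refl
  leaves-withoutApex {suc k} Us = refl

  record Children {k} (βs : Vec (PQTree n) k) (Us : Vec (MTree n) k) : Set ℓ₁ where
    field
      leaves↭ : ∀ i → leaves (lookup Us i) ↭ leaves (lookup βs i)
      trees   : ∀ i → MmoduleTree (lookup Us i)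
    to : ∀ {i x} → x ∈ᵀ lookup Us i → x ∈ᵀ lookup βs i
    to {i} = ∈-resp-↭ (leaves↭ i)
    from : ∀ {i x} → x ∈ᵀ lookup βs i → x ∈ᵀ lookup Us i
    from {i} = ∈-resp-↭ (↭-sym (leaves↭ i))
    all↭ : leavesAll Us ↭ leavesAll βs
    all↭ = leavesAll-↭ Us βs leaves↭
    toAll : ∀ {x} → x ∈ˡ leavesAll Us → x ∈ˡ leavesAll βs
    toAll = ∈-resp-↭ all↭
    fromAll : ∀ {x} → x ∈ˡ leavesAll βs → x ∈ˡ leavesAll Us
    fromAll = ∈-resp-↭ (↭-sym all↭)

  hom-tree : ∀ {l k δ} {βs : Vec (PQTree n) (2 + k)} {Us} → Good (node l βs) → Hom βs δ → Children βs Us →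
             MmoduleTree (node ∩ₙ Us)
  hom-tree {Us = Us} good h ch = MmoduleTree-∩ Us trees (λ i≢j x∈ y∈ → h i≢j (to x∈) (to y∈))
    λ M M⊆ ne _ mod → Sum.map
      (λ (i , M⊆i) → i , λ x∈ → from (M⊆i x∈))
      (λ union i → Sum.map (λ f x∈ → f (to x∈)) (λ f x∈ → f (to x∈)) (union i))
      (hom-classify good h M (λ x∈ → toAll (M⊆ x∈)) ne (λ x∈ y∈ z∈ → mod x∈ y∈ (fromAll z∈)))
    where open Children ch

  -- A proper module meeting two children would produce an apex through `split⇒apex`.
  nonconical-tree : ∀ {k} {βs : Vec (PQTree n) (3 + k)} {Us} → Good (node Q βs) → (∀ {i δ} → ¬ Apex βs i δ) →
                    Children βs Us → MmoduleTree (node ∪ₙ Us)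
  nonconical-tree {βs = βs} {Us} good ¬apex ch = MmoduleTree-∪ Us (s≤s (s≤s (s≤s z≤n))) trees
    (λ j≢i x∈ y∈ z∈ → Node.const₂ βs good j≢i (to z∈) (to z∈) (to x∈) (to y∈))
    classify
    where
    open Children ch
    classify : ∀ M → (∀ {x} → x ∈ M → x ∈ˡ leavesAll Us) → Nonempty M → (∃ λ z → z ∈ˡ leavesAll Us × z ∉ M) →
               ModuleIn (node ∪ₙ Us) M → ∃ λ i → ∀ {x} → x ∈ M → x ∈ᵀ lookup Us i
    classify M M⊆ (m , m∈) (z , z∈ , z∉) mod with leavesAll⁻ βs (toAll (M⊆ m∈))
    ... | a , m∈a with within? (lookup βs a) M
    ...   | inj₁ M⊆a = a , λ x∈ → from (M⊆a x∈)
    ...   | inj₂ (m′ , m′∈ , m′∉a) with leavesAll⁻ βs (toAll (M⊆ m′∈))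
    ...     | b , m′∈b with QNode.split⇒apex βs good M (λ x∈ y∈ _ _ z∈ → mod x∈ y∈ (fromAll z∈))
                              {a} {b} (λ { refl → m′∉a m′∈b }) m∈a m∈ m′∈b m′∈ (toAll z∈) z∉
    ...       | _ , _ , apex , _ = ⊥-elim (¬apex apex)

  -- The tree built at a conical node

  module Conical {k i δ} {βs : Vec (PQTree n) (3 + k)} {Us : Vec (MTree n) (3 + k)}
                 (good : Good (node Q βs)) (apex : Apex βs i δ) (ch : Children βs Us) where

    open Children ch

    Ws : Vec (MTree n) (2 + k)
    Ws = removeAt Us i

    T₀ : MTree n
    T₀ = withoutApex V d Ws

    Ws⁻ : ∀ {j x} → x ∈ᵀ lookup Ws j → x ∈ᵀ lookup βs (punchIn i j)
    Ws⁻ {j} p = to (subst (_ ∈ᵀ_) (lookup-removeAt Us i j) p)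

    Ws⁺ : ∀ {j x} (j≢i : j ≢ i) → x ∈ᵀ lookup βs j → x ∈ᵀ lookup Ws (punchOut (j≢i ∘ sym))
    Ws⁺ j≢i p = subst (_ ∈ᵀ_) (sym (Vec.removeAt-punchOut Us (j≢i ∘ sym))) (from p)

    allWs⁻ : ∀ {x} → x ∈ˡ leavesAll Ws → ∃ λ j → j ≢ i × x ∈ᵀ lookup βs j
    allWs⁻ p = let j , q = leavesAll⁻ Ws p in punchIn i j , Fin.punchInᵢ≢i i j , Ws⁻ q

    allWs⁺ : ∀ {j x} → j ≢ i → x ∈ᵀ lookup βs j → x ∈ˡ leavesAll Ws
    allWs⁺ j≢i p = leavesAll⁺ Ws _ (Ws⁺ j≢i p)

    T₀⁻ : ∀ {x} → x ∈ᵀ T₀ → ∃ λ j → j ≢ i × x ∈ᵀ lookup βs j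
    T₀⁻ p = allWs⁻ (subst (_ ∈ˡ_) (leaves-withoutApex Ws) p)

    T₀⁺ : ∀ {j x} → j ≢ i → x ∈ᵀ lookup βs j → x ∈ᵀ T₀
    T₀⁺ j≢i p = subst (_ ∈ˡ_) (sym (leaves-withoutApex Ws)) (allWs⁺ j≢i p)

    Ws-trees : ∀ j → MmoduleTree (lookup Ws j)
    Ws-trees j = subst MmoduleTree (sym (lookup-removeAt Us i j)) (trees (punchIn i j))

    Ws-const : ∀ {a b x y z} → b ≢ a → x ∈ᵀ lookup Ws a → y ∈ᵀ lookup Ws a → z ∈ᵀ lookup Ws b → d z x ≈ d z y
    Ws-const b≢a x∈ y∈ z∈ =
      Node.const₂ βs good (b≢a ∘ Fin.punchIn-injective i _ _) (Ws⁻ z∈) (Ws⁻ z∈) (Ws⁻ x∈) (Ws⁻ y∈)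

    -- A point of the apex child is at distance `δ` from every sibling, so it distinguishes no two
    -- points of `M`.
    Ws-module : ∀ {M} → (∀ {x} → x ∈ M → x ∈ˡ leavesAll Ws) → Module (leavesAll Ws) M → Module (leavesAll βs) M
    Ws-module M⊆ mod x∈ y∈ z∈ z∉ with leavesAll⁻ βs z∈
    ... | j , z∈j with j Fin.≟ i
    ...   | no j≢i   = mod x∈ y∈ (allWs⁺ j≢i z∈j) z∉
    ...   | yes refl = let a , a≢i , x∈a = allWs⁻ (M⊆ x∈) ; b , b≢i , y∈b = allWs⁻ (M⊆ y∈) in
      ≈-trans (apex a≢i z∈j x∈a) (≈-sym (apex b≢i z∈j y∈b))

    -- In the whole node, a module meeting two children omits points of the apex child only; here
    -- the omitted point `z` lies in a sibling, so `M` is inside one child.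
    Ws-classify : ∀ M → (∀ {x} → x ∈ M → x ∈ˡ leavesAll Ws) → Nonempty M → (∃ λ z → z ∈ˡ leavesAll Ws × z ∉ M) →
                  Module (leavesAll Ws) M → ∃ λ j → ∀ {x} → x ∈ M → x ∈ᵀ lookup Ws j
    Ws-classify M M⊆ (m , m∈) (z , z∈ , z∉) mod
      with conical-classify good apex M
             (λ p → let j , _ , q = allWs⁻ (M⊆ p) in leavesAll⁺ βs j q) (m , m∈)
             (z , (let j , _ , q = allWs⁻ z∈ in leavesAll⁺ βs j q) , z∉) (Ws-module M⊆ mod)
    ... | inj₁ (a , M⊆a) = punchOut (a≢i ∘ sym) , λ x∈ → Ws⁺ a≢i (M⊆a x∈)
      where
      a≢i : a ≢ i
      a≢i = let j , j≢i , m∈j = allWs⁻ (M⊆ m∈) in subst (_≢ i) (sameChild βs (Good.unique good) m∈j (M⊆a m∈)) j≢i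
    ... | inj₂ (rest , _) = let j , j≢i , z∈j = allWs⁻ z∈ in
      contradiction (sameChild βs (Good.unique good) z∈j (rest (leavesAll⁺ βs j z∈j) z∉)) j≢i

    private
      -- Stated for an arbitrary vector because the label given by `withoutApex` depends on its
      -- length. With two entries the node is a ∩-node, whose proper sets of children are again
      -- single children.
      withoutApex-tree : ∀ {k} (Ws : Vec (MTree n) (2 + k)) → (∀ j → MmoduleTree (lookup Ws j)) →
        (∀ {a b x y z} → b ≢ a → x ∈ᵀ lookup Ws a → y ∈ᵀ lookup Ws a → z ∈ᵀ lookup Ws b → d z x ≈ d z y) →
        (∀ M → (∀ {x} → x ∈ M → x ∈ˡ leavesAll Ws) → Nonempty M → (∃ λ z → z ∈ˡ leavesAll Ws × z ∉ M) →
           Module (leavesAll Ws) M → ∃ λ j → ∀ {x} → x ∈ M → x ∈ᵀ lookup Ws j) →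
        MmoduleTree (withoutApex V d Ws)
      withoutApex-tree {suc k} Ws sub con cls = MmoduleTree-∪ Ws (s≤s (s≤s (s≤s z≤n))) sub con
        λ M M⊆ ne out mod → cls M M⊆ ne out λ x∈ → mod x∈
      withoutApex-tree {zero} Ws sub con cls = MmoduleTree-∩ Ws sub
        (Hom-2 Ws (λ x∈ x′∈ y∈ y′∈ → ≈-trans (con (λ ()) y∈ y′∈ x∈) (d-sym (≈-trans (con (λ ()) x∈ x′∈ y′∈) (symmetric _ _))))
          (proj₂ (someLeaf∈ (lookup Ws zero))) (proj₂ (someLeaf∈ (lookup Ws (suc zero)))))
        λ M M⊆ ne out mod → inj₁ (cls M M⊆ ne out λ x∈ → mod x∈)

    T₀-tree : MmoduleTree T₀
    T₀-tree = withoutApex-tree Ws Ws-trees Ws-const Ws-classify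

    apex-small : ∀ {x y} → x ∈ᵀ lookup βs i → y ∈ᵀ lookup βs i → d x y ≤ᵛ δ
    apex-small x∈ y∈ = let j , j≢i = otherIndex i ; w , w∈ = someLeaf∈ (lookup βs j) in
      ≤≈ (Node.diam βs good (j≢i ∘ sym) x∈ y∈ w∈) (apex j≢i x∈ w∈)

    -- Vs consists either of the tree of the apex child or of the trees of its
    -- children.
    apex-tree : ∀ {m} (Vs : Vec (MTree n) (suc m)) → (∀ j → MmoduleTree (lookup Vs j)) →
                leavesAll Vs ↭ leaves (lookup βs i) → Hom Vs δ →
                (∀ M → (∀ {x} → x ∈ M → x ∈ᵀ lookup βs i) → Nonempty M → Module (leaves (lookup βs i)) M →
                   (∃ λ j → ∀ {x} → x ∈ M → x ∈ᵀ lookup Vs j) ⊎ (∀ j → FullOrDisjoint M (lookup Vs j))) →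
                (∀ M → (∀ {x y} → x ∈ᵀ lookup βs i → x ∈ M → y ∈ᵀ lookup βs i → y ∉ M → d x y ≈ δ) →
                   ∀ j → FullOrDisjoint M (lookup Vs j)) →
                (leaves (node ∩ₙ (T₀ ∷ Vs)) ↭ leavesAll βs) × MmoduleTree (node ∩ₙ (T₀ ∷ Vs))
    apex-tree Vs sub perm h classifyᵢ fullOrDisjoint = perm-all , MmoduleTree-∩ (T₀ ∷ Vs) sub-all h-all classify
      where
      perm-all : leaves T₀ ++ leavesAll Vs ↭ leavesAll βs
      perm-all = ↭-trans (Perm↭.++⁺ (↭-reflexive (leaves-withoutApex Ws)) (↭-trans perm (↭-sym (leaves↭ i))))
                         (↭-trans (leavesAll-removeAt Us i) all↭)
      toᵢ : ∀ {x} → x ∈ˡ leavesAll Vs → x ∈ᵀ lookup βs i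
      toᵢ = ∈-resp-↭ perm
      sub-all : ∀ j → MmoduleTree (lookup (T₀ ∷ Vs) j)
      sub-all zero    = T₀-tree
      sub-all (suc j) = sub j
      h-all : Hom (T₀ ∷ Vs) δ
      h-all {zero}  {zero}  i≢j x∈ y∈ = contradiction refl i≢j
      h-all {zero}  {suc j} i≢j x∈ y∈ = let a , a≢i , x∈a = T₀⁻ x∈ in d-sym (apex a≢i (toᵢ (leavesAll⁺ Vs j y∈)) x∈a)
      h-all {suc j} {zero}  i≢j x∈ y∈ = let a , a≢i , y∈a = T₀⁻ y∈ in apex a≢i (toᵢ (leavesAll⁺ Vs j x∈)) y∈a
      h-all {suc _} {suc _} i≢j x∈ y∈ = h (i≢j ∘ cong suc) x∈ y∈
      classify : ∀ M → (∀ {x} → x ∈ M → x ∈ˡ leavesAll (T₀ ∷ Vs)) → Nonempty M →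
        (∃ λ z → z ∈ˡ leavesAll (T₀ ∷ Vs) × z ∉ M) → ModuleIn (node ∩ₙ (T₀ ∷ Vs)) M →
        (∃ λ j → ∀ {x} → x ∈ M → x ∈ᵀ lookup (T₀ ∷ Vs) j) ⊎ (∀ j → FullOrDisjoint M (lookup (T₀ ∷ Vs) j))
      classify M M⊆ ne (z , z∈ , z∉) mod
        with conical-classify good apex M (λ x∈ → ∈-resp-↭ perm-all (M⊆ x∈)) ne (z , ∈-resp-↭ perm-all z∈ , z∉)
               (λ x∈ y∈ w∈ → mod x∈ y∈ (∈-resp-↭ (↭-sym perm-all) w∈))
      -- Here `M` omits points of the apex child only, so it contains all of `T₀` and can cut the
      -- apex child only at distance `δ`.
      ... | inj₂ (rest , split) = inj₂ λ where
              zero    → inj₁ λ x∈ → let a , a≢i , x∈a = T₀⁻ x∈ in decidable-stable (_ ∈? M) λ x∉ →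
                          a≢i (sameChild βs (Good.unique good) x∈a (rest (leavesAll⁺ βs a x∈a) x∉))
              (suc j) → fullOrDisjoint M (λ x∈ x∈M y∈ y∉ → split (leavesAll⁺ βs i x∈) x∈M (leavesAll⁺ βs i y∈) y∉) j
      ... | inj₁ (a , M⊆a) with a Fin.≟ i
      ...   | no a≢i   = inj₁ (zero , λ x∈ → T₀⁺ a≢i (M⊆a x∈))
      -- Inside the apex child, `M` misses `T₀`, and what remains is a statement on that child
      -- alone.
      ...   | yes refl = Sum.map (λ (j , M⊆j) → suc j , M⊆j) (λ union → λ where
                zero    → inj₂ λ x∈ x∈M → let b , b≢i , x∈b = T₀⁻ x∈ in
                            b≢i (sameChild βs (Good.unique good) x∈b (M⊆a x∈M))
                (suc j) → union j)
              (classifyᵢ M M⊆a ne (λ x∈ y∈ w∈ → mod x∈ y∈ (∈-resp-↭ (↭-sym perm-all) (leavesAll⁺ βs i w∈))))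

  -- Correctness of the procedure

  mmodAll-lookup : ∀ {k} (As : Vec (ATree n) k) i → lookup (value (mmodAll V d As)) i ≡ value (mmod V d (lookup As i))
  mmodAll-lookup (A ∷ As) zero    = refl
  mmodAll-lookup (A ∷ As) (suc i) = mmodAll-lookup As i

  -- The proof forms the results of all children and then removes the entry of the apex, so that one
  -- `Children` covers the siblings and the apex child alike.
  mmodAllBut-value : ∀ {k} i (As : Vec (ATree n) (suc k)) →
                     value (mmodAllBut V d i As) ≡ removeAt (value (mmodAll V d As)) i
  mmodAllBut-value         zero    (A ∷ As)     = refl
  mmodAllBut-value {suc _} (suc i) (A ∷ B ∷ As) = cong (value (mmod V d A) ∷_) (mmodAllBut-value i (B ∷ As))

  reachesρ : Carrier → ATree n → Bool
  reachesρ δ A = value (reaches? V d δ (value (ρ V d A)))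

  mmodApex-value : ∀ {k} δ T₀ i (As : Vec (ATree n) k) →
                   value (mmodApex V d δ T₀ i As) ≡ value (attach V d (reachesρ δ (lookup As i)) T₀ (lookup As i))
  mmodApex-value δ T₀ zero    (A ∷ As) = refl
  mmodApex-value δ T₀ (suc i) (A ∷ As) = mmodApex-value δ T₀ i As

  reaches?-true : ∀ {δ} r → value (reaches? V d δ r) ≡ true → ∃ λ δ′ → r ≡ just δ′ × δ ≤ᵛ δ′
  reaches?-true {δ} (just δ′) eq with δ ≤? δ′
  ... | yes p = δ′ , refl , p

  reaches?-false : ∀ {δ δ′} r → value (reaches? V d δ r) ≡ false → r ≡ just δ′ → ¬ δ ≤ᵛ δ′
  reaches?-false {δ} {δ′} .(just δ′) eq refl p with δ ≤? δ′
  reaches?-false {δ} {δ′} .(just δ′) () refl p | yes _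
  ... | no ¬p = ¬p p

  Correct : PQTree n → Set (ℓ₁ ⊔ ℓ₂)
  Correct T = ∀ {A} → Annotated T A → Good T →
              (leaves (value (mmod V d A)) ↭ leaves T) × MmoduleTree (value (mmod V d A))

  children : ∀ {l k} {βs : Vec (PQTree n) (2 + k)} {As} → (∀ i → Annotated (lookup βs i) (lookup As i)) →
             Good (node l βs) → (∀ i → Correct (lookup βs i)) → Children βs (value (mmodAll V d As))
  children {βs = βs} {As} ann good ih = record
    { leaves↭ = λ i → subst (λ U → leaves U ↭ _) (sym (mmodAll-lookup As i)) (proj₁ (correct i))
    ; trees   = λ i → subst MmoduleTree (sym (mmodAll-lookup As i)) (proj₂ (correct i))
    }
    where
    correct : ∀ i → (leaves (value (mmod V d (lookup As i))) ↭ leaves (lookup βs i)) × MmoduleTree (value (mmod V d (lookup As i)))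
    correct i = ih i (ann i) (Node.good-child βs good i)

  -- `T` is a variable tied to `lookup βs i` by an equation so that `Annotated T A` can be matched
  -- on. When merging, `mmod` runs on the children of `T`, whose correctness is therefore a separate
  -- hypothesis.
  attach-correct : ∀ {k i δ} {βs : Vec (PQTree n) (3 + k)} {Us}
    (good : Good (node Q βs)) (ap : Apex βs i δ) (ch : Children βs Us) →
    ∀ {T A} → Annotated T A → T ≡ lookup βs i → Correct T → (∀ {l m} {γs : Vec (PQTree n) (2 + m)} → T ≡ node l γs → ∀ j → Correct (lookup γs j)) →
    ∀ b → reachesρ δ A ≡ b →
    (leaves (value (attach V d b (Conical.T₀ good ap ch) A)) ↭ leavesAll βs) ×
    MmoduleTree (value (attach V d b (Conical.T₀ good ap ch) A))
  attach-correct {i = i} {δ} {βs} good ap ch {T} {A} ann eq correct _ false ¬reaches =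
    Conical.apex-tree good ap ch (value (mmod V d A) ∷ [])
      (λ { zero → proj₂ whole })
      (↭-trans (↭-reflexive (List.++-identityʳ _)) perm)
      (λ { {zero} {zero} i≢j _ _ → contradiction refl i≢j })
      (λ M M⊆ _ _ → inj₁ (zero , λ x∈ → ∈-resp-↭ (↭-sym perm) (M⊆ x∈)))
      (λ { M split zero → disjoint M split })
    where
    goodT : Good T
    goodT = subst Good (sym eq) (Node.good-child βs good i)
    whole = correct ann goodT
    perm : leaves (value (mmod V d A)) ↭ leaves (lookup βs i)
    perm = subst (λ T → leaves (value (mmod V d A)) ↭ leaves T) eq (proj₁ whole)
    toᵢ : ∀ {x} → x ∈ᵀ T → x ∈ᵀ lookup βs i
    toᵢ = subst (_ ∈ᵀ_) eq
    toT : ∀ {x} → x ∈ᵀ value (mmod V d A) → x ∈ᵀ T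
    toT = ∈-resp-↭ (proj₁ whole)
    -- A cut of the apex child at distance `δ` would make `ρ` at least `δ`, against the negative
    -- outcome of the test.
    disjoint : ∀ M → (∀ {x y} → x ∈ᵀ lookup βs i → x ∈ M → y ∈ᵀ lookup βs i → y ∉ M → d x y ≈ δ) →
               FullOrDisjoint M (value (mmod V d A))
    disjoint M split with covered? (value (mmod V d A)) M
    ... | inj₁ full = inj₁ full
    ... | inj₂ (z , z∈ , z∉) = inj₂ λ x∈ x∈M →
      let δ′ , r , δ≤δ′ = split⇒ρ (ρ-view ann goodT) goodT
            (λ p q → Conical.apex-small good ap ch (toᵢ p) (toᵢ q)) M (toT x∈) x∈M (toT z∈) z∉
            (λ p p∈ q q∉ → split (toᵢ p) p∈ (toᵢ q) q∉)
      in reaches?-false _ ¬reaches r δ≤δ′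
  attach-correct good ap ch leaf eq _ _ true ()
  attach-correct {i = i} {δ} {βs} good ap ch {T} {A@(node _ Cs)} ann@(node {l} {βs = γs} _ ann′) eq _ kids true reaches =
    Conical.apex-tree good ap ch (value (mmodAll V d Cs)) trees
      (subst (λ T → leavesAll (value (mmodAll V d Cs)) ↭ leaves T) eq all↭)
      (λ i≢j x∈ y∈ → h i≢j (to x∈) (to y∈))
      (λ M M⊆ ne mod → Sum.map
        (λ (j , M⊆j) → j , λ x∈ → from (M⊆j x∈))
        (λ union j → transfer (union j))
        (hom-classify goodT h M (λ x∈ → toT (M⊆ x∈)) ne (λ x∈ y∈ z∈ → mod x∈ y∈ (toᵢ z∈))))
      (λ M split j → transfer (hom-fullOrDisjoint goodT h M j
        (λ p p∈ q q∉ → split (toᵢ (leavesAll⁺ γs j p)) p∈ (toᵢ (leavesAll⁺ γs j q)) q∉)))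
    where
    goodT : Good (node l γs)
    goodT = subst Good (sym eq) (Node.good-child βs good i)
    open Children (children {As = Cs} ann′ goodT (kids refl))
    toᵢ : ∀ {x} → x ∈ˡ leavesAll γs → x ∈ᵀ lookup βs i
    toᵢ = subst (_ ∈ᵀ_) eq
    toT : ∀ {x} → x ∈ᵀ lookup βs i → x ∈ˡ leavesAll γs
    toT = subst (_ ∈ᵀ_) (sym eq)
    transfer : ∀ {M j} → FullOrDisjoint M (lookup γs j) → FullOrDisjoint M (lookup (value (mmodAll V d Cs)) j)
    transfer = Sum.map (λ f x∈ → f (to x∈)) (λ f x∈ → f (to x∈))
    h : Hom γs δ
    h = let δ′ , r , δ≤δ′ = reaches?-true (value (ρ V d A)) reaches in
      ρ⇒Hom (subst (RhoView (node l γs)) r (ρ-view ann goodT)) goodT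
        (λ p q → Conical.apex-small good ap ch (toᵢ p) (toᵢ q)) δ≤δ′

  mmod-correct : ∀ T → Correct T
  mmod-correct T = proj₁ (strong T)
    where
    Strong : PQTree n → Set (ℓ₁ ⊔ ℓ₂)
    Strong T = Correct T × (∀ {l k} {γs : Vec (PQTree n) (2 + k)} → T ≡ node l γs → ∀ j → Correct (lookup γs j))
    at-node : ∀ l {k} (βs : Vec (PQTree n) (2 + k)) → (∀ i → Strong (lookup βs i)) → Correct (node l βs)
    at-node P βs ih (node {As = As} _ ann) good = Children.all↭ ch ,
      hom-tree good (Hom-P good (someLeaf-∈ (ann zero)) (someLeaf-∈ (ann (suc zero)))) ch
      where ch = children {As = As} ann good (proj₁ ∘ ih)
    at-node Q {zero} βs ih (node {As = As} _ ann) good = Children.all↭ ch ,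
      hom-tree good (Hom-2 βs (Node.const₂ βs good (λ ())) (someLeaf-∈ (ann zero)) (someLeaf-∈ (ann (suc zero)))) ch
      where ch = children {As = As} ann good (proj₁ ∘ ih)
    at-node Q {suc k} βs ih (node {As = As} _ ann) good = go (value (findApex V d As)) refl
      where
      ch = children {As = As} ann good (proj₁ ∘ ih)
      go : ∀ r → value (findApex V d As) ≡ r →
           (leaves (value (mmodQ V d r As)) ↭ leavesAll βs) × MmoduleTree (value (mmodQ V d r As))
      go nothing        eq = Children.all↭ ch , nonconical-tree good (findApex-¬Apex {As = As} good ann eq) ch
      go (just (δ , i)) eq = subst (λ U → (leaves U ↭ leavesAll βs) × MmoduleTree U) (sym value≡)
        (attach-correct good ap ch (ann i) refl (proj₁ (ih i)) (proj₂ (ih i)) (reachesρ δ (lookup As i)) refl)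
        where
        ap : Apex βs i δ
        ap = findApex-Apex {As = As} good ann eq
        T₀ = Conical.T₀ good ap ch
        value≡ : value (mmodQ V d (just (δ , i)) As) ≡ value (attach V d (reachesρ δ (lookup As i)) T₀ (lookup As i))
        value≡ = trans (cong (λ Ws → value (mmodApex V d δ (withoutApex V d Ws) i As)) (mmodAllBut-value i As))
                       (mmodApex-value δ T₀ i As)
    strong : ∀ T → Strong T
    strong = Tree-ind (λ x → (λ { leaf _ → ↭-refl , MmoduleTree-leaf x }) , λ ())
      λ l βs ih → at-node l βs ih , λ { refl j → proj₁ (ih j) }

  mmodTree-correct : ∀ {T} → IsPQTreeOf V d T → IsMmoduleTree V d (value (mmodTree V d T))
  mmodTree-correct {T} isPQ = record
    { isXTree  = ↭U
    ; ∪-nodes  = λ q → arity q , λ j → mmodule (child∪ q j) tt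
    ; ∩-nodes  = λ q S a → mmodule (children∩ q S) a
    ; complete = λ M mod (ne , M≢) →
        let z , z∉ = ≢full⇒∉ M≢
            p , a , eq = complete M (λ {x} _ → all x) ne (z , all z , z∉) (λ x∈ y∈ _ z∉ → mod x∈ y∈ z∉)
        in p , (a , eq) , λ (b , eq′) → setAt-injective U uniqueU p _ a b (trans eq (sym eq′))
    }
    where
    U = value (mmodTree V d T)
    correct = mmod-correct T (annotate-Annotated T) (PQTree⇒Good isPQ)
    open MmoduleTree (proj₂ correct)
    ↭U : leaves U ↭ List.allFin n
    ↭U = ↭-trans (proj₁ correct) (IsPQTreeOf.isXTree isPQ)
    all : ∀ x → x ∈ᵀ U
    all x = ∈-resp-↭ (↭-sym ↭U) (∈-allFin x)
    uniqueU : Unique (leaves U)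
    uniqueU = Unique-resp-↭ (↭-sym ↭U) (Unique.allFin⁺ n)
    mmodule : ∀ (p : Place U) → Admissible p → Mmodule V d (setAt p)
    mmodule p a {z = z} x∈ y∈ z∉ = sound p a x∈ y∈ (all z) z∉

-- Running time

module _ {L A : Set} where

  size    : Tree L A → ℕ
  sizeAll : ∀ {k} → Vec (Tree L A) k → ℕ
  size (leaf _)    = 1
  size (node _ βs) = sizeAll βs
  sizeAll []       = 0
  sizeAll (β ∷ βs) = size β + sizeAll βs

  length-leaves    : ∀ (T : Tree L A) → length (leaves T) ≡ size T
  length-leavesAll : ∀ {k} (βs : Vec (Tree L A) k) → length (leavesAll βs) ≡ sizeAll βs
  length-leaves (leaf _)    = refl
  length-leaves (node _ βs) = length-leavesAll βs
  length-leavesAll []       = refl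
  length-leavesAll (β ∷ βs) =
    trans (List.length-++ (leaves β)) (cong₂ _+_ (length-leaves β) (length-leavesAll βs))

-- To derive x ≤ y from a ≤ b: y − x equals b − a plus a slack s.
linear : ∀ {a b x y} s → a ≤ b → x + b + s ≡ a + y → x ≤ y
linear {a} {b} {x} {y} s a≤b eq = ℕ.+-cancelʳ-≤ b x y (begin
  x + b     ≤⟨ ℕ.m≤m+n (x + b) s ⟩
  x + b + s ≡⟨ eq ⟩
  a + y     ≤⟨ ℕ.+-monoˡ-≤ y a≤b ⟩
  b + y     ≡⟨ ℕ.+-comm b y ⟩
  y + b     ∎)
  where open ℕ.≤-Reasoning

module _ {n : ℕ} where

  annotate-size    : ∀ (T : PQTree n) → size (value (annotate T)) ≡ size T
  annotateAll-size : ∀ {k} (βs : Vec (PQTree n) k) → sizeAll (value (annotateAll βs)) ≡ sizeAll βs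
  annotate-size (leaf _)    = refl
  annotate-size (node _ βs) = annotateAll-size βs
  annotateAll-size []       = refl
  annotateAll-size (β ∷ βs) = cong₂ _+_ (annotate-size β) (annotateAll-size βs)

  -- Each subtree leaves a reserve of 4, of which its list cell takes one. Two children thus leave
  -- 6, which pays for the empty list, the node itself and a new reserve of 4.
  annotate-cost    : ∀ (T : PQTree n) → cost (annotate T) + 4 ≤ 5 * size T
  annotateAll-cost : ∀ {k} (βs : Vec (PQTree n) k) → cost (annotateAll βs) + k * 3 ≤ 1 + 5 * sizeAll βs
  annotate-cost (leaf _) = ℕ.≤-refl
  annotate-cost (node _ {k} βs) = linear (k * 3) (annotateAll-cost βs) (arith (cost (annotateAll βs)) k (sizeAll βs))
    where
    arith : ∀ c k s → suc (c + 0) + 4 + (1 + 5 * s) + k * 3 ≡ c + (2 + k) * 3 + 5 * s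
    arith = solve-∀
  annotateAll-cost [] = ℕ.≤-refl
  annotateAll-cost (_∷_ {k} β βs) = linear 0 (ℕ.+-mono-≤ (annotate-cost β) (annotateAll-cost βs))
    (arith (cost (annotate β)) (cost (annotateAll βs)) k (size β) (sizeAll βs))
    where
    arith : ∀ c cs k s ss → suc (c + (cs + 0)) + suc k * 3 + (5 * s + (1 + 5 * ss)) + 0 ≡
                            c + 4 + (cs + k * 3) + (1 + 5 * (s + ss))
    arith = solve-∀

  lastChild-cost : ∀ {k} (v : Vec (ATree n) (suc k)) → cost (lastChild v) ≡ suc k
  lastChild-cost (_ ∷ [])         = refl
  lastChild-cost (_ ∷ βs@(_ ∷ _)) = cong suc (lastChild-cost βs)

module _ {c ℓ₁ ℓ₂} (V : DecTotalOrder c ℓ₁ ℓ₂) {n : ℕ} (d : Fin n → Fin n → DecTotalOrder.Carrier V) where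

  if-cost : ∀ {a} {A : Set a} b {r : A} (m : Timed A) → cost (if b then return r else m) ≤ cost m
  if-cost true  m = z≤n
  if-cost false m = ℕ.≤-refl

  -- A round costs 8: the call, four accesses to `d` and three comparisons.
  scan-cost : ∀ {k} a z p (v : Vec (ATree n) (suc k)) → cost (scan V d a z p v) ≤ 1 + k * 8
  scan-cost a z p (β ∷ [])         = ℕ.≤-refl
  scan-cost a z p (β ∷ βs@(next ∷ _)) = ℕ.+-monoʳ-≤ 8
    (ℕ.≤-trans (if-cost (dist≡ a β p β ∧ dist≡ p β β next ∧ dist≡ β next β z)
                        (scan V d a z β βs >>= λ r → return (Maybe.map (map₂ suc) r)))
    (ℕ.≤-trans (ℕ.≤-reflexive (ℕ.+-identityʳ _)) (scan-cost a z β βs)))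
    where
    dist≡ : ATree n → ATree n → ATree n → ATree n → Bool
    dist≡ α β γ δ = value (equal? V d (d (someLeaf α) (someLeaf β)) (d (someLeaf γ) (someLeaf δ)))

  -- Per child, 8 units go to `scan` and 1 to `lastChild`; the fixed part is absorbed since there
  -- are at least three children.
  findApex-cost : ∀ {k} (v : Vec (ATree n) (3 + k)) → cost (findApex V d v) ≤ (3 + k) * 9
  findApex-cost {k} (β ∷ βs) = linear 15
    (ℕ.+-mono-≤ (ℕ.≤-reflexive (lastChild-cost βs)) (scan-cost β (value (lastChild βs)) β βs))
    (arith (cost (lastChild βs)) (cost (scan V d β (value (lastChild βs)) β βs)) k)
    where
    arith : ∀ l s k → suc (l + (s + 0)) + (suc (suc k) + (1 + suc k * 8)) + 15 ≡ l + s + (3 + k) * 9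
    arith = solve-∀

  ρ-cost : ∀ l {k} (v : Vec (ATree n) (2 + k)) → cost (ρ V d (node l v)) ≤ 1 + (2 + k) * 9
  ρ-cost (P , _)         (_ ∷ _ ∷ _)  = s≤s (s≤s z≤n)
  ρ-cost (Q , _) {zero}  (_ ∷ _ ∷ []) = s≤s (s≤s z≤n)
  ρ-cost (Q , _) {suc k} v = s≤s (ℕ.≤-trans (ℕ.≤-reflexive (ℕ.+-identityʳ _)) (findApex-cost v))

  reaches?-cost : ∀ δ r → cost (reaches? V d δ r) ≤ 2
  reaches?-cost δ nothing  = s≤s z≤n
  reaches?-cost δ (just _) = ℕ.≤-refl

  -- The cost of ρ is charged to its argument: it is called only on the apex
  -- child, by the parent.
  mmod-cost     : ∀ (A : ATree n) → cost (mmod V d A) + cost (ρ V d A) + 60 ≤ 62 * size A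
  attach-cost   : ∀ b T₀ (A : ATree n) → cost (attach V d b T₀ A) + cost (ρ V d A) + 59 ≤ 62 * size A
  -- One unit of the reserve of 60 of each child pays for its list cell.
  mmodAll-cost  : ∀ {k} (As : Vec (ATree n) k) → cost (mmodAll V d As) + k * 59 ≤ 1 + 62 * sizeAll As
  -- A child before the apex is passed by `mmodAllBut` and by `mmodApex`, which takes two units of
  -- its reserve and leaves 58.
  conical-cost  : ∀ {k} δ T₀ i (As : Vec (ATree n) (suc k)) →
                  cost (mmodAllBut V d i As) + cost (mmodApex V d δ T₀ i As) + suc k * 58 ≤ 4 + 62 * sizeAll As
  mmodQ-cost    : ∀ {k} r (As : Vec (ATree n) (3 + k)) → cost (mmodQ V d r As) + (3 + k) * 58 ≤ 5 + 62 * sizeAll As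

  -- Besides the nodes handled by `mmodAll` directly, this covers a merged apex child: `mmod` is not
  -- called on it, but the calls on its children and the call of `ρ` are charged to it.
  plain-cost : ∀ l {k} (As : Vec (ATree n) (2 + k)) →
               suc (cost (mmodAll V d As) + 0) + cost (ρ V d (node l As)) + 60 ≤ 62 * sizeAll As
  plain-cost l {k} As = linear (37 + k * 50) (ℕ.+-mono-≤ (mmodAll-cost As) (ρ-cost l As))
    (arith (cost (mmodAll V d As)) (cost (ρ V d (node l As))) k (sizeAll As))
    where
    arith : ∀ c r k s → suc (c + 0) + r + 60 + (1 + 62 * s + (1 + (2 + k) * 9)) + (37 + k * 50) ≡
                        c + (2 + k) * 59 + r + 62 * s
    arith = solve-∀

  -- A leaf accounts for the factor 62: one unit each for `mmod` and `ρ`, and the reserve of 60.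
  mmod-cost (leaf x)                      = ℕ.≤-refl
  mmod-cost (node l@(P , _) As)           = plain-cost l As
  mmod-cost (node l@(Q , _) {zero} As)    = plain-cost l As
  -- Searching for the apex here and again in `ρ` takes 9 units per child each time; the remaining
  -- 40 of 58 per child cover the reserve of the node.
  mmod-cost (node l@(Q , _) {suc k} As)   = linear (53 + k * 40)
    (ℕ.+-mono-≤ (ℕ.+-mono-≤ (findApex-cost As) (mmodQ-cost (value (findApex V d As)) As)) (ρ-cost l As))
    (arith (cost (findApex V d As)) (cost (mmodQ V d (value (findApex V d As)) As)) (cost (ρ V d (node l As))) k (sizeAll As))
    where
    arith : ∀ f q r k s → suc (f + q) + r + 60 + ((3 + k) * 9 + (5 + 62 * s) + (1 + (3 + k) * 9)) + (53 + k * 40) ≡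
                          f + (q + (3 + k) * 58) + r + 62 * s
    arith = solve-∀

  attach-cost false T₀ A = linear 0 (mmod-cost A) (arith (cost (mmod V d A)) (cost (ρ V d A)) (size A))
    where
    arith : ∀ m r s → suc (m + 0) + r + 59 + 62 * s + 0 ≡ m + r + 60 + 62 * s
    arith = solve-∀
  attach-cost true T₀ (leaf x)    = ℕ.n≤1+n 61
  attach-cost true T₀ (node l As) = ℕ.≤-trans (ℕ.+-monoʳ-≤ (suc (cost (mmodAll V d As) + 0) + cost (ρ V d (node l As))) (ℕ.n≤1+n 59)) (plain-cost l As)

  mmodAll-cost []       = ℕ.≤-refl
  mmodAll-cost (_∷_ {k} A As) = linear (cost (ρ V d A)) (ℕ.+-mono-≤ (mmod-cost A) (mmodAll-cost As))
    (arith (cost (mmod V d A)) (cost (ρ V d A)) (cost (mmodAll V d As)) k (size A) (sizeAll As))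
    where
    arith : ∀ m r c k s ss → suc (m + (c + 0)) + suc k * 59 + (62 * s + (1 + 62 * ss)) + r ≡
                             m + r + 60 + (c + k * 59) + (1 + 62 * (s + ss))
    arith = solve-∀

  conical-cost {k} δ T₀ zero (A ∷ As) = linear k
    (ℕ.+-mono-≤ (ℕ.+-mono-≤ (reaches?-cost δ (value (ρ V d A))) (attach-cost b T₀ A)) (mmodAll-cost As))
    (arith (cost (reaches? V d δ (value (ρ V d A)))) (cost (attach V d b T₀ A)) (cost (ρ V d A)) (cost (mmodAll V d As)) k (size A) (sizeAll As))
    where
    b = value (reaches? V d δ (value (ρ V d A)))
    arith : ∀ e t r c k s ss → suc c + suc (r + (e + t)) + suc k * 58 + (2 + 62 * s + (1 + 62 * ss)) + k ≡
                               e + (t + r + 59) + (c + k * 59) + (4 + 62 * (s + ss))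
    arith = solve-∀
  conical-cost {suc k} δ T₀ (suc i) (A ∷ As) = linear (cost (ρ V d A)) (ℕ.+-mono-≤ (mmod-cost A) (conical-cost δ T₀ i As))
    (arith (cost (mmod V d A)) (cost (ρ V d A)) (cost (mmodAllBut V d i As)) (cost (mmodApex V d δ T₀ i As)) k (size A) (sizeAll As))
    where
    arith : ∀ m r u v k s ss → suc (m + (u + 0)) + suc v + suc (suc k) * 58 + (62 * s + (4 + 62 * ss)) + r ≡
                               m + r + 60 + (u + v + suc k * 58) + (4 + 62 * (s + ss))
    arith = solve-∀

  mmodQ-cost {k} nothing As = linear (6 + k) (mmodAll-cost As) (arith (cost (mmodAll V d As)) k (sizeAll As))
    where
    arith : ∀ c k s → suc (c + 0) + (3 + k) * 58 + (1 + 62 * s) + (6 + k) ≡ c + (3 + k) * 59 + (5 + 62 * s)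
    arith = solve-∀
  mmodQ-cost (just (δ , i)) As = s≤s (conical-cost δ (withoutApex V d (value (mmodAllBut V d i As))) i As)

  -- The factor is 5 for the annotation plus 62 for `mmod`; the reserves cover the initial call.
  mmodTree-cost : ∀ (T : PQTree n) → cost (mmodTree V d T) ≤ 67 * size T
  mmodTree-cost T = linear (63 + cost (ρ V d A)) (ℕ.+-mono-≤ (annotate-cost T) mmod≤)
    (arith (cost (annotate T)) (cost (mmod V d A)) (cost (ρ V d A)) (size T))
    where
    A = value (annotate T)
    mmod≤ : cost (mmod V d A) + cost (ρ V d A) + 60 ≤ 62 * size T
    mmod≤ = subst (λ s → cost (mmod V d A) + cost (ρ V d A) + 60 ≤ 62 * s) (annotate-size T) (mmod-cost A)
    arith : ∀ a m r s → suc (a + m) + (5 * s + 62 * s) + (63 + r) ≡ a + 4 + (m + r + 60) + 67 * s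
    arith = solve-∀

size≡ : ∀ {n} (T : PQTree n) → IsXTree T → size T ≡ n
size≡ {n} T isXTree = begin
  size T                ≡⟨ length-leaves T ⟨
  length (leaves T)     ≡⟨ Perm↭.↭-length isXTree ⟩
  length (List.allFin n) ≡⟨ List.length-tabulate {n = n} id ⟩
  n                     ∎
  where open ≡-Reasoning

theorem5p2 : ∀ {c ℓ₁ ℓ₂ : Level} →
    ∃ λ (C : ℕ) →
    (V : DecTotalOrder c ℓ₁ ℓ₂) (0# : DecTotalOrder.Carrier V) (n : ℕ)
    (d : Fin n → Fin n → DecTotalOrder.Carrier V) →
    IsDissimilarity V 0# d → Robinson V d →
    (T : PQTree n) → IsPQTreeOf V d T →
    IsMmoduleTree V d (value (mmodTree V d T)) × cost (mmodTree V d T) ≤ C * n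
theorem5p2 = 67 , λ V 0# n d isD _ T isPQ →
  Space.mmodTree-correct V 0# d isD isPQ ,
  subst (λ s → cost (mmodTree V d T) ≤ 67 * s) (size≡ T (IsPQTreeOf.isXTree isPQ)) (mmodTree-cost V d T)
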